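{- There is an algorithm that is FPT w.r.t. $(\overline{W},\alpha)$ for the unit-length \textsc{Spanner} problem: given a connected undirected graph $G=(V,E)$ with $n=|V|$, $m=|E|$, edge weights $w\colon E\to\mathbb{N}_{\ge0}$, unit edge lengths $\ell(e)=1$ for all $e\in E$, a stretch factor $\alpha\ge 1$ and $\overline{W}\in\mathbb{N}$, the algorithm decides whether $G$ has an $\alpha$-spanner $H=(V,F)$ with $w(E\setminus F)\ge\overline{W}$, and returns such a witness $H$ if it exists, in $$\mathcal{O}\big(\overline{W}^{\,2\overline{W}+1}\alpha^{2\overline{W}}\cdot m+nm\big)$$ time.
   Context: For a subgraph $G'\subseteq G$ and $u,v\in V$, $\ell_{G'}[u,v]$ is the length of a shortest $u$-$v$-path in $G'$ w.r.t. $\ell$. A subgraph $H=(V,F)$, $F\subseteq E$, is an $\alpha$-spanner of $G$ if $\ell_H[u,v]\le\alpha\,\ell_G[u,v]$ for all $u,v\in V$; equivalently, for all $\{u,v\}\in E$. For a set $X$ of edges, $w(X)=\sum_{e\in X}w(e)$. An algorithm is FPT w.r.t. a (possibly combined) parameter $k$ if on instance $I$ it runs in $\mathcal{O}(f(k)\cdot p(\langle I\rangle))$ time for a computable function $f$ and a polynomial $p$ in the encoding length $\langle I\rangle$. -}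

module Defs where

open import Data.Bool using (if_then_else_)
open import Data.Fin using (Fin; toℕ)
open import Data.Fin.Subset using (Subset; _∈_; ⊤; ∁)
open import Data.Fin.Subset.Properties using (_∈?_)
open import Data.Integer using (+_; ∣_∣)
open import Data.List using (List; []; _∷_; [_]; _++_; map; sum; filter; foldr; concatMap; allFin)
open import Data.List.Relation.Unary.Unique.Propositional using (Unique)
open import Data.Nat using (ℕ; zero; suc; _+_; _*_; _∸_; _≤_; _≥_; _≟_)
open import Data.Nat.Logarithm using (⌊log₂_⌋)
open import Data.Product using (Σ-syntax; ∃-syntax; _×_)
open import Data.Rational as ℚ using (ℚ; 1ℚ; ↥_; ↧ₙ_)
open import Data.Sum using (_⊎_)
open import Data.Vec as Vec using (Vec; []; _∷_; lookup)
open import Relation.Binary.PropositionalEquality using (_≡_; _≢_)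
open import Relation.Nullary using (¬_; does)

open import Algebra.Definitions.RawSemiring ℚ.+-*-rawSemiring public
  using () renaming (_^_ to _^ℚ_)

fromℕ : ℕ → ℚ
fromℕ k = (+ k) ℚ./ 1

------------------------------------------------------------------------
-- Graphs and spanners

-- Finite simple undirected graphs with vertex set Fin n and edge set
-- Fin m.  The orientation of an edge (which endpoint is src) is
-- arbitrary.

record Graph (n m : ℕ) : Set where
  field
    src tgt : Fin m → Fin n

  Joins : Fin m → Fin n → Fin n → Set
  Joins e u v = (src e ≡ u × tgt e ≡ v) ⊎ (src e ≡ v × tgt e ≡ u)

  field
    loopless   : ∀ e → src e ≢ tgt e
    noParallel : ∀ {e f} → Joins e (src f) (tgt f) → e ≡ f

module _ {n m : ℕ} (G : Graph n m) where
  open Graph G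

  -- A subset F of the edges stands for the spanning subgraph (V , F);
  -- G itself is ⊤.

  data Walk (F : Subset m) : Fin n → Fin n → Set where
    nil  : ∀ {u} → Walk F u u
    cons : ∀ {u x v} (e : Fin m) → e ∈ F → Joins e u x → Walk F x v → Walk F u v

  module _ {F : Subset m} where

    vertices : ∀ {u v} → Walk F u v → List (Fin n)
    vertices {u} nil            = [ u ]
    vertices {u} (cons _ _ _ p) = u ∷ vertices p

    edges : ∀ {u v} → Walk F u v → List (Fin m)
    edges nil            = []
    edges (cons e _ _ p) = e ∷ edges p

    IsPath : ∀ {u v} → Walk F u v → Set
    IsPath p = Unique (vertices p)

    length : (Fin m → ℕ) → ∀ {u v} → Walk F u v → ℕ
    length ℓ p = sum (map ℓ (edges p))

  Connected : Set
  Connected = ∀ u v → Σ[ p ∈ Walk ⊤ u v ] IsPath p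

  IsDistance : (Fin m → ℕ) → Subset m → Fin n → Fin n → ℕ → Set
  IsDistance ℓ F u v d =
    (Σ[ p ∈ Walk F u v ] IsPath p × length ℓ p ≡ d) ×
    (∀ (p : Walk F u v) → IsPath p → d ≤ length ℓ p)

  -- Distances are relational because they may be infinite: the
  -- existence of d′ says that the distance in (V , F) is finite.

  IsSpanner : (Fin m → ℕ) → ℚ → Subset m → Set
  IsSpanner ℓ α F = ∀ u v d → IsDistance ℓ ⊤ u v d →
    ∃[ d′ ] (IsDistance ℓ F u v d′ × fromℕ d′ ℚ.≤ α ℚ.* fromℕ d)

weight : ∀ {m} → (Fin m → ℕ) → Subset m → ℕ
weight {m} w X = sum (map w (filter (_∈? X) (allFin m)))

unitLength : ∀ {m} → Fin m → ℕ
unitLength _ = 1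

record Instance : Set where
  field
    n m       : ℕ
    G         : Graph n m
    connected : Connected G
    w         : Fin m → ℕ
    α         : ℚ
    1≤α       : 1ℚ ℚ.≤ α
    W̄         : ℕ

IsSolution : (I : Instance) → Subset (Instance.m I) → Set
IsSolution I F = IsSpanner G unitLength α F × weight w (∁ F) ≥ W̄
  where open Instance I

------------------------------------------------------------------------
-- Random access machine
--
-- Structured programs over registers and an indirectly addressed
-- memory, both holding natural numbers, at uniform cost: every
-- instruction and every test takes one step.  The only arithmetic is
-- addition and truncated subtraction: with unit-cost multiplication or
-- division, step counts would no longer be polynomially related to
-- Turing machine time.

Reg : Set
Reg = ℕ

data Instr : Set where
  const : Reg → ℕ → Instr
  add   : Reg → Reg → Reg → Instr
  sub   : Reg → Reg → Reg → Instr
  load  : Reg → Reg → Instr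
  store : Reg → Reg → Instr

infixr 5 _⨾_

data Program : Set where
  skip    : Program
  exec    : Instr → Program
  _⨾_     : Program → Program → Program
  if≢0    : Reg → Program → Program → Program
  while≢0 : Reg → Program → Program

record State : Set where
  constructor ⟨_,_⟩
  field
    reg : Reg → ℕ
    mem : ℕ → ℕ
open State public

_[_↦_] : (ℕ → ℕ) → ℕ → ℕ → (ℕ → ℕ)
(g [ a ↦ x ]) b = if does (b ≟ a) then x else g b

step : Instr → State → State
step (const r k) ⟨ ρ , μ ⟩ = ⟨ ρ [ r ↦ k ] , μ ⟩
step (add r s t) ⟨ ρ , μ ⟩ = ⟨ ρ [ r ↦ ρ s + ρ t ] , μ ⟩
step (sub r s t) ⟨ ρ , μ ⟩ = ⟨ ρ [ r ↦ ρ s ∸ ρ t ] , μ ⟩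
step (load r s)  ⟨ ρ , μ ⟩ = ⟨ ρ [ r ↦ μ (ρ s) ] , μ ⟩
step (store r s) ⟨ ρ , μ ⟩ = ⟨ ρ , μ [ ρ r ↦ ρ s ] ⟩

-- P , σ ⇓[ t ] σ′ : started in σ, P halts in σ′ after exactly t steps.

infix 4 _,_⇓[_]_

data _,_⇓[_]_ : Program → State → ℕ → State → Set where
  ⇓skip : ∀ {σ} → skip , σ ⇓[ 1 ] σ
  ⇓exec : ∀ {i σ} → exec i , σ ⇓[ 1 ] step i σ
  ⇓seq  : ∀ {P Q σ σ′ σ″ s t} →
          P , σ ⇓[ s ] σ′ → Q , σ′ ⇓[ t ] σ″ → P ⨾ Q , σ ⇓[ s + t ] σ″
  ⇓then : ∀ {r P Q σ σ′ t} → reg σ r ≢ 0 →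
          P , σ ⇓[ t ] σ′ → if≢0 r P Q , σ ⇓[ suc t ] σ′
  ⇓else : ∀ {r P Q σ σ′ t} → reg σ r ≡ 0 →
          Q , σ ⇓[ t ] σ′ → if≢0 r P Q , σ ⇓[ suc t ] σ′
  ⇓loop : ∀ {r P σ σ′ σ″ s t} → reg σ r ≢ 0 →
          P , σ ⇓[ s ] σ′ → while≢0 r P , σ′ ⇓[ t ] σ″ →
          while≢0 r P , σ ⇓[ suc (s + t) ] σ″
  ⇓exit : ∀ {r P σ} → reg σ r ≡ 0 → while≢0 r P , σ ⇓[ 1 ] σ

-- The input occupies an initial segment of the memory; all other cells
-- and all registers are 0.

contents : List ℕ → ℕ → ℕ
contents []       _       = 0
contents (x ∷ _)  zero    = x
contents (_ ∷ xs) (suc a) = contents xs a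

initial : List ℕ → State
initial xs = ⟨ (λ _ → 0) , contents xs ⟩

Computable : ∀ {k} → (Vec ℕ k → ℕ) → Set
Computable f = ∃[ Q ] ∀ v → ∃[ t ] ∃[ σ ]
  (Q , initial (Vec.toList v) ⇓[ t ] σ × mem σ 0 ≡ f v)

------------------------------------------------------------------------
-- Algorithms for the unit-length spanner problem

-- α is given by its numerator and denominator in lowest terms; the
-- edges are listed in order, each as its two endpoints and its weight.

encode : Instance → List ℕ
encode I = n ∷ m ∷ W̄ ∷ ∣ ↥ α ∣ ∷ ↧ₙ α ∷
  concatMap (λ e → toℕ (src e) ∷ toℕ (tgt e) ∷ w e ∷ []) (allFin m)
  where
  open Instance I
  open Graph G

-- Total number of bits of the numbers in the encoding; 0 counts as one
-- bit, as ⌊log₂ 0 ⌋ is 0.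

encodingLength : Instance → ℕ
encodingLength I = sum (map (λ x → suc ⌊log₂ x ⌋) (encode I))

-- Cell 0 of the final memory is the answer (1 for yes, 0 for no).  For
-- yes, the cells 1 , … , m hold the characteristic vector of a witness.

CorrectOutput : Instance → State → Set
CorrectOutput I σ =
  (mem σ 0 ≡ 1 × ∃[ F ] (IsSolution I F ×
    (∀ e → mem σ (suc (toℕ e)) ≡ (if lookup F e then 1 else 0)))) ⊎
  (mem σ 0 ≡ 0 × ¬ (∃[ F ] IsSolution I F))

SolvesSpanner : Program → Set
SolvesSpanner P = ∀ I → ∃[ t ] ∃[ σ ]
  (P , initial (encode I) ⇓[ t ] σ × CorrectOutput I σ)

-- Running time in O(g).  The summand 1 matters only where g vanishes
-- (for a single vertex, nm = 0): running times are never 0.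

RunsInO : (Instance → ℚ) → Program → Set
RunsInO g P = ∃[ C ] ∀ I → ∃[ t ] ∃[ σ ]
  (P , initial (encode I) ⇓[ t ] σ ×
   fromℕ t ℚ.≤ fromℕ C ℚ.* (g I ℚ.+ 1ℚ))

evalPoly : List ℕ → ℕ → ℕ
evalPoly cs x = foldr (λ c y → c + x * y) 0 cs

IsFPT : ∀ {k} → (Instance → Vec ℕ k) → Program → Set
IsFPT {k} κ P = Σ[ f ∈ (Vec ℕ k → ℕ) ] ∃[ p ]
  (Computable f ×
   RunsInO (λ I → fromℕ (f (κ I) * evalPoly p (encodingLength I))) P)

-- The combined parameter (W̄ , α), with α as numerator and denominator.

parameter : Instance → Vec ℕ 3
parameter I = W̄ ∷ ∣ ↥ α ∣ ∷ ↧ₙ α ∷ []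
  where open Instance I

timeBound : Instance → ℚ
timeBound I =
  fromℕ W̄ ^ℚ (2 * W̄ + 1) ℚ.* α ^ℚ (2 * W̄) ℚ.* fromℕ m ℚ.+ fromℕ (n * m)
  where open Instance I

{-# OPTIONS --safe #-}

-- Let A be the integral part of α, or n if that is smaller.  A solution
-- may be assumed to remove at most W̄ edges, all of positive weight, and
-- then each of them has a detour: a path of length at most A between its
-- ends that avoids it.  Fix one detour for every such edge.  In the
-- digraph with an arc from e to the edges of its detour, out-degrees are
-- at most A, so some vertex has in-degree at most A as well; choosing it
-- and discarding its neighbours, one gets from (2A + 1) W̄ edges W̄ edges
-- none of which is on the detour of another, and these can be removed
-- together.  Hence it suffices to keep (2A + 1) W̄ edges with a detour
-- (or all of them, if there are fewer) and to try all sequences of W̄ of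
-- them, padded by a dummy edge, with W̄ breadth-first searches each.
--
-- The edges with a detour are found in time O(nm) by one breadth-first
-- search per vertex u: a shortest detour of an edge uv enters the branch
-- of v in the search tree once, by an edge xy, and its length is
-- d(u,x) + d(u,y).
--
-- A breadth-first search is one loop of 2m + n + 2 iterations, each of
-- which scans an arc, dequeues a vertex or is idle, so that the running
-- time of a program can be read off from its text and the loop counts.

module Submission where

open import Defs
open import Data.Bool using (Bool; true; false; not; if_then_else_)
open import Data.Fin as Fin using (Fin; toℕ; fromℕ<; #_)
import Data.Fin.Properties as Finₚ
open import Data.Fin.Subset using (Subset; ⊤; ∁)
import Data.Fin.Subset as Subset
import Data.Fin.Subset.Properties as Subsetₚ
import Data.Integer as ℤ
import Data.Integer.Properties as ℤₚ
open import Data.List as List using (List; []; _∷_; _++_; map; filter; downFrom; take; applyUpTo)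
import Data.List.Properties as Listₚ
open import Data.List.Membership.Propositional as Membership using (_∈_; _∉_)
import Data.List.Membership.Propositional.Properties as ∈ₚ
open import Data.List.Membership.DecPropositional using () renaming (_∈?_ to member?)
open import Data.List.Relation.Binary.Subset.Propositional using (_⊆_)
open import Data.List.Relation.Unary.All as All using (All; []; _∷_)
open import Data.List.Relation.Unary.AllPairs using ([]; _∷_)
open import Data.List.Relation.Unary.Any as Any using (here; there)
open import Data.List.Relation.Unary.Unique.Propositional using (Unique)
import Data.List.Relation.Unary.Unique.Propositional.Properties as Uniqueₚ
open import Data.Nat
open import Data.Nat.DivMod using (_%_; [m+kn]%n≡m%n; m<n⇒m%n≡m)
open import Data.Nat.Logarithm using (⌊log₂_⌋)
open import Data.Nat.ListAction using (sum)
open import Data.Nat.Properties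
open import Algebra.Properties.CommutativeSemigroup +-commutativeSemigroup using (x∙yz≈y∙xz; interchange)
open import Data.Nat.ListAction.Properties using (sum-++)
open import Data.Nat.Tactic.RingSolver using (solve-∀)
open import Data.Product using (Σ-syntax; ∃-syntax; _×_; _,_; proj₁; proj₂)
open import Data.Rational as ℚ using (ℚ; 1ℚ; 0ℚ)
import Data.Rational.Properties as ℚₚ
open import Data.Sum as Sum using (_⊎_; inj₁; inj₂)
open import Data.Vec as Vec using (Vec; []; _∷_; lookup)
import Data.Vec.Properties as Vecₚ
open import Function using (_∘_; id; case_of_)
open import Relation.Binary.Definitions using (tri<; tri≈; tri>)
open import Relation.Binary.PropositionalEquality
open import Relation.Nullary using (Dec; yes; no; does; ¬_; contradiction)
open import Relation.Nullary.Decidable using (_×-dec_; ¬?; map′; dec-true; dec-false)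
import Data.Nat.Coprimality as Coprimality
import Data.Rational.Unnormalised as ℚᵘ
import Data.Rational.Unnormalised.Properties as ℚᵘₚ

-- One search per edge would find the detours in O(m^2), which the term nm does not cover; so a
-- single search from `u` must settle all edges with source `u`. The enumeration has room to spare:
-- for W > 0, at most 4AW choices for each of W positions make (4AW)^W trials of O(W) linear passes,
-- and 4^W is at most 256 W^W, so that one factor W^W of the bound pays for constants. A search
-- takes O(m) rather than O(n + m) because a connected graph with an edge has n ≤ 2m; graphs without
-- edges are answered separately. That W removed edges suffice rests on the weights being integers:
-- W edges of positive weight weigh W already, and putting other edges back harms no detour. Without
-- multiplication and division, powers and quotients come from repeated addition and subtraction;
-- capping the stretch at n, which no distance reaches, keeps the division within n rounds. Since
-- loop counts are read-only, the program has three stages, each computing loop counts for the next.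

-- Updates of functions, quotients and remainders

update-same : ∀ g a x → (g [ a ↦ x ]) a ≡ x
update-same g a x rewrite dec-true (a ≟ a) refl = refl

update-other : ∀ g {a b} x → b ≢ a → (g [ a ↦ x ]) b ≡ g b
update-other g {a} {b} x b≢a rewrite dec-false (b ≟ a) b≢a = refl

-- Uniqueness of quotient and remainder. It separates register classes (modulus 4), interleaved
-- arrays (modulus 16) and the digits of numerals (modulus a power of the base).
*-inj-remainder : ∀ S .{{_ : NonZero S}} {k l i j} → k < S → l < S →
  k + i * S ≡ l + j * S → k ≡ l × i ≡ j
*-inj-remainder S {k} {l} {i} {j} k<S l<S eq = k≡l , i≡j
  where
  k≡l : k ≡ l
  k≡l = begin
    k               ≡⟨ m<n⇒m%n≡m k<S ⟨
    k % S           ≡⟨ [m+kn]%n≡m%n k i S ⟨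
    (k + i * S) % S ≡⟨ cong (_% S) eq ⟩
    (l + j * S) % S ≡⟨ [m+kn]%n≡m%n l j S ⟩
    l % S           ≡⟨ m<n⇒m%n≡m l<S ⟩
    l               ∎
    where open ≡-Reasoning
  i≡j : i ≡ j
  i≡j = *-cancelʳ-≡ i j S
    (+-cancelˡ-≡ k _ _ (trans eq (cong (_+ j * S) (sym k≡l))))

-- A structured language over the RAM

-- Variables and arrays are writable; parameters and tables are
-- read-only, and a for-loop takes its count from a parameter.  The cells
-- are those of the input and the output: beyond the bound of the
-- environment they read as 0 and are not written.  The purpose of call c
-- is to keep wp from unfolding c.

Array : Set
Array = Fin 8

infixl 6 _⊕_ _⊖_
infix  4 _≺_ _≃_
infixr 3 _∧_
infix  5 ∼_
infix  2 _≔_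
infixr 1 _﹔_

data Exp : Set where
  lit var par : ℕ → Exp
  _⊕_ _⊖_     : Exp → Exp → Exp
  get fix     : Array → Exp → Exp
  cell        : Exp → Exp

data Test : Set where
  _≺_ _≃_ : Exp → Exp → Test
  _∧_     : Test → Test → Test
  ∼_      : Test → Test

data Cmd : Set where
  pass : Cmd
  _≔_  : ℕ → Exp → Cmd
  put  : Array → Exp → Exp → Cmd
  out  : Exp → Exp → Cmd
  _﹔_  : Cmd → Cmd → Cmd
  when_then_else_ : Test → Cmd → Cmd → Cmd
  for  : ℕ → Cmd → Cmd
  call : Cmd → Cmd

record Env : Set where
  constructor env
  field
    params : ℕ → ℕ
    tables : Array → ℕ → ℕ
    bound  : ℕ
open Env public

record Store : Set where
  constructor ⟪_,_,_⟫
  field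
    vars  : ℕ → ℕ
    arrs  : Array → ℕ → ℕ
    cells : ℕ → ℕ
open Store public

setArr : (Array → ℕ → ℕ) → Array → ℕ → ℕ → Array → ℕ → ℕ
setArr α k i x l = if does (l Finₚ.≟ k) then α k [ i ↦ x ] else α l

iterate : {A : Set} → ℕ → (A → A) → A → A
iterate zero    f x = x
iterate (suc k) f x = iterate k f (f x)

module Semantics (η : Env) where

  ⟦_⟧ : Exp → Store → ℕ
  ⟦ lit k ⟧   s = k
  ⟦ var x ⟧   s = vars s x
  ⟦ par x ⟧   s = params η x
  ⟦ e ⊕ e′ ⟧  s = ⟦ e ⟧ s + ⟦ e′ ⟧ s
  ⟦ e ⊖ e′ ⟧  s = ⟦ e ⟧ s ∸ ⟦ e′ ⟧ s
  ⟦ get k e ⟧ s = arrs s k (⟦ e ⟧ s)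
  ⟦ fix k e ⟧ s = tables η k (⟦ e ⟧ s)
  ⟦ cell e ⟧  s = if does (⟦ e ⟧ s <? bound η) then cells s (⟦ e ⟧ s) else 0

  Holds : Test → Store → Set
  Holds (e ≺ e′) s = ⟦ e ⟧ s < ⟦ e′ ⟧ s
  Holds (e ≃ e′) s = ⟦ e ⟧ s ≡ ⟦ e′ ⟧ s
  Holds (b ∧ b′) s = Holds b s × Holds b′ s
  Holds (∼ b)    s = ¬ Holds b s

  holds? : ∀ b s → Dec (Holds b s)
  holds? (e ≺ e′) s = ⟦ e ⟧ s <? ⟦ e′ ⟧ s
  holds? (e ≃ e′) s = ⟦ e ⟧ s ≟ ⟦ e′ ⟧ s
  holds? (b ∧ b′) s = holds? b s ×-dec holds? b′ s
  holds? (∼ b)    s = ¬? (holds? b s)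

  setVar : ℕ → ℕ → Store → Store
  setVar x v s = ⟪ vars s [ x ↦ v ] , arrs s , cells s ⟫

  setArray : Array → ℕ → ℕ → Store → Store
  setArray k i v s = ⟪ vars s , setArr (arrs s) k i v , cells s ⟫

  setCell : ℕ → ℕ → Store → Store
  setCell a v s =
    ⟪ vars s , arrs s , (if does (a <? bound η) then cells s [ a ↦ v ] else cells s) ⟫

  run : Cmd → Store → Store
  run pass                   s = s
  run (x ≔ e)                s = setVar x (⟦ e ⟧ s) s
  run (put k i e)            s = setArray k (⟦ i ⟧ s) (⟦ e ⟧ s) s
  run (out i e)              s = setCell (⟦ i ⟧ s) (⟦ e ⟧ s) s
  run (c ﹔ d)                s = run d (run c s)
  run (when b then c else d) s = if does (holds? b s) then run c s else run d s
  run (for x c)              s = iterate (params η x) (run c) s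
  run (call c)               s = run c s

  -- The wrapper stops `wp` at loops and calls and leaves `c`, `Q` and `s` visible to unification.
  record After (c : Cmd) (Q : Store → Set) (s : Store) : Set where
    constructor after
    field
      holds : Q (run c s)

  -- Assignments and tests reduce by computation, so that only loops need an invariant, which is
  -- given to `wp-for`.
  wp : Cmd → (Store → Set) → Store → Set
  wp pass                   Q s = Q s
  wp (x ≔ e)                Q s = Q (setVar x (⟦ e ⟧ s) s)
  wp (put k i e)            Q s = Q (setArray k (⟦ i ⟧ s) (⟦ e ⟧ s) s)
  wp (out i e)              Q s = Q (setCell (⟦ i ⟧ s) (⟦ e ⟧ s) s)
  wp (c ﹔ d)                Q s = wp c (wp d Q) s
  wp (when b then c else d) Q s = (Holds b s → wp c Q s) × (¬ Holds b s → wp d Q s)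
  wp (for x c)              Q s = After (for x c) Q s
  wp (call c)               Q s = After c Q s

  wp-sound : ∀ c {Q s} → wp c Q s → Q (run c s)
  wp-sound pass        p = p
  wp-sound (x ≔ e)     p = p
  wp-sound (put k i e) p = p
  wp-sound (out i e)   p = p
  wp-sound (c ﹔ d)     p = wp-sound d (wp-sound c p)
  wp-sound (when b then c else d) {s = s} (p , q) with holds? b s
  ... | yes h = wp-sound c (p h)
  ... | no ¬h = wp-sound d (q ¬h)
  wp-sound (for x c)   p = After.holds p
  wp-sound (call c)    p = After.holds p

  wp-complete : ∀ c {Q s} → Q (run c s) → wp c Q s
  wp-complete pass        p = p
  wp-complete (x ≔ e)     p = p
  wp-complete (put k i e) p = p
  wp-complete (out i e)   p = p
  wp-complete (c ﹔ d)     p = wp-complete c (wp-complete d p)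
  wp-complete (when b then c else d) {s = s} p with holds? b s
  ... | yes h = (λ _ → wp-complete c p) , (λ ¬h → contradiction h ¬h)
  ... | no ¬h = (λ h → contradiction h ¬h) , (λ _ → wp-complete d p)
  wp-complete (for x c)   p = after p
  wp-complete (call c)    p = after p

  wp-mono : ∀ c {Q Q′ : Store → Set} {s} → wp c Q s → (∀ s′ → Q s′ → Q′ s′) → wp c Q′ s
  wp-mono c p f = wp-complete c (f _ (wp-sound c p))

  wp-call : ∀ {c Q s} → wp c Q s → wp (call c) Q s
  wp-call {c} p = after (wp-sound c p)

  -- The body cannot write parameters, so the count is known on entry and the invariant may be
  -- indexed by the number of completed iterations.
  wp-for : ∀ x c (Inv : ℕ → Store → Set) {Q : Store → Set} {s} →
    Inv 0 s →
    (∀ i s′ → i < params η x → Inv i s′ → wp c (Inv (suc i)) s′) →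
    (∀ s′ → Inv (params η x) s′ → Q s′) →
    wp (for x c) Q s
  wp-for x c Inv {Q} inv₀ pres done = after (loop (params η x) 0 _ refl inv₀)
    where
    loop : ∀ k i s → i + k ≡ params η x → Inv i s → Q (iterate k (run c) s)
    loop zero    i s eq inv =
      done s (subst (λ j → Inv j s) (trans (sym (+-identityʳ i)) eq) inv)
    loop (suc k) i s eq inv = loop k (suc i) (run c s) (trans (sym (+-suc i k)) eq)
      (wp-sound c (pres i s (≤-trans (m<m+n i z<s) (≤-reflexive eq)) inv))

-- Frame conditions

-- Syntactic and Boolean, so that the frame condition of a concrete command is proved by `refl`.
writesVar : ℕ → Cmd → Bool
writesVar x pass                   = false
writesVar x (y ≔ _)                = does (x ≟ y)
writesVar x (put _ _ _)            = false
writesVar x (out _ _)              = false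
writesVar x (c ﹔ d)                = if writesVar x c then true else writesVar x d
writesVar x (when _ then c else d) = if writesVar x c then true else writesVar x d
writesVar x (for _ c)              = writesVar x c
writesVar x (call c)               = writesVar x c

writesArr : Array → Cmd → Bool
writesArr k pass                   = false
writesArr k (_ ≔ _)                = false
writesArr k (put l _ _)            = does (k Finₚ.≟ l)
writesArr k (out _ _)              = false
writesArr k (c ﹔ d)                = if writesArr k c then true else writesArr k d
writesArr k (when _ then c else d) = if writesArr k c then true else writesArr k d
writesArr k (for _ c)              = writesArr k c
writesArr k (call c)               = writesArr k c

writesCells : Cmd → Bool
writesCells pass                   = false
writesCells (_ ≔ _)                = false
writesCells (put _ _ _)            = false
writesCells (out _ _)              = true
writesCells (c ﹔ d)                = if writesCells c then true else writesCells d
writesCells (when _ then c else d) = if writesCells c then true else writesCells d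
writesCells (for _ c)              = writesCells c
writesCells (call c)               = writesCells c

private
  or-false : ∀ {b c} → (if b then true else c) ≡ false → b ≡ false × c ≡ false
  or-false {false} eq = refl , eq

module Frames (η : Env) where
  open Semantics η

  iterate-frame : ∀ {A : Set} (g : Store → A) {f} → (∀ s → g (f s) ≡ g s) →
    ∀ k s → g (iterate k f s) ≡ g s
  iterate-frame g eq zero    s = refl
  iterate-frame g eq (suc k) s = trans (iterate-frame g eq k _) (eq s)

  var-frame : ∀ x c → writesVar x c ≡ false → ∀ s → vars (run c s) x ≡ vars s x
  var-frame x pass        eq s = refl
  var-frame x (y ≔ e)     eq s rewrite eq = refl
  var-frame x (put k i e) eq s = refl
  var-frame x (out i e)   eq s = refl
  var-frame x (c ﹔ d)     eq s with or-false eq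
  ... | p , q = trans (var-frame x d q _) (var-frame x c p s)
  var-frame x (when b then c else d) eq s with or-false eq | holds? b s
  ... | p , q | yes _ = var-frame x c p s
  ... | p , q | no  _ = var-frame x d q s
  var-frame x (for y c)   eq s =
    iterate-frame (λ s → vars s x) (var-frame x c eq) (params η y) s
  var-frame x (call c)    eq s = var-frame x c eq s

  arr-frame : ∀ k c → writesArr k c ≡ false → ∀ s → arrs (run c s) k ≡ arrs s k
  arr-frame k pass        eq s = refl
  arr-frame k (y ≔ e)     eq s = refl
  arr-frame k (put l i e) eq s rewrite eq = refl
  arr-frame k (out i e)   eq s = refl
  arr-frame k (c ﹔ d)     eq s with or-false eq
  ... | p , q = trans (arr-frame k d q _) (arr-frame k c p s)
  arr-frame k (when b then c else d) eq s with or-false eq | holds? b s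
  ... | p , q | yes _ = arr-frame k c p s
  ... | p , q | no  _ = arr-frame k d q s
  arr-frame k (for y c)   eq s =
    iterate-frame (λ s → arrs s k) (arr-frame k c eq) (params η y) s
  arr-frame k (call c)    eq s = arr-frame k c eq s

  cells-frame : ∀ c → writesCells c ≡ false → ∀ s → cells (run c s) ≡ cells s
  cells-frame pass        eq s = refl
  cells-frame (y ≔ e)     eq s = refl
  cells-frame (put l i e) eq s = refl
  cells-frame (c ﹔ d)     eq s with or-false eq
  ... | p , q = trans (cells-frame d q _) (cells-frame c p s)
  cells-frame (when b then c else d) eq s with or-false eq | holds? b s
  ... | p , q | yes _ = cells-frame c p s
  ... | p , q | no  _ = cells-frame d q s
  cells-frame (for y c)   eq s =
    iterate-frame cells (cells-frame c eq) (params η y) s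
  cells-frame (call c)    eq s = cells-frame c eq s

  record Unchanged (c : Cmd) (s s′ : Store) : Set where
    field
      var≡   : ∀ x → writesVar x c ≡ false → vars s′ x ≡ vars s x
      arr≡   : ∀ k → writesArr k c ≡ false → arrs s′ k ≡ arrs s k
      cells≡ : writesCells c ≡ false → cells s′ ≡ cells s

  -- Whatever `c` does not write is known to be unchanged afterwards, and the invariants of its
  -- loops need not carry it.
  wp-frame : ∀ c {Q Q′ : Store → Set} {s} → wp c Q s →
    (∀ s′ → Unchanged c s s′ → Q s′ → Q′ s′) → wp c Q′ s
  wp-frame c p f = wp-complete c (f _ record
    { var≡   = λ x eq → var-frame x c eq _
    ; arr≡   = λ k eq → arr-frame k c eq _
    ; cells≡ = λ eq → cells-frame c eq _
    } (wp-sound c p))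

-- Running times of the structured language

expTime : Exp → ℕ
expTime (lit _)   = 1
expTime (var _)   = 2
expTime (par _)   = 2
expTime (e ⊕ e′)  = expTime e + (expTime e′ + 1)
expTime (e ⊖ e′)  = expTime e + (expTime e′ + 1)
expTime (get _ e) = expTime e + (7 + 1)
expTime (fix _ e) = expTime e + (7 + 1)
expTime (cell e)  = expTime e + (1 + 2)

testTime : Test → ℕ
testTime (e ≺ e′) = expTime e + (expTime e′ + 2)
testTime (e ≃ e′) = expTime (e ⊖ e′) + (expTime (e′ ⊖ e) + 2)
testTime (b ∧ b′) = testTime b + testTime b′
testTime (∼ b)    = testTime b

-- Loop counts come from `π` alone and a test is charged its dearer branch, which makes the time
-- independent of the store.
time : (ℕ → ℕ) → Cmd → ℕ
time π pass                   = 1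
time π (x ≔ e)                = expTime e + 2
time π (put k i e)            = expTime i + (7 + (expTime e + 1))
time π (out i e)              = expTime i + (expTime e + 3)
time π (c ﹔ d)                = time π c + time π d
time π (when b then c else d) = testTime b + (time π c ⊔ time π d)
time π (for x c)              = 3 + π x * (3 + time π c)
time π (call c)               = time π c

-- Compilation

-- Register R c i belongs to class c: 0 scratch, 1 and 2 variables and
-- parameters, 3 the bound (i = 0) and the loop counters.  Arrays and
-- tables are interleaved above the bound.  The flag f tells which of the
-- two families is writable, so that negating it turns the variables and
-- arrays of one stage into the parameters and tables of the next.

opaque
  R : ℕ → ℕ → ℕ
  R c i = c + i * 4

  R-inj : ∀ {c c′ i j} → c < 4 → c′ < 4 → R c i ≡ R c′ j → c ≡ c′ × i ≡ j
  R-inj = *-inj-remainder 4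

varClass : Bool → ℕ
varClass f = if f then 1 else 2

slot : Bool → Array → ℕ
slot f k = (if f then 0 else 8) + toℕ k

address : ℕ → Bool → Array → ℕ → ℕ
address β f k a = (slot f k + a * 16) + β

-- Sixteen arrays, eight of each family, are interleaved: with a power of two as period, an index is
-- scaled by four doublings in place of a multiplication.
indexCode : ℕ → ℕ → Program
indexCode j t =
  exec (add (R 0 t) (R 0 t) (R 0 t)) ⨾
  exec (add (R 0 t) (R 0 t) (R 0 t)) ⨾
  exec (add (R 0 t) (R 0 t) (R 0 t)) ⨾
  exec (add (R 0 t) (R 0 t) (R 0 t)) ⨾
  exec (const (R 0 (suc t)) j) ⨾
  exec (add (R 0 t) (R 0 (suc t)) (R 0 t)) ⨾
  exec (add (R 0 t) (R 0 t) (R 3 0))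

-- The value of the expression is left in scratch register t.
expCode : Bool → ℕ → Exp → Program
expCode f t (lit k)   = exec (const (R 0 t) k)
-- The machine has no move instruction; a copy is an addition of 0.
expCode f t (var x)   = exec (const (R 0 t) 0) ⨾ exec (add (R 0 t) (R (varClass f) x) (R 0 t))
expCode f t (par x)   = exec (const (R 0 t) 0) ⨾ exec (add (R 0 t) (R (varClass (not f)) x) (R 0 t))
expCode f t (e ⊕ e′)  = expCode f t e ⨾ expCode f (suc t) e′ ⨾ exec (add (R 0 t) (R 0 t) (R 0 (suc t)))
expCode f t (e ⊖ e′)  = expCode f t e ⨾ expCode f (suc t) e′ ⨾ exec (sub (R 0 t) (R 0 t) (R 0 (suc t)))
expCode f t (get k e) = expCode f t e ⨾ indexCode (slot f k) t ⨾ exec (load (R 0 t) (R 0 t))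
expCode f t (fix k e) = expCode f t e ⨾ indexCode (slot (not f) k) t ⨾ exec (load (R 0 t) (R 0 t))
expCode f t (cell e)  = expCode f t e ⨾ exec (sub (R 0 (suc t)) (R 3 0) (R 0 t)) ⨾
  if≢0 (R 0 (suc t)) (exec (load (R 0 t) (R 0 t))) (exec (const (R 0 t) 0))

testCode : Bool → Test → Program → Program → Program
testCode f (e ≺ e′) P Q = expCode f 0 e′ ⨾ expCode f 1 e ⨾ exec (sub (R 0 0) (R 0 0) (R 0 1)) ⨾ if≢0 (R 0 0) P Q
-- Two numbers are equal if both truncated differences vanish, hence the exchanged branches.
testCode f (e ≃ e′) P Q = expCode f 0 (e ⊖ e′) ⨾ expCode f 1 (e′ ⊖ e) ⨾ exec (add (R 0 0) (R 0 0) (R 0 1)) ⨾ if≢0 (R 0 0) Q P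
-- Compiling the else branch twice lengthens the program, not its runs.
testCode f (b ∧ b′) P Q = testCode f b (testCode f b′ P Q) Q
testCode f (∼ b)    P Q = testCode f b Q P

cmdCode : Bool → ℕ → Cmd → Program
cmdCode f d pass         = skip
cmdCode f d (x ≔ e)      = expCode f 0 e ⨾ exec (const (R 0 1) 0) ⨾ exec (add (R (varClass f) x) (R 0 0) (R 0 1))
cmdCode f d (put k i e)  = expCode f 0 i ⨾ indexCode (slot f k) 0 ⨾ expCode f 1 e ⨾ exec (store (R 0 0) (R 0 1))
cmdCode f d (out i e)    = expCode f 0 i ⨾ expCode f 1 e ⨾ exec (sub (R 0 2) (R 3 0) (R 0 0)) ⨾
  if≢0 (R 0 2) (exec (store (R 0 0) (R 0 1))) skip
cmdCode f d (c ﹔ c′)     = cmdCode f d c ⨾ cmdCode f d c′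
cmdCode f d (when b then c else c′) = testCode f b (cmdCode f d c) (cmdCode f d c′)
cmdCode f d (for x c)    =
  exec (const (R 0 0) 0) ⨾ exec (add (R 3 (suc d)) (R (varClass (not f)) x) (R 0 0)) ⨾
  while≢0 (R 3 (suc d))
    (cmdCode f (suc d) c ⨾ exec (const (R 0 0) 1) ⨾ exec (sub (R 3 (suc d)) (R 3 (suc d)) (R 0 0)))
cmdCode f d (call c)     = cmdCode f d c

-- Correctness of the compiled code

-- Total correctness with a time bound. The bound is an inequality, as the branches of a test may
-- differ in cost.
Runs : Program → State → ℕ → (State → Set) → Set
Runs P σ T Q = ∃[ t ] ∃[ σ′ ] (P , σ ⇓[ t ] σ′ × t ≤ T × Q σ′)

runs-exec : ∀ {i σ Q} → Q (step i σ) → Runs (exec i) σ 1 Q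
runs-exec q = 1 , _ , ⇓exec , ≤-refl , q

runs-⨾ : ∀ {P P′ σ T T′ Q Q′} → Runs P σ T Q → (∀ σ′ → Q σ′ → Runs P′ σ′ T′ Q′) →
  Runs (P ⨾ P′) σ (T + T′) Q′
runs-⨾ (t , σ′ , p , t≤ , q) f with f σ′ q
... | t′ , σ″ , p′ , t′≤ , q′ = t + t′ , σ″ , ⇓seq p p′ , +-mono-≤ t≤ t′≤ , q′

runs-mono : ∀ {P σ T T′ Q Q′} → Runs P σ T Q → T ≤ T′ → (∀ σ′ → Q σ′ → Q′ σ′) → Runs P σ T′ Q′
runs-mono (t , σ′ , p , t≤ , q) T≤ f = t , σ′ , p , ≤-trans t≤ T≤ , f σ′ q

runs-then : ∀ {r P P′ σ T Q} → reg σ r ≢ 0 → Runs P σ T Q → Runs (if≢0 r P P′) σ (suc T) Q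
runs-then r≢0 (t , σ′ , p , t≤ , q) = suc t , σ′ , ⇓then r≢0 p , s≤s t≤ , q

runs-else : ∀ {r P P′ σ T Q} → reg σ r ≡ 0 → Runs P′ σ T Q → Runs (if≢0 r P P′) σ (suc T) Q
runs-else r≡0 (t , σ′ , p , t≤ , q) = suc t , σ′ , ⇓else r≡0 p , s≤s t≤ , q

varClass<4 : ∀ f → varClass f < 4
varClass<4 false = s≤s (s≤s (s≤s z≤n))
varClass<4 true  = s≤s (s≤s z≤n)

varClass≢0 : ∀ f → varClass f ≢ 0
varClass≢0 false ()
varClass≢0 true  ()

varClass≢3 : ∀ f → varClass f ≢ 3
varClass≢3 false ()
varClass≢3 true  ()

varClass-not : ∀ f → varClass f ≢ varClass (not f)
varClass-not false ()
varClass-not true  ()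

slot<16 : ∀ f k → slot f k < 16
slot<16 false k = +-monoʳ-< 8 (Finₚ.toℕ<n k)
slot<16 true  k = ≤-trans (Finₚ.toℕ<n k) (m≤m+n 8 8)

slot-not : ∀ f k l → slot f k ≢ slot (not f) l
slot-not true  k l eq = <⇒≢ (≤-trans (Finₚ.toℕ<n k) (m≤m+n 8 (toℕ l))) eq
slot-not false k l eq = <⇒≢ (≤-trans (Finₚ.toℕ<n l) (m≤m+n 8 (toℕ k))) (sym eq)

slot-inj : ∀ f {k l} → slot f k ≡ slot f l → k ≡ l
slot-inj false eq = Finₚ.toℕ-injective (+-cancelˡ-≡ 8 _ _ eq)
slot-inj true  eq = Finₚ.toℕ-injective eq

address-inj : ∀ β f g {k l a b} → address β f k a ≡ address β g l b →
  slot f k ≡ slot g l × a ≡ b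
address-inj β f g {k} {l} eq =
  *-inj-remainder 16 (slot<16 f k) (slot<16 g l) (+-cancelʳ-≡ β _ _ eq)

address≥bound : ∀ β f k a → β ≤ address β f k a
address≥bound β f k a = m≤n+m β _

R-other : ∀ {c c′ i j} → c < 4 → c′ < 4 → c ≢ c′ ⊎ i ≢ j → R c i ≢ R c′ j
R-other c< c′< (inj₁ ne) eq = ne (proj₁ (R-inj c< c′< eq))
R-other c< c′< (inj₂ ne) eq = ne (proj₂ (R-inj c< c′< eq))

-- Cells are compared below the bound only, since the memory above it holds the arrays and tables.
record Simulates (f : Bool) (η : Env) (σ : State) (s : Store) : Set where
  field
    vars≈   : ∀ x → reg σ (R (varClass f) x) ≡ vars s x
    params≈ : ∀ x → reg σ (R (varClass (not f)) x) ≡ params η x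
    bound≈  : reg σ (R 3 0) ≡ bound η
    arrs≈   : ∀ k a → mem σ (address (bound η) f k a) ≡ arrs s k a
    tables≈ : ∀ k a → mem σ (address (bound η) (not f) k a) ≡ tables η k a
    cells≈  : ∀ a → a < bound η → mem σ a ≡ cells s a

-- The contract of an evaluation at scratch level `t`: intermediate results below `t` survive it, as
-- do memory, variables, parameters and loop counters.
record Keeps (t : ℕ) (σ σ′ : State) : Set where
  field
    mem≡  : ∀ a → mem σ′ a ≡ mem σ a
    low≡  : ∀ i → i < t → reg σ′ (R 0 i) ≡ reg σ (R 0 i)
    reg≡  : ∀ c i → c < 4 → c ≢ 0 → reg σ′ (R c i) ≡ reg σ (R c i)

keeps-refl : ∀ {t σ} → Keeps t σ σ
keeps-refl = record { mem≡ = λ _ → refl ; low≡ = λ _ _ → refl ; reg≡ = λ _ _ _ _ → refl }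

keeps-trans : ∀ {t t′ σ σ′ σ″} → t ≤ t′ → Keeps t σ σ′ → Keeps t′ σ′ σ″ → Keeps t σ σ″
keeps-trans t≤ p q = record
  { mem≡ = λ a → trans (Q.mem≡ a) (P.mem≡ a)
  ; low≡ = λ i i<t → trans (Q.low≡ i (<-≤-trans i<t t≤)) (P.low≡ i i<t)
  ; reg≡ = λ c i c< c≢0 → trans (Q.reg≡ c i c< c≢0) (P.reg≡ c i c< c≢0)
  }
  where module P = Keeps p
        module Q = Keeps q

keeps-weaken : ∀ {t t′ σ σ′} → t ≤ t′ → Keeps t′ σ σ′ → Keeps t σ σ′
keeps-weaken t≤ k = keeps-trans t≤ keeps-refl k

keeps-scratch : ∀ {t i v ρ μ} → t ≤ i → Keeps t ⟨ ρ , μ ⟩ ⟨ ρ [ R 0 i ↦ v ] , μ ⟩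
keeps-scratch {ρ = ρ} t≤i = record
  { mem≡ = λ _ → refl
  ; low≡ = λ j j<t → update-other ρ _ (R-other z<s z<s (inj₂ (<⇒≢ (<-≤-trans j<t t≤i))))
  ; reg≡ = λ c j c< c≢0 → update-other ρ _ (R-other c< z<s (inj₁ c≢0))
  }

sim-keeps : ∀ {f η σ σ′ s t} → Keeps t σ σ′ → Simulates f η σ s → Simulates f η σ′ s
sim-keeps {f} k S = record
  { vars≈   = λ x → trans (reg≡ _ x (varClass<4 f) (varClass≢0 f)) (vars≈ x)
  ; params≈ = λ x → trans (reg≡ _ x (varClass<4 (not f)) (varClass≢0 (not f))) (params≈ x)
  ; bound≈  = trans (reg≡ 3 0 ≤-refl (λ ())) bound≈
  ; arrs≈   = λ k a → trans (mem≡ _) (arrs≈ k a)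
  ; tables≈ = λ k a → trans (mem≡ _) (tables≈ k a)
  ; cells≈  = λ a a< → trans (mem≡ a) (cells≈ a a<)
  }
  where open Simulates S
        open Keeps k

module _ (f : Bool) (η : Env) where
  open Semantics η

  Evaluates : ℕ → State → ℕ → State → Set
  Evaluates t σ v σ′ = Keeps t σ σ′ × reg σ′ (R 0 t) ≡ v

  eval-exec : ∀ {i t σ v} → Evaluates t σ v (step i σ) → Runs (exec i) σ 1 (Evaluates t σ v)
  eval-exec = runs-exec

  set-scratch : ∀ ρ t v {w} → v ≡ w → (ρ [ R 0 t ↦ v ]) (R 0 t) ≡ w
  set-scratch ρ t v eq = trans (update-same ρ (R 0 t) v) eq

  index-correct : ∀ j t σ a → reg σ (R 0 t) ≡ a → reg σ (R 3 0) ≡ bound η →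
    Runs (indexCode j t) σ 7 (Evaluates t σ ((j + a * 16) + bound η))
  index-correct j t σ a ra rb =
    runs-⨾ (double σ a ra) λ σ₁ (k₁ , r₁) →
    runs-⨾ (double σ₁ _ r₁) λ σ₂ (k₂ , r₂) →
    runs-⨾ (double σ₂ _ r₂) λ σ₃ (k₃ , r₃) →
    runs-⨾ (double σ₃ _ r₃) λ σ₄ (k₄ , r₄) →
    runs-⨾ (runs-exec {Q = λ σ′ → Keeps (suc t) σ₄ σ′ × reg σ′ (R 0 (suc t)) ≡ j}
             (keeps-scratch ≤-refl , set-scratch (reg σ₄) (suc t) j refl)) λ σ₅ (k₅ , r₅) →
    runs-⨾ (eval-exec {t = t} {σ = σ₅} {v = j + a * 16}
             (keeps-scratch ≤-refl , set-scratch (reg σ₅) t _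
               (cong₂ _+_ r₅ (trans (trans (Keeps.low≡ k₅ t ≤-refl) r₄) (quadruple a))))) λ σ₆ (k₆ , r₆) →
    let k = keeps-trans ≤-refl k₁ (keeps-trans ≤-refl k₂ (keeps-trans ≤-refl k₃
              (keeps-trans ≤-refl k₄ (keeps-trans ≤-refl (keeps-weaken (n≤1+n t) k₅) k₆)))) in
    runs-mono (eval-exec {t = t} {σ = σ₆} {v = (j + a * 16) + bound η}
             (keeps-scratch ≤-refl , set-scratch (reg σ₆) t _
               (cong₂ _+_ r₆ (trans (Keeps.reg≡ k 3 0 ≤-refl (λ ())) rb))))
      ≤-refl λ σ₇ (k₇ , r₇) → keeps-trans ≤-refl k k₇ , r₇
    where
    double : ∀ σ a → reg σ (R 0 t) ≡ a →
      Runs (exec (add (R 0 t) (R 0 t) (R 0 t))) σ 1 (Evaluates t σ (a + a))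
    double σ a ra = runs-exec (keeps-scratch ≤-refl , set-scratch (reg σ) t _ (cong₂ _+_ ra ra))
    quadruple : ∀ a → ((a + a) + (a + a)) + ((a + a) + (a + a)) + (((a + a) + (a + a)) + ((a + a) + (a + a))) ≡ a * 16
    quadruple = solve-∀

  copy-correct : ∀ {t c x σ v} → c < 4 → c ≢ 0 → reg σ (R c x) ≡ v →
    Runs (exec (const (R 0 t) 0) ⨾ exec (add (R 0 t) (R c x) (R 0 t))) σ 2 (Evaluates t σ v)
  copy-correct {t} {c} {x} {σ} {v} c< c≢0 eq =
    runs-⨾ (runs-exec {Q = Evaluates t σ 0} (keeps-scratch ≤-refl , set-scratch (reg σ) t 0 refl)) λ σ₁ (k₁ , r₁) →
    runs-exec (keeps-trans ≤-refl k₁ (keeps-scratch ≤-refl) , set-scratch (reg σ₁) t _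
      (trans (cong₂ _+_ (trans (Keeps.reg≡ k₁ c x c< c≢0) eq) r₁) (+-identityʳ v)))

  load-correct : ∀ {t σ a v} → reg σ (R 0 t) ≡ a → mem σ a ≡ v →
    Runs (exec (load (R 0 t) (R 0 t))) σ 1 (Evaluates t σ v)
  load-correct {t} {σ} ra eq =
    runs-exec (keeps-scratch ≤-refl , set-scratch (reg σ) t _ (trans (cong (mem σ) ra) eq))

  exp-correct : ∀ e t {σ s} → Simulates f η σ s →
    Runs (expCode f t e) σ (expTime e) (Evaluates t σ (⟦ e ⟧ s))

  binary-correct : ∀ e e′ t (i : Instr) (_∙_ : ℕ → ℕ → ℕ) {σ s} → Simulates f η σ s →
    (∀ σ → step i σ ≡ ⟨ reg σ [ R 0 t ↦ reg σ (R 0 t) ∙ reg σ (R 0 (suc t)) ] , mem σ ⟩) →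
    Runs (expCode f t e ⨾ expCode f (suc t) e′ ⨾ exec i) σ (expTime e + (expTime e′ + 1))
      (Evaluates t σ (⟦ e ⟧ s ∙ ⟦ e′ ⟧ s))
  binary-correct e e′ t i _∙_ {σ} {s} S step≡ =
    runs-⨾ (exp-correct e t S) λ σ₁ (k₁ , r₁) →
    runs-⨾ (exp-correct e′ (suc t) (sim-keeps k₁ S)) λ σ₂ (k₂ , r₂) →
    runs-exec (subst (Evaluates t σ (⟦ e ⟧ s ∙ ⟦ e′ ⟧ s)) (sym (step≡ σ₂))
      ( keeps-trans ≤-refl k₁ (keeps-trans ≤-refl (keeps-weaken (n≤1+n t) k₂) (keeps-scratch ≤-refl))
      , set-scratch (reg σ₂) t _ (cong₂ _∙_ (trans (Keeps.low≡ k₂ t ≤-refl) r₁) r₂)))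

  lookup-correct : ∀ e t j {σ s v} → Simulates f η σ s →
    mem σ ((j + ⟦ e ⟧ s * 16) + bound η) ≡ v →
    Runs (expCode f t e ⨾ indexCode j t ⨾ exec (load (R 0 t) (R 0 t))) σ (expTime e + (7 + 1))
      (Evaluates t σ v)
  lookup-correct e t j {σ} {s} S eq =
    runs-⨾ (exp-correct e t S) λ σ₁ (k₁ , r₁) →
    runs-⨾ (index-correct j t σ₁ _ r₁ (Simulates.bound≈ (sim-keeps k₁ S))) λ σ₂ (k₂ , r₂) →
    let k = keeps-trans ≤-refl k₁ k₂ in
    runs-mono (load-correct r₂ (trans (Keeps.mem≡ k _) eq)) ≤-refl λ σ₃ (k₃ , r₃) →
    keeps-trans ≤-refl k k₃ , r₃

  exp-correct (lit v) t {σ} S = runs-exec (keeps-scratch ≤-refl , set-scratch (reg σ) t v refl)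
  exp-correct (var x) t S = copy-correct (varClass<4 f) (varClass≢0 f) (Simulates.vars≈ S x)
  exp-correct (par x) t S = copy-correct (varClass<4 (not f)) (varClass≢0 (not f)) (Simulates.params≈ S x)
  exp-correct (e ⊕ e′) t S = binary-correct e e′ t _ _+_ S (λ _ → refl)
  exp-correct (e ⊖ e′) t S = binary-correct e e′ t _ _∸_ S (λ _ → refl)
  exp-correct (get k e) t S = lookup-correct e t (slot f k) S (Simulates.arrs≈ S k _)
  exp-correct (fix k e) t S = lookup-correct e t (slot (not f) k) S (Simulates.tables≈ S k _)
  exp-correct (cell e) t {σ} {s} S =
    runs-⨾ (exp-correct e t S) λ σ₁ (k₁ , r₁) →
    runs-⨾ (runs-exec {Q = λ σ′ → Keeps (suc t) σ₁ σ′ × reg σ′ (R 0 (suc t)) ≡ bound η ∸ ⟦ e ⟧ s}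
      (keeps-scratch ≤-refl , set-scratch (reg σ₁) (suc t) _
        (cong₂ _∸_ (Simulates.bound≈ (sim-keeps k₁ S)) r₁))) λ σ₂ (k₂ , r₂) →
    let k  = keeps-trans ≤-refl k₁ (keeps-weaken (n≤1+n t) k₂)
        r  = trans (Keeps.low≡ k₂ t ≤-refl) r₁
        S₂ = sim-keeps k S in
    branch σ₂ k r r₂ S₂
    where
    branch : ∀ σ₂ → Keeps t σ σ₂ → reg σ₂ (R 0 t) ≡ ⟦ e ⟧ s →
      reg σ₂ (R 0 (suc t)) ≡ bound η ∸ ⟦ e ⟧ s → Simulates f η σ₂ s →
      Runs (if≢0 (R 0 (suc t)) (exec (load (R 0 t) (R 0 t))) (exec (const (R 0 t) 0))) σ₂ 2
        (Evaluates t σ (⟦ cell e ⟧ s))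
    branch σ₂ k r r₂ S₂ with ⟦ e ⟧ s <? bound η
    ... | yes lt rewrite dec-true (⟦ e ⟧ s <? bound η) lt = runs-then (λ eq → m>n⇒m∸n≢0 lt (trans (sym r₂) eq))
      (runs-mono (load-correct r (Simulates.cells≈ S₂ _ lt)) ≤-refl λ σ₃ (k₃ , r₃) → keeps-trans ≤-refl k k₃ , r₃)
    ... | no ¬lt rewrite dec-false (⟦ e ⟧ s <? bound η) ¬lt = runs-else (trans r₂ (m≤n⇒m∸n≡0 (≮⇒≥ ¬lt)))
      (runs-exec (keeps-trans ≤-refl k (keeps-scratch ≤-refl) , set-scratch (reg σ₂) t 0 refl))

  test-binary : ∀ e e′ (i : Instr) (_∙_ : ℕ → ℕ → ℕ) {P σ s T Q} → Simulates f η σ s →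
    (∀ σ → step i σ ≡ ⟨ reg σ [ R 0 0 ↦ reg σ (R 0 0) ∙ reg σ (R 0 1) ] , mem σ ⟩) →
    (∀ σ′ → Evaluates 0 σ (⟦ e ⟧ s ∙ ⟦ e′ ⟧ s) σ′ → Runs P σ′ T Q) →
    Runs (expCode f 0 e ⨾ expCode f 1 e′ ⨾ exec i ⨾ P) σ (expTime e + (expTime e′ + (1 + T))) Q
  test-binary e e′ i _∙_ {σ = σ} {s} S step≡ p =
    runs-⨾ (exp-correct e 0 S) λ σ₁ (k₁ , r₁) →
    runs-⨾ (exp-correct e′ 1 (sim-keeps k₁ S)) λ σ₂ (k₂ , r₂) →
    runs-⨾ (runs-exec {Q = Evaluates 0 σ (⟦ e ⟧ s ∙ ⟦ e′ ⟧ s)} (subst (Evaluates 0 σ (⟦ e ⟧ s ∙ ⟦ e′ ⟧ s)) (sym (step≡ σ₂))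
      ( keeps-trans ≤-refl k₁ (keeps-trans ≤-refl (keeps-weaken z≤n k₂) (keeps-scratch ≤-refl))
      , set-scratch (reg σ₂) 0 _ (cong₂ _∙_ (trans (Keeps.low≡ k₂ 0 ≤-refl) r₁) r₂)))) p

  test-correct : ∀ b {P P′ σ s T T′ Q} → Simulates f η σ s →
    (Holds b s → ∀ σ′ → Keeps 0 σ σ′ → Runs P σ′ T Q) →
    (¬ Holds b s → ∀ σ′ → Keeps 0 σ σ′ → Runs P′ σ′ T′ Q) →
    Runs (testCode f b P P′) σ (testTime b + (T ⊔ T′)) Q
  test-correct (e ≺ e′) {P} {P′} {σ} {s} {T} {T′} {Q} S p q =
    runs-mono (test-binary e′ e _ _∸_ S (λ _ → refl) branch)
      (≤-reflexive (rearrange (expTime e) (expTime e′) (T ⊔ T′))) (λ _ z → z)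
    where
    rearrange : ∀ a b c → b + (a + (1 + suc c)) ≡ (a + (b + 2)) + c
    rearrange = solve-∀
    branch : ∀ σ′ → Evaluates 0 σ (⟦ e′ ⟧ s ∸ ⟦ e ⟧ s) σ′ → Runs (if≢0 (R 0 0) P P′) σ′ (suc (T ⊔ T′)) Q
    branch σ′ (k , r) with ⟦ e ⟧ s <? ⟦ e′ ⟧ s
    ... | yes lt = runs-then (λ eq → m>n⇒m∸n≢0 lt (trans (sym r) eq))
      (runs-mono (p lt σ′ k) (m≤m⊔n T T′) (λ _ z → z))
    ... | no ¬lt = runs-else (trans r (m≤n⇒m∸n≡0 (≮⇒≥ ¬lt)))
      (runs-mono (q ¬lt σ′ k) (m≤n⊔m T T′) (λ _ z → z))
  test-correct (e ≃ e′) {P} {P′} {σ} {s} {T} {T′} {Q} S p q =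
    runs-mono (test-binary (e ⊖ e′) (e′ ⊖ e) _ _+_ S (λ _ → refl) branch)
      (≤-reflexive (rearrange (expTime (e ⊖ e′)) (expTime (e′ ⊖ e)) (T ⊔ T′))) (λ _ z → z)
    where
    rearrange : ∀ a b c → a + (b + (1 + suc c)) ≡ (a + (b + 2)) + c
    rearrange = solve-∀
    ∸-antisym : ∀ a b → (a ∸ b) + (b ∸ a) ≡ 0 → a ≡ b
    ∸-antisym a b eq = ≤-antisym (m∸n≡0⇒m≤n (m+n≡0⇒m≡0 (a ∸ b) eq)) (m∸n≡0⇒m≤n (m+n≡0⇒n≡0 (a ∸ b) eq))
    branch : ∀ σ′ → Evaluates 0 σ (⟦ e ⊖ e′ ⟧ s + ⟦ e′ ⊖ e ⟧ s) σ′ → Runs (if≢0 (R 0 0) P′ P) σ′ (suc (T ⊔ T′)) Q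
    branch σ′ (k , r) with ⟦ e ⟧ s ≟ ⟦ e′ ⟧ s
    ... | yes eq = runs-else (trans r (cong₂ _+_ (m≤n⇒m∸n≡0 (≤-reflexive eq)) (m≤n⇒m∸n≡0 (≤-reflexive (sym eq)))))
      (runs-mono (p eq σ′ k) (m≤m⊔n T T′) (λ _ z → z))
    ... | no ne = runs-then (λ r≡0 → ne (∸-antisym _ _ (trans (sym r) r≡0)))
      (runs-mono (q ne σ′ k) (m≤n⊔m T T′) (λ _ z → z))
  test-correct (b ∧ b′) {T = T} {T′} S p q =
    runs-mono
      (test-correct b S
        (λ h σ₁ k₁ → test-correct b′ (sim-keeps k₁ S)
          (λ h′ σ₂ k₂ → p (h , h′) σ₂ (keeps-trans ≤-refl k₁ k₂))
          (λ ¬h′ σ₂ k₂ → q (¬h′ ∘ proj₂) σ₂ (keeps-trans ≤-refl k₁ k₂)))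
        (λ ¬h σ₁ k₁ → runs-mono (q (¬h ∘ proj₁) σ₁ k₁) (≤-trans (m≤n⊔m T T′) (m≤n+m (T ⊔ T′) (testTime b′))) (λ _ z → z)))
      (≤-reflexive (trans (cong (testTime b +_) (⊔-idem _)) (sym (+-assoc (testTime b) _ _)))) (λ _ z → z)

  test-correct (∼ b) {T = T} {T′} S p q =
    runs-mono (test-correct b S (λ h → q (λ ¬h → ¬h h)) p)
      (≤-reflexive (cong (testTime b +_) (⊔-comm T′ T))) (λ _ z → z)

  -- Loops at smaller depth have their counters in the registers R 3 i, i ≤ d.
  Executes : ℕ → State → Store → State → Set
  Executes d σ s σ′ = Simulates f η σ′ s × (∀ i → i ≤ d → reg σ′ (R 3 i) ≡ reg σ (R 3 i))

  counters-keep : ∀ {t d σ σ′} → Keeps t σ σ′ → ∀ i → i ≤ d → reg σ′ (R 3 i) ≡ reg σ (R 3 i)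
  counters-keep k i _ = Keeps.reg≡ k 3 i ≤-refl (λ ())

  sim-set : ∀ {σ s} x {v w} → v ≡ w → Simulates f η σ s →
    Simulates f η ⟨ reg σ [ R (varClass f) x ↦ v ] , mem σ ⟩ (setVar x w s)
  sim-set {σ} {s} x {v} refl S = record
    { vars≈   = vars≈′
    ; params≈ = λ y → trans (update-other (reg σ) v (R-other (varClass<4 (not f)) (varClass<4 f) (inj₁ (varClass-not f ∘ sym)))) (params≈ y)
    ; bound≈  = trans (update-other (reg σ) v (R-other ≤-refl (varClass<4 f) (inj₁ (varClass≢3 f ∘ sym)))) bound≈
    ; arrs≈   = arrs≈
    ; tables≈ = tables≈
    ; cells≈  = cells≈
    }
    where
    open Simulates S
    vars≈′ : ∀ y → (reg σ [ R (varClass f) x ↦ v ]) (R (varClass f) y) ≡ (vars s [ x ↦ v ]) y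
    vars≈′ y with y ≟ x
    ... | yes refl = trans (update-same (reg σ) (R (varClass f) x) v) (sym (update-same (vars s) x v))
    ... | no y≢x = trans (update-other (reg σ) v (R-other (varClass<4 f) (varClass<4 f) (inj₂ y≢x)))
      (trans (vars≈ y) (sym (update-other (vars s) v y≢x)))

  sim-put : ∀ {σ s} k i {v w} → v ≡ w → Simulates f η σ s →
    Simulates f η ⟨ reg σ , mem σ [ address (bound η) f k i ↦ v ] ⟩ (setArray k i w s)
  sim-put {σ} {s} k i {v} refl S = record
    { vars≈   = vars≈
    ; params≈ = params≈
    ; bound≈  = bound≈
    ; arrs≈   = arrs≈′
    ; tables≈ = λ l a → trans (update-other (mem σ) v λ eq →
        slot-not f k l (sym (proj₁ (address-inj (bound η) (not f) f {l} {k} {a} {i} eq)))) (tables≈ l a)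
    ; cells≈  = λ a a< → trans (update-other (mem σ) v
        (<⇒≢ (<-≤-trans a< (address≥bound (bound η) f k i)))) (cells≈ a a<)
    }
    where
    open Simulates S
    arrs≈′ : ∀ l a → (mem σ [ address (bound η) f k i ↦ v ]) (address (bound η) f l a) ≡ setArr (arrs s) k i v l a
    arrs≈′ l a with l Finₚ.≟ k
    ... | no l≢k = trans (update-other (mem σ) v λ eq →
        l≢k (slot-inj f (proj₁ (address-inj (bound η) f f {l} {k} {a} {i} eq)))) (arrs≈ l a)
    ... | yes refl with a ≟ i
    ...   | yes refl = trans (update-same (mem σ) _ v) (sym (update-same (arrs s l) a v))
    ...   | no a≢i = trans (update-other (mem σ) v λ eq →
        a≢i (proj₂ (address-inj (bound η) f f {l} {l} {a} {i} eq))) (trans (arrs≈ l a) (sym (update-other (arrs s l) v a≢i)))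

  sim-cell : ∀ {σ s} a {v w} → v ≡ w → a < bound η → Simulates f η σ s →
    Simulates f η ⟨ reg σ , mem σ [ a ↦ v ] ⟩ ⟪ vars s , arrs s , cells s [ a ↦ w ] ⟫
  sim-cell {σ} {s} a {v} refl a< S = record
    { vars≈   = vars≈
    ; params≈ = params≈
    ; bound≈  = bound≈
    ; arrs≈   = λ k i → trans (above f k i) (arrs≈ k i)
    ; tables≈ = λ k i → trans (above (not f) k i) (tables≈ k i)
    ; cells≈  = cells≈′
    }
    where
    open Simulates S
    above : ∀ g k i → (mem σ [ a ↦ v ]) (address (bound η) g k i) ≡ mem σ (address (bound η) g k i)
    above g k i = update-other (mem σ) v (<⇒≢ (<-≤-trans a< (address≥bound (bound η) g k i)) ∘ sym)
    cells≈′ : ∀ b → b < bound η → (mem σ [ a ↦ v ]) b ≡ (cells s [ a ↦ v ]) b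
    cells≈′ b b< with b ≟ a
    ... | yes refl = trans (update-same (mem σ) a v) (sym (update-same (cells s) a v))
    ... | no b≢a = trans (update-other (mem σ) v b≢a) (trans (cells≈ b b<) (sym (update-other (cells s) v b≢a)))

  cmd-correct : ∀ c d {σ s} → Simulates f η σ s →
    Runs (cmdCode f d c) σ (time (params η) c) (Executes d σ (run c s))
  cmd-correct pass d {σ} S = 1 , _ , ⇓skip , ≤-refl , S , λ _ _ → refl
  cmd-correct (x ≔ e) d {σ} {s} S =
    runs-⨾ (exp-correct e 0 S) λ σ₁ (k₁ , r₁) →
    runs-⨾ (runs-exec {Q = λ σ′ → Keeps 1 σ₁ σ′ × reg σ′ (R 0 1) ≡ 0}
      (keeps-scratch ≤-refl , set-scratch (reg σ₁) 1 0 refl)) λ σ₂ (k₂ , r₂) →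
    let k = keeps-trans ≤-refl k₁ (keeps-weaken z≤n k₂) in
    runs-exec
      ( sim-set x (trans (cong₂ _+_ (trans (Keeps.low≡ k₂ 0 ≤-refl) r₁) r₂) (+-identityʳ _)) (sim-keeps k S)
      , λ i i≤ → trans (update-other (reg σ₂) _ (R-other ≤-refl (varClass<4 f) (inj₁ (varClass≢3 f ∘ sym))))
                   (counters-keep k i i≤))
  cmd-correct (put k i e) d {σ} {s} S =
    runs-⨾ (exp-correct i 0 S) λ σ₁ (k₁ , r₁) →
    runs-⨾ (index-correct (slot f k) 0 σ₁ _ r₁ (Simulates.bound≈ (sim-keeps k₁ S))) λ σ₂ (k₂ , r₂) →
    let k₁₂ = keeps-trans ≤-refl k₁ k₂ in
    runs-⨾ (exp-correct e 1 (sim-keeps k₁₂ S)) λ σ₃ (k₃ , r₃) →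
    let k₁₂₃ = keeps-trans ≤-refl k₁₂ (keeps-weaken z≤n k₃) in
    runs-exec
      ( subst (λ a → Simulates f η ⟨ reg σ₃ , mem σ₃ [ a ↦ reg σ₃ (R 0 1) ] ⟩ (setArray k (⟦ i ⟧ s) (⟦ e ⟧ s) s))
          (sym (trans (Keeps.low≡ k₃ 0 ≤-refl) r₂)) (sim-put k (⟦ i ⟧ s) r₃ (sim-keeps k₁₂₃ S))
      , counters-keep k₁₂₃)
  cmd-correct (out i e) d {σ} {s} S =
    runs-⨾ (exp-correct i 0 S) λ σ₁ (k₁ , r₁) →
    runs-⨾ (exp-correct e 1 (sim-keeps k₁ S)) λ σ₂ (k₂ , r₂) →
    let k₁₂ = keeps-trans ≤-refl k₁ (keeps-weaken z≤n k₂)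
        r₁′ = trans (Keeps.low≡ k₂ 0 ≤-refl) r₁ in
    runs-⨾ (runs-exec {Q = λ σ′ → Keeps 2 σ₂ σ′ × reg σ′ (R 0 2) ≡ bound η ∸ ⟦ i ⟧ s}
      (keeps-scratch ≤-refl , set-scratch (reg σ₂) 2 _
        (cong₂ _∸_ (Simulates.bound≈ (sim-keeps k₁₂ S)) r₁′))) λ σ₃ (k₃ , r₃) →
    branch σ₃ (keeps-trans ≤-refl k₁₂ (keeps-weaken z≤n k₃))
      (trans (Keeps.low≡ k₃ 0 z<s) r₁′) (trans (Keeps.low≡ k₃ 1 ≤-refl) r₂) r₃
    where
    branch : ∀ σ₃ → Keeps 0 σ σ₃ → reg σ₃ (R 0 0) ≡ ⟦ i ⟧ s → reg σ₃ (R 0 1) ≡ ⟦ e ⟧ s →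
      reg σ₃ (R 0 2) ≡ bound η ∸ ⟦ i ⟧ s →
      Runs (if≢0 (R 0 2) (exec (store (R 0 0) (R 0 1))) skip) σ₃ 2 (Executes d σ (run (out i e) s))
    branch σ₃ k r₀ r₁ r₂ with ⟦ i ⟧ s <? bound η
    ... | yes lt rewrite dec-true (⟦ i ⟧ s <? bound η) lt = runs-then (λ eq → m>n⇒m∸n≢0 lt (trans (sym r₂) eq)) (runs-exec
      ( subst (λ a → Simulates f η ⟨ reg σ₃ , mem σ₃ [ a ↦ reg σ₃ (R 0 1) ] ⟩
                ⟪ vars s , arrs s , cells s [ ⟦ i ⟧ s ↦ ⟦ e ⟧ s ] ⟫)
          (sym r₀) (sim-cell (⟦ i ⟧ s) r₁ lt (sim-keeps k S))
      , counters-keep k))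
    ... | no ¬lt rewrite dec-false (⟦ i ⟧ s <? bound η) ¬lt = runs-else (trans r₂ (m≤n⇒m∸n≡0 (≮⇒≥ ¬lt)))
      (1 , _ , ⇓skip , ≤-refl , sim-keeps k S , counters-keep k)
  cmd-correct (c ﹔ c′) d S =
    runs-⨾ (cmd-correct c d S) λ σ₁ (S₁ , k₁) →
    runs-mono (cmd-correct c′ d S₁) ≤-refl λ σ₂ (S₂ , k₂) →
    S₂ , λ i i≤ → trans (k₂ i i≤) (k₁ i i≤)
  cmd-correct (when b then c else c′) d {σ} {s} S =
    test-correct b S
      (λ h σ₁ k₁ → runs-mono (cmd-correct c d (sim-keeps k₁ S)) ≤-refl λ σ₂ (S₂ , k₂) →
        subst (λ b → Simulates f η σ₂ (if b then run c s else run c′ s)) (sym (dec-true (holds? b s) h)) S₂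
        , λ i i≤ → trans (k₂ i i≤) (counters-keep k₁ i i≤))
      (λ ¬h σ₁ k₁ → runs-mono (cmd-correct c′ d (sim-keeps k₁ S)) ≤-refl λ σ₂ (S₂ , k₂) →
        subst (λ b → Simulates f η σ₂ (if b then run c s else run c′ s)) (sym (dec-false (holds? b s) ¬h)) S₂
        , λ i i≤ → trans (k₂ i i≤) (counters-keep k₁ i i≤))
  cmd-correct (call c) d S = cmd-correct c d S
  cmd-correct (for x c) d {σ} {s} S =
    runs-⨾ (runs-exec {Q = λ σ′ → Keeps 0 σ σ′ × reg σ′ (R 0 0) ≡ 0}
      (keeps-scratch z≤n , set-scratch (reg σ) 0 0 refl)) λ σ₁ (k₁ , r₁) →
    runs-⨾ (runs-exec {Q = λ σ′ → Executes d σ s σ′ × reg σ′ (R 3 (suc d)) ≡ params η x}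
      ( set-counter k₁ S
      , trans (update-same (reg σ₁) (R 3 (suc d)) _)
          (trans (cong₂ _+_ (Simulates.params≈ (sim-keeps k₁ S) x) r₁) (+-identityʳ _)))) λ σ₂ ((S₂ , k₂) , r₂) →
    runs-mono (loop (params η x) σ₂ s S₂ r₂) ≤-refl λ σ₃ (S₃ , k₃) →
    S₃ , λ i i≤ → trans (k₃ i i≤) (k₂ i i≤)
    where
    body : Program
    body = cmdCode f (suc d) c ⨾ exec (const (R 0 0) 1) ⨾ exec (sub (R 3 (suc d)) (R 3 (suc d)) (R 0 0))

    set-counter : ∀ {σ σ₁ s v} → Keeps 0 σ σ₁ → Simulates f η σ s →
      Executes d σ s ⟨ reg σ₁ [ R 3 (suc d) ↦ v ] , mem σ₁ ⟩
    set-counter {σ₁ = σ₁} {v = v} k S = record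
      { vars≈   = λ y → trans (update-other (reg σ₁) v (R-other (varClass<4 f) ≤-refl (inj₁ (varClass≢3 f)))) (vars≈ y)
      ; params≈ = λ y → trans (update-other (reg σ₁) v (R-other (varClass<4 (not f)) ≤-refl (inj₁ (varClass≢3 (not f))))) (params≈ y)
      ; bound≈  = trans (update-other (reg σ₁) {R 3 (suc d)} {R 3 0} v (R-other {i = 0} {suc d} ≤-refl ≤-refl (inj₂ (λ ())))) bound≈
      ; arrs≈   = arrs≈
      ; tables≈ = tables≈
      ; cells≈  = cells≈
      } , λ i i≤ → trans (update-other (reg σ₁) v (R-other ≤-refl ≤-refl (inj₂ (<⇒≢ (s≤s i≤))))) (counters-keep k i i≤)
      where open Simulates (sim-keeps k S)

    loop : ∀ k σ s → Simulates f η σ s → reg σ (R 3 (suc d)) ≡ k →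
      Runs (while≢0 (R 3 (suc d)) body) σ (suc (k * (3 + time (params η) c))) (Executes d σ (iterate k (run c) s))
    loop zero σ s S r = 1 , σ , ⇓exit r , ≤-refl , S , λ _ _ → refl
    loop (suc k) σ s S r with
      runs-⨾ (cmd-correct c (suc d) S) (λ σ₁ (S₁ , k₁) →
      runs-⨾ (runs-exec {Q = λ σ′ → Keeps 0 σ₁ σ′ × reg σ′ (R 0 0) ≡ 1}
        (keeps-scratch z≤n , set-scratch (reg σ₁) 0 1 refl)) λ σ₂ (k₂ , r₂) →
      runs-exec {Q = λ σ′ → Executes d σ (run c s) σ′ × reg σ′ (R 3 (suc d)) ≡ k}
        ( (proj₁ (set-counter k₂ S₁) , λ i i≤ → trans (proj₂ (set-counter {v = reg σ₂ (R 3 (suc d)) ∸ reg σ₂ (R 0 0)} k₂ S₁) i i≤) (k₁ i (m≤n⇒m≤1+n i≤)))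
        , trans (update-same (reg σ₂) (R 3 (suc d)) _)
            (cong₂ _∸_ (trans (counters-keep k₂ (suc d) ≤-refl) (trans (k₁ (suc d) ≤-refl) r)) r₂)))
    ... | t₁ , σ₁ , p₁ , t₁≤ , (S₁ , k₁) , r₁ with loop k σ₁ (run c s) S₁ r₁
    ...   | t₂ , σ₂ , p₂ , t₂≤ , S₂ , k₂ =
      suc (t₁ + t₂) , σ₂ , ⇓loop (λ eq → 1+n≢0 (trans (sym r) eq)) p₁ p₂ ,
      s≤s (≤-trans (+-mono-≤ t₁≤ t₂≤) (≤-reflexive (rearrange (time (params η) c) (k * (3 + time (params η) c))))) ,
      S₂ , λ i i≤ → trans (k₂ i i≤) (k₁ i i≤)
      where
      rearrange : ∀ a b → (a + 2) + suc b ≡ (3 + a) + b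
      rearrange = solve-∀

-- No instruction is executed between two stages: negating the flag merely reinterprets the same
-- machine state.
swap-stage : ∀ {f η σ s} → Simulates f η σ s →
  Simulates (not f) (env (vars s) (arrs s) (bound η)) σ ⟪ params η , tables η , cells s ⟫
swap-stage {f} {η} {σ} {s} S = record
  { vars≈   = params≈
  ; params≈ = λ x → subst (λ g → reg σ (R (varClass g) x) ≡ vars s x) (sym (not-not f)) (vars≈ x)
  ; bound≈  = bound≈
  ; arrs≈   = tables≈
  ; tables≈ = λ k a → subst (λ g → mem σ (address (bound η) g k a) ≡ arrs s k a) (sym (not-not f)) (arrs≈ k a)
  ; cells≈  = cells≈
  }
  where
  open Simulates S
  not-not : ∀ f → not (not f) ≡ f
  not-not true  = refl
  not-not false = refl

-- Graphs on natural numbers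

module Graphs (m : ℕ) (s t : ℕ → ℕ) where

  Ends : ℕ → ℕ → ℕ → Set
  Ends e x y = (s e ≡ x × t e ≡ y) ⊎ (s e ≡ y × t e ≡ x)

  ends-sym : ∀ {e x y} → Ends e x y → Ends e y x
  ends-sym = Sum.swap

  data Trail (P : ℕ → Set) : ℕ → ℕ → ℕ → Set where
    stop : ∀ {x} → Trail P 0 x x
    move : ∀ {k x y z} e → e < m → P e → Ends e x y → Trail P k y z → Trail P (suc k) x z

  trail-edges : ∀ {P k x y} → Trail P k x y → List ℕ
  trail-edges stop             = []
  trail-edges (move e _ _ _ p) = e ∷ trail-edges p

  trail-edges-length : ∀ {P k x y} (p : Trail P k x y) → List.length (trail-edges p) ≡ k
  trail-edges-length stop             = refl
  trail-edges-length (move _ _ _ _ p) = cong suc (trail-edges-length p)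

  trail-edges-all : ∀ {P k x y} (p : Trail P k x y) → ∀ {e} → e ∈ trail-edges p → P e
  trail-edges-all (move _ _ Pe _ _) (here refl) = Pe
  trail-edges-all (move _ _ _ _ p)  (there e∈)  = trail-edges-all p e∈

  trail-restrict : ∀ {P Q k x y} (p : Trail P k x y) → (∀ {e} → e ∈ trail-edges p → e < m → P e → Q e) → Trail Q k x y
  trail-restrict stop                  f = stop
  trail-restrict (move e e< Pe ends p) f = move e e< (f (here refl) e< Pe) ends (trail-restrict p (f ∘ there))

  trail-map : ∀ {P Q k x y} → (∀ {e} → e < m → P e → Q e) → Trail P k x y → Trail Q k x y
  trail-map f p = trail-restrict p (λ _ → f)

  trail-++ : ∀ {P j k x y z} → Trail P j x y → Trail P k y z → Trail P (j + k) x z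
  trail-++ stop                  q = q
  trail-++ (move e e< Pe ends p) q = move e e< Pe ends (trail-++ p q)

  trail-snoc : ∀ {P k x y z} e → e < m → P e → Ends e y z → Trail P k x y → Trail P (suc k) x z
  trail-snoc {P} {k} {x} {z = z} e e< Pe ends p =
    subst (λ j → Trail P j x z) (+-comm k 1) (trail-++ p (move e e< Pe ends stop))

  trail-reverse : ∀ {P k x y} → Trail P k x y → Trail P k y x
  trail-reverse stop                  = stop
  trail-reverse (move e e< Pe ends p) = trail-snoc e e< Pe (ends-sym ends) (trail-reverse p)

  -- The edge e itself need not satisfy P.
  Bridged : (ℕ → Set) → ℕ → ℕ → Set
  Bridged P a e = ∃[ k ] (k ≤ a × Trail P k (s e) (t e))

  Detour : ℕ → ℕ → Set
  Detour a e = Bridged (_≢ e) a e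

  -- Outcome of a breadth-first search from u: D x is 1 + the distance to
  -- x, or 0 if x is not reached, and B x is the child of u above x.
  record Layered (n : ℕ) (P : ℕ → Set) (u : ℕ) (D B : ℕ → ℕ) : Set where
    field
      root   : D u ≡ 1
      closed : ∀ {e x y} → e < m → P e → Ends e x y → D x ≢ 0 → D y ≢ 0 × D y ≤ suc (D x)
      parent : ∀ x → x < n → D x ≢ 0 → x ≢ u → ∃[ e ] ∃[ y ] (e < m × P e × Ends e y x ×
        y < n × D y ≢ 0 × D x ≡ suc (D y) × (y ≡ u × B x ≡ x ⊎ y ≢ u × B x ≡ B y))

    -- Every edge raises the label by at most one, so labels are bounded by distances;
    -- `trail-from-root` is the converse, by following parents.
    reached : ∀ {k x y} → Trail P k x y → D x ≢ 0 → D y ≢ 0 × D y ≤ k + D x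
    reached stop                              Dx≢0 = Dx≢0 , ≤-refl
    reached {suc k} {x} (move e e< Pe ends p) Dx≢0 with closed e< Pe ends Dx≢0
    ... | Dz≢0 , Dz≤ with reached p Dz≢0
    ...   | Dy≢0 , Dy≤ = Dy≢0 , ≤-trans Dy≤ (≤-trans (+-monoʳ-≤ k Dz≤) (≤-reflexive (+-suc k (D x))))

    -- Any other reached vertex has a parent with a nonzero label, hence a label of at least 2.
    only-root : ∀ x → x < n → D x ≡ 1 → x ≡ u
    only-root x x<n Dx≡1 with x ≟ u
    ... | yes x≡u = x≡u
    ... | no  x≢u with parent x x<n (λ eq → 1+n≢0 (trans (sym Dx≡1) eq)) x≢u
    ...   | e , y , _ , _ , _ , _ , Dy≢0 , Dx≡ , _ = contradiction (suc-injective (trans (sym Dx≡) Dx≡1)) Dy≢0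

    trail-from-root : ∀ k x → x < n → D x ≡ suc k → Trail P k u x
    trail-from-root zero    x x<n Dx≡ = subst (Trail P 0 u) (sym (only-root x x<n Dx≡)) stop
    trail-from-root (suc k) x x<n Dx≡ with x ≟ u
    ... | yes refl = contradiction (trans (sym root) Dx≡) (λ ())
    ... | no  x≢u with parent x x<n (λ eq → 1+n≢0 (trans (sym Dx≡) eq)) x≢u
    ...   | e , y , e< , Pe , ends , y<n , _ , Dx≡′ , _ =
      trail-snoc e e< Pe ends (trail-from-root k y y<n (suc-injective (trans (sym Dx≡′) Dx≡)))

    bridged-sound : ∀ {a e} → s e ≡ u → t e < n → D (t e) ≢ 0 → D (t e) ≤ suc a → Bridged P a e
    bridged-sound {a} {e} refl t<n D≢0 D≤ = pred (D (t e)) , ≤-pred (≤-trans (≤-reflexive suc-pred′) D≤) ,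
      trail-from-root _ _ t<n (sym suc-pred′)
      where
      suc-pred′ : suc (pred (D (t e))) ≡ D (t e)
      suc-pred′ = suc-pred (D (t e)) {{≢-nonZero D≢0}}

    bridged-complete : ∀ {a e} → s e ≡ u → Bridged P a e → D (t e) ≢ 0 × D (t e) ≤ suc a
    bridged-complete {a} {e} refl (k , k≤a , p) with reached p (λ eq → 1+n≢0 (trans (sym root) eq))
    ... | D≢0 , D≤ = D≢0 , ≤-trans D≤ (≤-trans (≤-reflexive (trans (cong (k +_) root) (+-comm k 1))) (s≤s k≤a))

  -- A shortest detour for an edge uv follows the tree from u to some y
  -- outside the branch of v, crosses to some x in it and climbs to v.
  module Branches {n} (s<n : ∀ e → e < m → s e < n) (t<n : ∀ e → e < m → t e < n)
    (parallel : ∀ {e f x y} → e < m → f < m → Ends e x y → Ends f x y → e ≡ f)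
    {P} (full : ∀ e → e < m → P e) {u D B} (L : Layered n P u D B) (all : ∀ x → x < n → D x ≢ 0) where
    open Layered L

    ends<n : ∀ {e x y} → e < m → Ends e x y → x < n × y < n
    ends<n {e} e< (inj₁ (refl , refl)) = s<n e e< , t<n e e<
    ends<n {e} e< (inj₂ (refl , refl)) = t<n e e< , s<n e e<

    -- Labels exceed distances by one, so the last condition says d(u,x) + d(u,y) ≤ a. This is the
    -- length of the detour: the crossing edge makes up for the tree edge at `u` that the climb from
    -- `x` leaves out. `1 < D` excludes the root, which lies in no branch.
    Crosses : ℕ → ℕ → ℕ → Set
    Crosses a x y = 1 < D x × 1 < D y × B x ≢ B y × D x + D y ≤ a + 2

    not-root : ∀ {x} → 1 < D x → x ≢ u
    not-root 1< refl = <⇒≢ 1< (sym root)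

    below-root : ∀ {x} → x < n → x ≢ u → 1 < D x
    below-root {x} x<n x≢u = ≤∧≢⇒< (n≢0⇒n>0 (all x x<n)) (λ eq → x≢u (only-root x x<n (sym eq)))

    other-end : ∀ {e y v} → Ends e u y → Ends e u v → u ≢ v → y ≡ v
    other-end (inj₁ (_ , p)) (inj₁ (_ , q)) _   = trans (sym p) q
    other-end (inj₁ (p , _)) (inj₂ (q , _)) u≢v = contradiction (trans (sym p) q) u≢v
    other-end (inj₂ (_ , p)) (inj₁ (_ , q)) u≢v = contradiction (trans (sym p) q) u≢v
    other-end (inj₂ (p , _)) (inj₂ (q , _)) _   = trans (sym p) q

    touches-root : ∀ {e x y v} → Ends e x y → Ends e u v → x ≡ u ⊎ y ≡ u
    touches-root (inj₁ (p , _)) (inj₁ (q , _)) = inj₁ (trans (sym p) q)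
    touches-root (inj₁ (_ , p)) (inj₂ (_ , q)) = inj₂ (trans (sym p) q)
    touches-root (inj₂ (p , _)) (inj₁ (q , _)) = inj₂ (trans (sym p) q)
    touches-root (inj₂ (_ , p)) (inj₂ (_ , q)) = inj₁ (trans (sym p) q)

    -- A neighbour of the root has distance 1, so that its parent is the root and it starts a branch
    -- of its own.
    child : ∀ {e x} → e < m → Ends e u x → x ≢ u → D x ≡ 2 × B x ≡ x
    child {e} {x} e< ends x≢u with parent x (proj₂ (ends<n e< ends)) (all x (proj₂ (ends<n e< ends))) x≢u
    ... | _ , y , _ , _ , _ , y<n , _ , Dx≡ , br = Dx≡2 , Bx≡x br
      where
      Dx≡2 : D x ≡ 2
      Dx≡2 = ≤-antisym (≤-trans (proj₂ (closed e< (full e e<) ends (λ eq → 1+n≢0 (trans (sym root) eq)))) (s≤s (≤-reflexive root)))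
        (below-root (proj₂ (ends<n e< ends)) x≢u)
      Bx≡x : y ≡ u × B x ≡ x ⊎ y ≢ u × B x ≡ B y → B x ≡ x
      Bx≡x (inj₁ (_ , eq))  = eq
      Bx≡x (inj₂ (y≢u , _)) = contradiction (only-root y y<n (suc-injective (trans (sym Dx≡) Dx≡2))) y≢u

    -- The bound survives prefixing the edge from `z` to `z′`, since the label of `z′` exceeds that
    -- of `z` by at most one.
    detour-step : ∀ {e z z′} {R : ℕ → ℕ → ℕ → Set} → e < m → Ends e z z′ → ∀ k →
      ∃[ f ] ∃[ x ] ∃[ y ] (R f x y × D x + D y ≤ k + D z′ + 1) →
      ∃[ f ] ∃[ x ] ∃[ y ] (R f x y × D x + D y ≤ suc k + D z + 1)
    detour-step {e} {z} {z′} e< ends k (f , x , y , r , le) = f , x , y , r ,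
      ≤-trans le (+-monoˡ-≤ 1 (≤-trans (+-monoʳ-≤ k (proj₂ (closed e< (full e e<) ends (all z (proj₁ (ends<n e< ends))))))
        (≤-reflexive (+-suc k (D z)))))

    module _ {e₀ v} (e₀< : e₀ < m) (ends₀ : Ends e₀ u v) (u≢v : u ≢ v) where

      avoids : ∀ {e x y} → Ends e x y → x ≢ u → y ≢ u → e ≢ e₀
      avoids ends x≢u y≢u refl = Sum.[ x≢u , y≢u ] (touches-root ends ends₀)

      -- As `e₀` joins the root to `v`, a tree path from the root can use it only to enter the
      -- branch of `v`.
      outside-trail : ∀ k x → x < n → D x ≡ suc k → x ≡ u ⊎ B x ≢ v → Trail (_≢ e₀) k u x
      outside-trail zero    x x<n Dx≡ _ = subst (Trail _ 0 u) (sym (only-root x x<n Dx≡)) stop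
      outside-trail (suc k) x x<n Dx≡ o with x ≟ u
      ... | yes refl = contradiction (trans (sym root) Dx≡) (λ ())
      ... | no  x≢u with parent x x<n (all x x<n) x≢u
      ...   | e , y , e< , _ , ends , y<n , _ , Dx≡′ , br =
        trail-snoc e e< (e≢ br) ends (outside-trail k y y<n (suc-injective (trans (sym Dx≡′) Dx≡)) (outside br))
        where
        Bx≢v : B x ≢ v
        Bx≢v = Sum.[ (λ x≡u → contradiction x≡u x≢u) , id ] o
        e≢ : y ≡ u × B x ≡ x ⊎ y ≢ u × B x ≡ B y → e ≢ e₀
        e≢ (inj₁ (refl , Bx≡x)) refl = Bx≢v (trans Bx≡x (other-end ends ends₀ u≢v))
        e≢ (inj₂ (y≢u , _))          = avoids ends y≢u x≢u
        outside : y ≡ u × B x ≡ x ⊎ y ≢ u × B x ≡ B y → y ≡ u ⊎ B y ≢ v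
        outside (inj₁ (y≡u , _)) = inj₁ y≡u
        outside (inj₂ (_ , eq))  = inj₂ (λ By≡v → Bx≢v (trans eq By≡v))

      -- The climb within the branch ends at `v`, one step before the root, so that none of its
      -- edges touches the root.
      inside-trail : ∀ k x → x < n → D x ≡ 2 + k → B x ≡ v → Trail (_≢ e₀) k x v
      inside-trail k x x<n Dx≡ Bx≡v with parent x x<n (all x x<n) x≢u
        where x≢u : x ≢ u
              x≢u refl = contradiction (trans (sym root) Dx≡) (λ ())
      inside-trail zero    x x<n Dx≡ Bx≡v | e , y , e< , _ , ends , y<n , _ , Dx≡′ , br =
        subst (Trail _ 0 x) (trans (sym (Bx≡x br)) Bx≡v) stop
        where
        Bx≡x : y ≡ u × B x ≡ x ⊎ y ≢ u × B x ≡ B y → B x ≡ x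
        Bx≡x (inj₁ (_ , eq))  = eq
        Bx≡x (inj₂ (y≢u , _)) = contradiction (only-root y y<n (suc-injective (trans (sym Dx≡′) Dx≡))) y≢u
      inside-trail (suc k) x x<n Dx≡ Bx≡v | e , y , e< , _ , ends , y<n , _ , Dx≡′ , br =
        move e e< (avoids ends y≢u x≢u) (ends-sym ends) (inside-trail k y y<n Dy≡ (By≡v br))
        where
        Dy≡ : D y ≡ 2 + k
        Dy≡ = suc-injective (trans (sym Dx≡′) Dx≡)
        y≢u : y ≢ u
        y≢u refl = contradiction (trans (sym root) Dy≡) (λ ())
        x≢u : x ≢ u
        x≢u refl = contradiction (trans (sym root) Dx≡) (λ ())
        By≡v : y ≡ u × B x ≡ x ⊎ y ≢ u × B x ≡ B y → B y ≡ v
        By≡v (inj₁ (y≡u , _)) = contradiction y≡u y≢u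
        By≡v (inj₂ (_ , eq))  = trans (sym eq) Bx≡v

      crossing-detour : ∀ {a e x y} → e < m → Ends e x y → Crosses a x y → B x ≡ v →
        ∃[ k ] (k ≤ a × Trail (_≢ e₀) k u v)
      crossing-detour {a} {e} {x} {y} e< ends (1<Dx , 1<Dy , Bx≢By , sum≤) Bx≡v =
        i + suc j , i+sj≤a ,
        trail-++ (outside-trail i y y<n Dy≡ (inj₂ (λ By≡v → Bx≢By (trans Bx≡v (sym By≡v)))))
          (move e e< (avoids ends (not-root 1<Dx) (not-root 1<Dy)) (ends-sym ends)
            (inside-trail j x x<n Dx≡ Bx≡v))
        where
        x<n = proj₁ (ends<n e< ends)
        y<n = proj₂ (ends<n e< ends)
        -- The lengths d(u,y) and d(u,x) - 1 of the tree paths from `u` to `y` and from `x` to `v`.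
        i = D y ∸ 1
        j = D x ∸ 2
        Dy≡ : D y ≡ suc i
        Dy≡ = sym (m+[n∸m]≡n (<⇒≤ 1<Dy))
        Dx≡ : D x ≡ 2 + j
        Dx≡ = sym (m+[n∸m]≡n 1<Dx)
        rearrange : ∀ i j → 2 + j + suc i ≡ (i + suc j) + 2
        rearrange = solve-∀
        i+sj≤a : i + suc j ≤ a
        i+sj≤a = +-cancelʳ-≤ 2 _ _ (≤-trans (≤-reflexive (sym (trans (cong₂ _+_ Dx≡ Dy≡) (rearrange i j)))) sum≤)

      -- The trail begins outside the branch of `v` and ends inside, so it has a first edge into it,
      -- from `z` to `z′` say. The rest of the trail leads from `z′` to `v`, whose label is 2; hence
      -- D z′ ≤ k + 2. For the vertices before `z` the bound follows by `detour-step`. The root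
      -- counts as outside, whatever its entry in `B`.
      detour-crossing : ∀ {k z} → z < n → z ≡ u ⊎ B z ≢ v → Trail (_≢ e₀) k z v →
        ∃[ e ] ∃[ x ] ∃[ y ] ((e < m × Ends e x y × 1 < D x × 1 < D y × B x ≡ v × B y ≢ v) × D x + D y ≤ k + D z + 1)
      detour-crossing z<n (inj₁ refl) stop = contradiction refl u≢v
      detour-crossing z<n (inj₂ Bz≢v) stop = contradiction (proj₂ (child e₀< ends₀ (u≢v ∘ sym))) Bz≢v
      detour-crossing {suc k} {z} z<n o (move {y = z′} e e< e≢e₀ ends p) with z′ ≟ u | B z′ ≟ v
      ... | yes z′≡u | _ = detour-step e< ends k (detour-crossing (proj₂ (ends<n e< ends)) (inj₁ z′≡u) p)
      ... | no _ | no Bz′≢v = detour-step e< ends k (detour-crossing (proj₂ (ends<n e< ends)) (inj₂ Bz′≢v) p)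
      ... | no z′≢u | yes Bz′≡v = e , z′ , z , (e< , ends-sym ends , below-root z′<n z′≢u , below-root z<n z≢u ,
        Bz′≡v , Sum.[ (λ z≡u → contradiction z≡u z≢u) , id ] o) , (begin
          D z′ + D z      ≤⟨ +-monoˡ-≤ (D z) (proj₂ (reached (trail-reverse (trail-map (λ f< _ → full _ f<) p)) (all v v<n))) ⟩
          k + D v + D z   ≡⟨ cong (λ d → k + d + D z) (proj₁ (child e₀< ends₀ (u≢v ∘ sym))) ⟩
          k + 2 + D z     ≡⟨ rearrange k (D z) ⟩
          suc k + D z + 1 ∎)
        where
        open ≤-Reasoning
        z′<n = proj₂ (ends<n e< ends)
        v<n  = proj₂ (ends<n e₀< ends₀)
        rearrange : ∀ k d → k + 2 + d ≡ suc k + d + 1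
        rearrange = solve-∀
        -- An edge from the root into the branch of `v` ends in a child of the root, thus in `v`,
        -- and would be parallel to `e₀`.
        z≢u : z ≢ u
        z≢u refl = e≢e₀ (parallel e< e₀< (subst (Ends e u) (trans (sym (proj₂ (child e< ends z′≢u))) Bz′≡v) ends) ends₀)

      detour-marked : ∀ {a} → ∃[ k ] (k ≤ a × Trail (_≢ e₀) k u v) →
        ∃[ e ] ∃[ x ] ∃[ y ] (e < m × Ends e x y × Crosses a x y × B x ≡ v)
      detour-marked {a} (k , k≤a , p) with detour-crossing (proj₁ (ends<n e₀< ends₀)) (inj₁ refl) p
      ... | e , x , y , (e< , ends , 1<Dx , 1<Dy , Bx≡v , By≢v) , le =
        e , x , y , e< , ends , (1<Dx , 1<Dy , (λ eq → By≢v (trans (sym eq) Bx≡v)) ,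
          ≤-trans le (≤-trans (≤-reflexive (trans (cong (λ d → k + d + 1) root) (+-assoc k 1 1))) (+-monoˡ-≤ 2 k≤a))) , Bx≡v

-- Sums over lists without repetition

-- Each element of `ys` in turn is cut out of `xs`; as it does not recur in `ys`, the remaining
-- elements are still found in the rest. Constant weight 1 gives the pigeonhole principle
-- `length-⊆`.
sum-⊆ : ∀ {A : Set} (g : A → ℕ) {ys xs} → Unique ys → ys ⊆ xs → sum (map g ys) ≤ sum (map g xs)
sum-⊆ g {[]}     _         _  = z≤n
sum-⊆ g {y ∷ ys} {xs} (y∉ ∷ u) ys⊆ with ∈ₚ.∈-∃++ (ys⊆ (here refl))
... | xs₁ , xs₂ , refl = begin
  g y + sum (map g ys)                      ≤⟨ +-monoʳ-≤ (g y) (sum-⊆ g u ys⊆′) ⟩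
  g y + sum (map g (xs₁ ++ xs₂))            ≡⟨ cong (λ l → g y + sum l) (Listₚ.map-++ g xs₁ xs₂) ⟩
  g y + sum (map g xs₁ ++ map g xs₂)        ≡⟨ cong (g y +_) (sum-++ (map g xs₁) (map g xs₂)) ⟩
  g y + (sum (map g xs₁) + sum (map g xs₂)) ≡⟨ x∙yz≈y∙xz (g y) (sum (map g xs₁)) _ ⟩
  sum (map g xs₁) + (g y + sum (map g xs₂)) ≡⟨ sum-++ (map g xs₁) (map g (y ∷ xs₂)) ⟨
  sum (map g xs₁ ++ map g (y ∷ xs₂))        ≡⟨ cong sum (Listₚ.map-++ g xs₁ (y ∷ xs₂)) ⟨
  sum (map g (xs₁ ++ y ∷ xs₂))              ∎
  where
  open ≤-Reasoning
  ys⊆′ : ys ⊆ xs₁ ++ xs₂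
  ys⊆′ {z} z∈ with ∈ₚ.∈-++⁻ xs₁ (ys⊆ (there z∈))
  ... | inj₁ z∈₁         = ∈ₚ.∈-++⁺ˡ z∈₁
  ... | inj₂ (here refl) = contradiction refl (All.lookup y∉ z∈)
  ... | inj₂ (there z∈₂) = ∈ₚ.∈-++⁺ʳ xs₁ z∈₂

length-sum : ∀ {A : Set} (xs : List A) → sum (map (λ _ → 1) xs) ≡ List.length xs
length-sum []       = refl
length-sum (x ∷ xs) = cong suc (length-sum xs)

length-⊆ : ∀ {A : Set} {ys xs : List A} → Unique ys → ys ⊆ xs → List.length ys ≤ List.length xs
length-⊆ {ys = ys} {xs} u ys⊆ = subst₂ _≤_ (length-sum ys) (length-sum xs) (sum-⊆ (λ _ → 1) u ys⊆)

length-bounded : ∀ {ys n} → Unique ys → (∀ {y} → y ∈ ys → y < n) → List.length ys ≤ n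
length-bounded {n = n} u y< =
  ≤-trans (length-⊆ u (λ y∈ → ∈ₚ.∈-downFrom⁺ (y< y∈))) (≤-reflexive (Listₚ.length-downFrom n))

-- Adjacency lists and breadth-first search

-- Numbered from 1, so that 0 can mark the end of a chain.
Arc : ℕ → ℕ → Set
Arc M a = a ≢ 0 × a ≤ M

-- The arcs with tail x form a decreasing chain hd x, nx (hd x), … , 0.
record Chains (M : ℕ) (hd nx fr : ℕ → ℕ) : Set where
  field
    head-arc : ∀ x → hd x ≢ 0 → Arc M (hd x) × fr (hd x) ≡ x
    head-max : ∀ {a} → Arc M a → a ≤ hd (fr a)
    next-arc : ∀ {a} → Arc M a → nx a ≢ 0 → Arc M (nx a) × fr (nx a) ≡ fr a
    next<    : ∀ {a} → Arc M a → nx a < a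
    next-max : ∀ {a b} → Arc M a → Arc M b → fr b ≡ fr a → b < a → b ≤ nx a

record Adjacency (m : ℕ) (s t hd nx to ed fr : ℕ → ℕ) (M : ℕ) : Set where
  open Graphs m s t
  field
    chains   : Chains M hd nx fr
    sound    : ∀ {a} → Arc M a → ed a < m × Ends (ed a) (fr a) (to a)
    complete : ∀ {e x y} → e < m → Ends e x y → ∃[ a ] (Arc M a × ed a ≡ e × fr a ≡ x × to a ≡ y)
  open Chains chains public

module BFS {n m s t hd nx to ed fr M} (s<n : ∀ e → e < m → s e < n) (t<n : ∀ e → e < m → t e < n)
  (adj : Adjacency m s t hd nx to ed fr M) (P : ℕ → Set) (u : ℕ) where
  open Graphs m s t
  open Adjacency adj

  to<n : ∀ {a} → Arc M a → to a < n
  to<n arc with sound arc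
  ... | e< , inj₁ (_ , eq) = subst (_< n) eq (t<n _ e<)
  ... | e< , inj₂ (eq , _) = subst (_< n) eq (s<n _ e<)

  fr<n : ∀ {a} → Arc M a → fr a < n
  fr<n arc with sound arc
  ... | e< , inj₁ (eq , _) = subst (_< n) eq (s<n _ e<)
  ... | e< , inj₂ (_ , eq) = subst (_< n) eq (t<n _ e<)

  -- c is the queue index of the vertex being scanned, l the length of
  -- the queue and p the next arc to be scanned, 0 if none is left.
  Scanned : (ℕ → ℕ) → ℕ → ℕ → ℕ → Set
  Scanned Q c p a = ∃[ i ] (i ≤ c × fr a ≡ Q i × (i < c ⊎ p < a))

  -- By `mono` and `near` the labels along the queue are sorted and exceed that of the scanned
  -- vertex by at most one. That is why an arc to a vertex found earlier satisfies the inequality in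
  -- `scanned`.
  record Search (D B Q : ℕ → ℕ) (c l p : ℕ) : Set where
    field
      c<l     : c < l
      root    : D u ≡ 1
      queue<n : ∀ i → i < l → Q i < n
      queued  : ∀ i → i < l → D (Q i) ≢ 0
      index   : ∀ x → x < n → D x ≢ 0 → ∃[ i ] (i < l × Q i ≡ x)
      inj     : ∀ i j → i < l → j < l → Q i ≡ Q j → i ≡ j
      mono    : ∀ i j → i ≤ j → j < l → D (Q i) ≤ D (Q j)
      near    : ∀ j → j < l → D (Q j) ≤ suc (D (Q c))
      arc     : p ≢ 0 → Arc M p × fr p ≡ Q c
      scanned : ∀ a → Arc M a → Scanned Q c p a → P (ed a) → D (to a) ≢ 0 × D (to a) ≤ suc (D (fr a))
      parent  : ∀ x → x < n → D x ≢ 0 → x ≢ u → ∃[ e ] ∃[ y ] (e < m × P e × Ends e y x ×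
        y < n × D y ≢ 0 × D x ≡ suc (D y) × (y ≡ u × B x ≡ x ⊎ y ≢ u × B x ≡ B y))

  start : ∀ {D B Q} → u < n → D u ≡ 1 → (∀ x → x < n → x ≢ u → D x ≡ 0) → Q 0 ≡ u → Search D B Q 0 1 (hd u)
  start {D} {B} {Q} u<n Du≡1 rest Q0≡u = record
    { c<l     = z<s
    ; root    = Du≡1
    ; queue<n = λ { zero _ → ≤-trans (s≤s (≤-reflexive Q0≡u)) u<n ; (suc i) (s≤s ()) }
    ; queued  = λ { zero _ eq → 1+n≢0 (trans (sym Du≡1) (trans (cong D (sym Q0≡u)) eq)) ; (suc i) (s≤s ()) }
    ; index   = λ x x<n Dx≢0 → 0 , z<s , trans Q0≡u (sym (is-root x x<n Dx≢0))
    ; inj     = λ { zero zero _ _ _ → refl ; (suc i) _ (s≤s ()) ; zero (suc j) _ (s≤s ()) }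
    ; mono    = λ { zero zero _ _ → ≤-refl ; (suc i) zero () ; _ (suc j) _ (s≤s ()) }
    ; near    = λ { zero _ → n≤1+n _ ; (suc j) (s≤s ()) }
    ; arc     = λ ≢0 → proj₁ (head-arc u ≢0) , trans (proj₂ (head-arc u ≢0)) (sym Q0≡u)
    -- `hd u` is the largest arc with tail `u`, so that no arc counts as scanned yet.
    ; scanned = λ { a arc (zero , _ , eq , inj₂ lt) _ → contradiction
                      (subst (λ x → a ≤ hd x) (trans eq Q0≡u) (head-max arc)) (<⇒≱ lt) }
    ; parent  = λ x x<n Dx≢0 x≢u → contradiction (is-root x x<n Dx≢0) x≢u
    }
    where
    is-root : ∀ x → x < n → D x ≢ 0 → x ≡ u
    is-root x x<n Dx≢0 with x ≟ u
    ... | yes eq = eq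
    ... | no  ne = contradiction (rest x x<n ne) Dx≢0

  module _ {D B Q c l p} (S : Search D B Q c l p) where
    open Search S

    pop : p ≡ 0 → suc c < l → Search D B Q (suc c) l (hd (Q (suc c)))
    pop refl sc<l = record
      { c<l     = sc<l
      ; root    = root
      ; queue<n = queue<n
      ; queued  = queued
      ; index   = index
      ; inj     = inj
      ; mono    = mono
      ; near    = λ j j<l → ≤-trans (near j j<l) (s≤s (mono c (suc c) (n≤1+n c) sc<l))
      ; arc     = head-arc _
      ; scanned = scanned′
      ; parent  = parent
      }
      where
      scanned′ : ∀ a → Arc M a → Scanned Q (suc c) (hd (Q (suc c))) a → P (ed a) →
        D (to a) ≢ 0 × D (to a) ≤ suc (D (fr a))
      scanned′ a ar (i , i≤ , eq , inj₁ i<sc) = scanned a ar (i , ≤-pred i<sc , eq , inj₂ (n≢0⇒n>0 (proj₁ ar)))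
      scanned′ a ar (i , i≤ , eq , inj₂ lt) with m≤n⇒m<n∨m≡n i≤
      ... | inj₁ i<sc = scanned a ar (i , ≤-pred i<sc , eq , inj₂ (n≢0⇒n>0 (proj₁ ar)))
      ... | inj₂ refl = contradiction (subst (λ x → a ≤ hd x) eq (head-max ar)) (<⇒≱ lt)

    module _ (p≢0 : p ≢ 0) where
      private
        p-arc : Arc M p
        p-arc = proj₁ (arc p≢0)
        fr≡ : fr p ≡ Q c
        fr≡ = proj₂ (arc p≢0)

      next-arc′ : nx p ≢ 0 → Arc M (nx p) × fr (nx p) ≡ Q c
      next-arc′ ≢0 = proj₁ (next-arc p-arc ≢0) , trans (proj₂ (next-arc p-arc ≢0)) fr≡

      -- By `next-max` no arc with the same tail lies strictly between `nx p` and `p`, so that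
      -- advancing the pointer adds only `p` to the scanned arcs.
      rescan : ∀ a → Arc M a → Scanned Q c (nx p) a → Scanned Q c p a ⊎ a ≡ p
      rescan a ar (i , i≤ , eq , inj₁ i<c) = inj₁ (i , i≤ , eq , inj₁ i<c)
      rescan a ar (i , i≤ , eq , inj₂ lt) with m≤n⇒m<n∨m≡n i≤
      ... | inj₁ i<c  = inj₁ (i , i≤ , eq , inj₁ i<c)
      ... | inj₂ refl with <-cmp a p
      ...   | tri< a<p _ _ = contradiction (next-max p-arc ar (trans eq (sym fr≡)) a<p) (<⇒≱ lt)
      ...   | tri≈ _ a≡p _ = inj₂ a≡p
      ...   | tri> _ _ p<a = inj₁ (i , i≤ , eq , inj₂ p<a)

      pass-arc : (P (ed p) → D (to p) ≢ 0) → Search D B Q c l (nx p)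
      pass-arc seen = record
        { c<l     = c<l
          ; root    = root
        ; queue<n = queue<n
        ; queued  = queued
        ; index   = index
        ; inj     = inj
        ; mono    = mono
        ; near    = near
        ; arc     = next-arc′
        ; scanned = scanned′
        ; parent  = parent
        }
        where
        scanned′ : ∀ a → Arc M a → Scanned Q c (nx p) a → P (ed a) → D (to a) ≢ 0 × D (to a) ≤ suc (D (fr a))
        scanned′ a ar sc Pe with rescan a ar sc
        ... | inj₁ sc′  = scanned a ar sc′ Pe
        ... | inj₂ refl with index (to p) (to<n p-arc) (seen Pe)
        ...   | j , j<l , eq = seen Pe , subst₂ (λ x y → D x ≤ suc (D y)) eq (sym fr≡) (near j j<l)

      -- The new label D (Q c) + 1 is the largest that `near` admits; hence the queue stays sorted
      -- when `v` is appended.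
      discover : ∀ {b v d} → v ≡ to p → d ≡ suc (D (fr p)) → P (ed p) → D v ≡ 0 →
        (fr p ≡ u × b ≡ v ⊎ fr p ≢ u × b ≡ B (fr p)) →
        Search (D [ v ↦ d ]) (B [ v ↦ b ]) (Q [ l ↦ v ]) c (suc l) (nx p)
      discover {b} {v} {d} refl refl Pe Dv≡0 branch = record
        { c<l     = m≤n⇒m≤1+n c<l
        ; root    = trans (D-old (λ eq → 1+n≢0 (trans (sym root) eq))) root
        ; queue<n = queue<n′
        ; queued  = queued′
        ; index   = index′
        ; inj     = inj′
        ; mono    = mono′
        ; near    = near′
        ; arc     = λ ≢0 → proj₁ (next-arc′ ≢0) , trans (proj₂ (next-arc′ ≢0)) (sym (Q-old c c<l))
        ; scanned = scanned′
        ; parent  = parent′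
        }
        where
        D′ B′ Q′ : ℕ → ℕ
        D′ = D [ v ↦ d ]
        B′ = B [ v ↦ b ]
        Q′ = Q [ l ↦ v ]
        v≢ : ∀ {x} → D x ≢ 0 → x ≢ v
        v≢ Dx≢0 refl = Dx≢0 Dv≡0
        D-old : ∀ {x} → D x ≢ 0 → D′ x ≡ D x
        D-old Dx≢0 = update-other D d (v≢ Dx≢0)
        B-old : ∀ {x} → x ≢ v → B′ x ≡ B x
        B-old = update-other B b
        Q-old : ∀ i → i < l → Q′ i ≡ Q i
        Q-old i i<l = update-other Q v (<⇒≢ i<l)
        Q-new : Q′ l ≡ v
        Q-new = update-same Q l v
        D-new : D′ v ≡ suc (D (Q c))
        D-new = trans (update-same D v d) (cong (λ x → suc (D x)) fr≡)
        DQ-old : ∀ i → i < l → D′ (Q′ i) ≡ D (Q i)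
        DQ-old i i<l = trans (cong D′ (Q-old i i<l)) (D-old (queued i i<l))
        DQ-new : D′ (Q′ l) ≡ suc (D (Q c))
        DQ-new = trans (cong D′ Q-new) D-new
        Dfr≢0 : D (fr p) ≢ 0
        Dfr≢0 eq = queued c c<l (trans (cong D (sym fr≡)) eq)
        split : ∀ {i} → i < suc l → i < l ⊎ i ≡ l
        split i< = m≤n⇒m<n∨m≡n (≤-pred i<)
        queue<n′ : ∀ i → i < suc l → Q′ i < n
        queue<n′ i i< with split i<
        ... | inj₁ i<l  = ≤-trans (s≤s (≤-reflexive (Q-old i i<l))) (queue<n i i<l)
        ... | inj₂ refl = ≤-trans (s≤s (≤-reflexive Q-new)) (to<n p-arc)
        queued′ : ∀ i → i < suc l → D′ (Q′ i) ≢ 0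
        queued′ i i< eq with split i<
        ... | inj₁ i<l  = queued i i<l (trans (sym (DQ-old i i<l)) eq)
        ... | inj₂ refl = 1+n≢0 (trans (sym DQ-new) eq)
        index′ : ∀ x → x < n → D′ x ≢ 0 → ∃[ i ] (i < suc l × Q′ i ≡ x)
        index′ x x<n D′x≢0 with x ≟ v
        ... | yes refl = l , ≤-refl , Q-new
        ... | no  x≢v with index x x<n (λ eq → D′x≢0 (trans (update-other D d x≢v) eq))
        ...   | i , i<l , eq = i , m≤n⇒m≤1+n i<l , trans (Q-old i i<l) eq
        inj′ : ∀ i j → i < suc l → j < suc l → Q′ i ≡ Q′ j → i ≡ j
        inj′ i j i< j< eq with split i< | split j<
        ... | inj₁ i<l  | inj₁ j<l  = inj i j i<l j<l (trans (sym (Q-old i i<l)) (trans eq (Q-old j j<l)))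
        ... | inj₁ i<l  | inj₂ refl = contradiction (trans (sym (Q-old i i<l)) (trans eq Q-new)) (v≢ (queued i i<l))
        ... | inj₂ refl | inj₁ j<l  = contradiction (trans (sym (Q-old j j<l)) (trans (sym eq) Q-new)) (v≢ (queued j j<l))
        ... | inj₂ refl | inj₂ refl = refl
        mono′ : ∀ i j → i ≤ j → j < suc l → D′ (Q′ i) ≤ D′ (Q′ j)
        mono′ i j i≤j j< with split j<
        ... | inj₁ j<l = subst₂ _≤_ (sym (DQ-old i (≤-<-trans i≤j j<l))) (sym (DQ-old j j<l)) (mono i j i≤j j<l)
        ... | inj₂ refl with split (s≤s i≤j)
        ...   | inj₁ i<l  = subst₂ _≤_ (sym (DQ-old i i<l)) (sym DQ-new) (near i i<l)
        ...   | inj₂ refl = ≤-refl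
        near′ : ∀ j → j < suc l → D′ (Q′ j) ≤ suc (D′ (Q′ c))
        near′ j j< with split j<
        ... | inj₁ j<l  = subst₂ (λ x y → x ≤ suc y) (sym (DQ-old j j<l)) (sym (DQ-old c c<l)) (near j j<l)
        ... | inj₂ refl = ≤-reflexive (trans DQ-new (cong suc (sym (DQ-old c c<l))))
        unscan : ∀ {a q} → Scanned Q′ c q a → Scanned Q c q a
        unscan (i , i≤c , eq , r) = i , i≤c , trans eq (Q-old i (≤-<-trans i≤c c<l)) , r
        scanned′ : ∀ a → Arc M a → Scanned Q′ c (nx p) a → P (ed a) → D′ (to a) ≢ 0 × D′ (to a) ≤ suc (D′ (fr a))
        scanned′ a ar sc Pa with rescan a ar (unscan sc)
        ... | inj₂ refl = (λ eq → 1+n≢0 (trans (sym D-new) eq)) ,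
          ≤-reflexive (trans (update-same D v d) (cong suc (sym (D-old Dfr≢0))))
        ... | inj₁ sc′ with scanned a ar sc′ Pa
        ...   | D≢0 , D≤ = (λ eq → D≢0 (trans (sym (D-old D≢0)) eq)) ,
          subst₂ (λ x y → x ≤ suc y) (sym (D-old D≢0)) (sym (D-old (fr≢0 sc′))) D≤
          where
          fr≢0 : Scanned Q c p a → D (fr a) ≢ 0
          fr≢0 (i , i≤c , eq , _) D≡0 = queued i (≤-<-trans i≤c c<l) (trans (cong D (sym eq)) D≡0)
        parent′ : ∀ x → x < n → D′ x ≢ 0 → x ≢ u → ∃[ e ] ∃[ y ] (e < m × P e × Ends e y x ×
          y < n × D′ y ≢ 0 × D′ x ≡ suc (D′ y) × (y ≡ u × B′ x ≡ x ⊎ y ≢ u × B′ x ≡ B′ y))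
        parent′ x x<n D′x≢0 x≢u with x ≟ v
        ... | yes refl = ed p , fr p , proj₁ (sound p-arc) , Pe , proj₂ (sound p-arc) , fr<n p-arc ,
          (λ eq → Dfr≢0 (trans (sym (D-old Dfr≢0)) eq)) , trans (update-same D v d) (cong suc (sym (D-old Dfr≢0))) ,
          Sum.map (λ (eq , b≡) → eq , trans (update-same B v b) b≡)
            (λ (ne , b≡) → ne , trans (update-same B v b) (trans b≡ (sym (B-old (v≢ Dfr≢0))))) branch
        ... | no  x≢v with parent x x<n (λ eq → D′x≢0 (trans (update-other D d x≢v) eq)) x≢u
        ...   | e , y , e< , Pe′ , ends , y<n , Dy≢0 , Dx≡ , br = e , y , e< , Pe′ , ends , y<n ,
          (λ eq → Dy≢0 (trans (sym (D-old Dy≢0)) eq)) ,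
          trans (update-other D d x≢v) (trans Dx≡ (cong suc (sym (D-old Dy≢0)))) ,
          Sum.map (λ (eq , B≡) → eq , trans (B-old x≢v) B≡)
            (λ (ne , B≡) → ne , trans (B-old x≢v) (trans B≡ (sym (B-old (v≢ Dy≢0))))) br

    finish : p ≡ 0 → suc c ≡ l → Layered n P u D B
    finish refl refl = record { root = root ; closed = closed ; parent = parent }
      where
      closed : ∀ {e x y} → e < m → P e → Ends e x y → D x ≢ 0 → D y ≢ 0 × D y ≤ suc (D x)
      closed e< Pe ends Dx≢0 with complete e< ends
      ... | a , ar , refl , refl , refl with index (fr a) (fr<n ar) Dx≢0
      ...   | i , i<l , eq = scanned a ar (i , ≤-pred i<l , sym eq , inj₂ (n≢0⇒n>0 (proj₁ ar))) Pe

  -- Every iteration but the idle ones scans a new arc a or a new vertex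
  -- x, recorded as the event a or suc M + x.
  record Progress (k : ℕ) (Q : ℕ → ℕ) (c p : ℕ) : Set where
    field
      events   : List ℕ
      distinct : Unique events
      count    : List.length events ≡ k
      past     : ∀ {a} → a ∈ events → Arc M a × Scanned Q c p a ⊎ ∃[ i ] (i ≤ c × a ≡ suc M + Q i)

  progress-start : ∀ {Q c p} → Progress 0 Q c p
  progress-start = record { events = [] ; distinct = [] ; count = refl ; past = λ () }

  module _ {D B Q c l p k} (S : Search D B Q c l p) (G : Progress k Q c p) where
    open Search S
    open Progress G

    progress-pop : p ≡ 0 → suc c < l → Progress (suc k) Q (suc c) (hd (Q (suc c)))
    progress-pop refl sc<l = record
      { events   = suc M + Q (suc c) ∷ events
      ; distinct = All.tabulate (λ x∈ → λ { refl → fresh x∈ }) ∷ distinct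
      ; count    = cong suc count
      ; past     = past′
      }
      where
      fresh : suc M + Q (suc c) ∉ events
      fresh x∈ with past x∈
      ... | inj₁ ((_ , a≤M) , _) = <⇒≱ (s≤s a≤M) (m≤m+n (suc M) _)
      ... | inj₂ (i , i≤c , eq) = <⇒≢ (s≤s i≤c)
        (inj i (suc c) (<-trans (s≤s i≤c) sc<l) sc<l (sym (+-cancelˡ-≡ (suc M) _ _ eq)))
      past′ : ∀ {a} → a ∈ suc M + Q (suc c) ∷ events →
        Arc M a × Scanned Q (suc c) (hd (Q (suc c))) a ⊎ ∃[ i ] (i ≤ suc c × a ≡ suc M + Q i)
      past′ (here refl) = inj₂ (suc c , ≤-refl , refl)
      past′ (there a∈) with past a∈
      ... | inj₁ (ar , i , i≤c , eq , _) = inj₁ (ar , i , m≤n⇒m≤1+n i≤c , eq , inj₁ (s≤s i≤c))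
      ... | inj₂ (i , i≤c , eq)          = inj₂ (i , m≤n⇒m≤1+n i≤c , eq)

    -- One conclusion for an arc that discovers nothing, one for an arc that appends a vertex.
    -- Events refer to queue entries up to `c` only, which both leave alone.
    progress-arc : ∀ {l′ v} → l′ ≡ l → p ≢ 0 → Progress (suc k) Q c (nx p) × Progress (suc k) (Q [ l′ ↦ v ]) c (nx p)
    progress-arc {v = v} refl p≢0 = advance Q (λ _ _ → refl) , advance (Q [ l ↦ v ]) (λ i i<l → update-other Q v (<⇒≢ i<l))
      where
      p-arc = proj₁ (arc p≢0)
      fresh : p ∉ events
      fresh p∈ with past p∈
      ... | inj₁ (_ , i , i≤c , eq , inj₁ i<c) =
        <⇒≢ i<c (inj i c (≤-<-trans i≤c c<l) c<l (trans (sym eq) (proj₂ (arc p≢0))))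
      ... | inj₁ (_ , i , i≤c , eq , inj₂ p<p) = <-irrefl refl p<p
      ... | inj₂ (i , _ , eq) = <⇒≱ (s≤s (proj₂ p-arc)) (≤-trans (m≤m+n (suc M) (Q i)) (≤-reflexive (sym eq)))
      advance : ∀ Q′ → (∀ i → i < l → Q′ i ≡ Q i) → Progress (suc k) Q′ c (nx p)
      advance Q′ same = record
        { events   = p ∷ events
        ; distinct = All.tabulate (λ x∈ → λ { refl → fresh x∈ }) ∷ distinct
        ; count    = cong suc count
        ; past     = past′
        }
        where
        same′ : ∀ i → i ≤ c → Q i ≡ Q′ i
        same′ i i≤c = sym (same i (≤-<-trans i≤c c<l))
        past′ : ∀ {a} → a ∈ p ∷ events → Arc M a × Scanned Q′ c (nx p) a ⊎ ∃[ i ] (i ≤ c × a ≡ suc M + Q′ i)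
        past′ (here refl) = inj₁ (p-arc , c , ≤-refl , trans (proj₂ (arc p≢0)) (same′ c ≤-refl) , inj₂ (next< p-arc))
        past′ (there a∈) with past a∈
        ... | inj₁ (ar , i , i≤c , eq , r) = inj₁ (ar , i , i≤c , trans eq (same′ i i≤c) ,
          Sum.map₂ (λ p<a → <-trans (next< p-arc) p<a) r)
        ... | inj₂ (i , i≤c , eq) = inj₂ (i , i≤c , trans eq (cong (suc M +_) (same′ i i≤c)))

    -- Vertices are shifted beyond the arcs, so the events are distinct numbers below M + 1 + n. A
    -- loop with more iterations must have become idle.
    progress-bounded : k ≤ suc M + n
    progress-bounded = subst (_≤ suc M + n) count (length-bounded distinct bounded)
      where
      bounded : ∀ {a} → a ∈ events → a < suc M + n
      bounded a∈ with past a∈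
      ... | inj₁ ((_ , a≤M) , _)     = ≤-trans (s≤s a≤M) (m≤m+n (suc M) n)
      ... | inj₂ (i , i≤c , refl) = +-monoʳ-< (suc M) (queue<n i (≤-<-trans i≤c c<l))

-- Breadth-first search as a program

-- Parameters of the search stage; in the two stages before it, these are
-- the variables that compute them.
pattern NUM     = 0
pattern SIZE    = 1
pattern GOAL    = 2
pattern STRETCH = 3
pattern CHOICES = 4
pattern ROUNDS  = 5
pattern TRIALS  = 6

pattern ROOT  = 7
pattern CUR   = 8
pattern END   = 9
pattern PTR   = 10
pattern VTX   = 11
pattern TAIL  = 12
pattern IDX   = 13
pattern CHOSEN = 14
pattern COUNT = 15
pattern SUM   = 16
pattern VALID = 17
pattern FOUND = 18
pattern CARRY = 19
pattern STEP  = 20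

SRC TGT WEIGHT HEAD NEXT TO EDGE FROM : Array
SRC    = # 0
TGT    = # 1
WEIGHT = # 2
HEAD   = # 3
NEXT   = # 4
TO     = # 5
EDGE   = # 6
FROM   = # 7

REMOVED DIST BRANCH QUEUE MARK CAND DIGIT WITNESS : Array
REMOVED = # 0
DIST    = # 1
BRANCH  = # 2
QUEUE   = # 3
MARK    = # 4
CAND    = # 5
DIGIT   = # 6
WITNESS = # 7

incr : ℕ → Cmd
incr x = x ≔ lit 1 ⊕ var x

fill : Array → ℕ → Exp → Cmd
fill k x e = call
  ( IDX ≔ lit 0 ﹔
    for x (put k (var IDX) e ﹔ incr IDX) )

bfsStep : Cmd
bfsStep =
  when lit 0 ≺ var PTR
  then ( VTX ≔ fix TO (var PTR) ﹔
         TAIL ≔ fix FROM (var PTR) ﹔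
         (when (get REMOVED (fix EDGE (var PTR)) ≃ lit 0) ∧ (get DIST (var VTX) ≃ lit 0)
          -- Label 1 identifies the root, whose children start the branches.
          then ( (when get DIST (var TAIL) ≃ lit 1
                  then put BRANCH (var VTX) (var VTX)
                  else put BRANCH (var VTX) (get BRANCH (var TAIL))) ﹔
                 put DIST (var VTX) (lit 1 ⊕ get DIST (var TAIL)) ﹔
                 put QUEUE (var END) (var VTX) ﹔
                 incr END )
          else pass) ﹔
         PTR ≔ fix NEXT (var PTR) )
  else (when lit 1 ⊕ var CUR ≺ var END
        then ( incr CUR ﹔ PTR ≔ fix HEAD (get QUEUE (var CUR)) )
        else pass)

bfs : Cmd
bfs = call
  ( fill DIST NUM (lit 0) ﹔
    put DIST (var ROOT) (lit 1) ﹔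
    put QUEUE (lit 0) (var ROOT) ﹔
    CUR ≔ lit 0 ﹔
    END ≔ lit 1 ﹔
    PTR ≔ fix HEAD (var ROOT) ﹔
    for ROUNDS bfsStep )

module Fill (η : Env) where
  open Semantics η
  open Frames η

  setArr-same : ∀ α k i v → setArr α k i v k ≡ α k [ i ↦ v ]
  setArr-same α k i v rewrite dec-true (k Finₚ.≟ k) refl = refl

  fill-correct : ∀ k x e v {Q s} → (∀ s → ⟦ e ⟧ s ≡ v) →
    (∀ s′ → Unchanged (fill k x e) s s′ → (∀ i → i < params η x → arrs s′ k i ≡ v) → Q s′) →
    wp (fill k x e) Q s
  fill-correct k x e v {Q} {s} e≡v q =
    wp-frame (fill k x e) {s = s}
      (wp-call (wp-for x (put k (var IDX) e ﹔ incr IDX)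
        (λ i s′ → vars s′ IDX ≡ i × (∀ j → j < i → arrs s′ k j ≡ v))
        (refl , λ _ ())
        iteration
        (λ _ → proj₂)))
      q
    where
    iteration : ∀ i s′ → i < params η x → vars s′ IDX ≡ i × (∀ j → j < i → arrs s′ k j ≡ v) →
      suc (vars s′ IDX) ≡ suc i ×
      (∀ j → j < suc i → setArr (arrs s′) k (vars s′ IDX) (⟦ e ⟧ s′) k j ≡ v)
    iteration i s′ _ (refl , old) = refl , new
      where
      new : ∀ j → j < suc i → setArr (arrs s′) k (vars s′ IDX) (⟦ e ⟧ s′) k j ≡ v
      new j j< with m≤n⇒m<n∨m≡n (≤-pred j<)
      ... | inj₁ j<i = trans (cong (λ g → g j) (setArr-same (arrs s′) k _ _))
        (trans (update-other (arrs s′ k) _ (<⇒≢ j<i)) (old j j<i))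
      ... | inj₂ refl = trans (cong (λ g → g j) (setArr-same (arrs s′) k _ _))
        (trans (update-same (arrs s′ k) _ _) (e≡v s′))

module BFSCorrect (η : Env) (M : ℕ)
  (s<n : ∀ e → e < params η SIZE → tables η SRC e < params η NUM)
  (t<n : ∀ e → e < params η SIZE → tables η TGT e < params η NUM)
  (adj : Adjacency (params η SIZE) (tables η SRC) (tables η TGT)
    (tables η HEAD) (tables η NEXT) (tables η TO) (tables η EDGE) (tables η FROM) M)
  (rounds : suc M + params η NUM < params η ROUNDS) where
  open Env η renaming (params to π; tables to ρ) using ()
  open Semantics η
  open Frames η
  open Fill η
  open Graphs (π SIZE) (ρ SRC) (ρ TGT)

  bfs-correct : ∀ {Q s} → vars s ROOT < π NUM →
    (∀ s′ → Unchanged bfs s s′ →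
      Layered (π NUM) (λ e → arrs s REMOVED e ≡ 0) (vars s ROOT) (arrs s′ DIST) (arrs s′ BRANCH) → Q s′) →
    wp bfs Q s
  bfs-correct {Q} {s} u<n q = wp-frame bfs {s = s}
    (wp-call (fill-correct DIST NUM (lit 0) 0 {s = s} (λ _ → refl) λ s′ same zeros →
      wp-for ROUNDS bfsStep Inv
        ( Unchanged.arr≡ same REMOVED refl
        , subst (λ u′ → Search (arrs s′ DIST [ u′ ↦ 1 ]) (arrs s′ BRANCH) (arrs s′ QUEUE [ 0 ↦ u′ ]) 0 1 (ρ HEAD u′))
            (sym (Unchanged.var≡ same ROOT refl))
            (start u<n (update-same (arrs s′ DIST) u 1)
              (λ x x<n x≢u → trans (update-other (arrs s′ DIST) 1 x≢u) (zeros x x<n))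
              (update-same (arrs s′ QUEUE) 0 u))
        , inj₂ progress-start)
        iteration
        finished))
    q
    where
    u : ℕ
    u = vars s ROOT
    P : ℕ → Set
    P e = arrs s REMOVED e ≡ 0
    open BFS s<n t<n adj P u

    -- Either the queue is exhausted, and remains so, or each of the `k` iterations made progress;
    -- the latter is impossible at the end of the loop.
    Inv : ℕ → Store → Set
    Inv k s′ = arrs s′ REMOVED ≡ arrs s REMOVED ×
      Search (arrs s′ DIST) (arrs s′ BRANCH) (arrs s′ QUEUE) (vars s′ CUR) (vars s′ END) (vars s′ PTR) ×
      ((vars s′ PTR ≡ 0 × suc (vars s′ CUR) ≡ vars s′ END) ⊎ Progress k (arrs s′ QUEUE) (vars s′ CUR) (vars s′ PTR))

    iteration : ∀ k s′ → k < π ROUNDS → Inv k s′ → wp bfsStep (Inv (suc k)) s′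
    iteration k s′ _ (same , S , state) = arc-iteration , queue-iteration
      where
      D B Qu : ℕ → ℕ
      D  = arrs s′ DIST
      B  = arrs s′ BRANCH
      Qu = arrs s′ QUEUE
      c p : ℕ
      c = vars s′ CUR
      p = vars s′ PTR
      arc-iteration : 0 < p → _
      arc-iteration 0<p = discovering , λ skipped → same ,
          pass-arc S p≢0 (λ Pe Dv≡0 → skipped (trans (cong (λ g → g (ρ EDGE p)) same) Pe , Dv≡0)) ,
          inj₂ (proj₁ (progress-arc S progress {v = 0} refl p≢0))
        where
        p≢0 : p ≢ 0
        p≢0 = >⇒≢ 0<p
        progress : Progress k Qu c p
        progress = Sum.[ (λ (p≡0 , _) → contradiction p≡0 p≢0) , id ]′ state
        fr<n′ : ρ FROM p < π NUM
        fr<n′ = fr<n (proj₁ (Search.arc S p≢0))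
        D≡1⇒root : D (ρ FROM p) ≡ 1 → ρ FROM p ≡ u
        D≡1⇒root eq with ρ FROM p ≟ u
        ... | yes fr≡u = fr≡u
        ... | no fr≢u with Search.parent S _ fr<n′ (λ D≡0 → 1+n≢0 (trans (sym eq) D≡0)) fr≢u
        ...   | _ , _ , _ , _ , _ , _ , Dy≢0 , D≡ , _ = contradiction (suc-injective (trans (sym D≡) eq)) Dy≢0
        discovering : _ → _
        discovering (unremoved , Dv≡0) =
          (λ D≡1 → same , found (inj₁ (D≡1⇒root D≡1 , refl)) , enqueued) ,
          (λ D≢1 → same , found (inj₂ ((λ fr≡u → D≢1 (trans (cong D fr≡u) (Search.root S))) , refl)) , enqueued)
          where
          found : ∀ {b} → (ρ FROM p ≡ u × b ≡ ρ TO p ⊎ ρ FROM p ≢ u × b ≡ B (ρ FROM p)) → _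
          found = discover S p≢0 refl refl (trans (cong (λ g → g (ρ EDGE p)) (sym same)) unremoved) Dv≡0
          enqueued : _ ⊎ _
          enqueued = inj₂ (proj₂ (progress-arc S progress {v = ρ TO p} refl p≢0))
      queue-iteration : ¬ 0 < p → _
      queue-iteration ¬0<p =
        (λ sc<l → same , pop S p≡0 sc<l ,
          inj₂ (Sum.[ (λ (_ , eq) → contradiction eq (<⇒≢ sc<l)) , (λ G → progress-pop S G p≡0 sc<l) ]′ state)) ,
        (λ sc≮l → same , S , inj₁ (p≡0 , ≤-antisym (Search.c<l S) (≮⇒≥ sc≮l)))
        where
        p≡0 : p ≡ 0
        p≡0 = n≤0⇒n≡0 (≮⇒≥ ¬0<p)

    finished : ∀ s′ → Inv (π ROUNDS) s′ → Layered (π NUM) P u (arrs s′ DIST) (arrs s′ BRANCH)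
    finished s′ (_ , S , inj₁ (p≡0 , eq)) = finish S p≡0 eq
    finished s′ (_ , S , inj₂ G) = contradiction (progress-bounded S G) (<⇒≱ rounds)

-- The first two stages: loop counts and adjacency lists

-- The quotient of numerator and denominator is found by `NUM` attempts to subtract, which caps it
-- at n. In `CHOICES`, which becomes 1 + W (2A + 1), the 1 is for the dummy edge. `ROUNDS` exceeds
-- the number of arcs and vertices together by 2.
parametersCmd : Cmd
parametersCmd =
  STRETCH ≔ lit 0 ﹔
  VTX ≔ cell (lit 3) ﹔
  for NUM (when cell (lit 4) ≺ lit 1 ⊕ var VTX
           then ( VTX ≔ var VTX ⊖ cell (lit 4) ﹔ incr STRETCH )
           else pass) ﹔
  CHOICES ≔ lit 1 ﹔
  for GOAL (CHOICES ≔ lit 1 ⊕ (var STRETCH ⊕ var STRETCH) ⊕ var CHOICES) ﹔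
  -- Parameters and variables change places after the stage, so that values needed later must be
  -- handed on.
  NUM ≔ par NUM ﹔
  SIZE ≔ par SIZE ﹔
  GOAL ≔ par GOAL ﹔
  ROUNDS ≔ lit 2 ⊕ (par SIZE ⊕ par SIZE ⊕ par NUM)

pushArc : Cmd
pushArc = call
  ( incr COUNT ﹔
    put FROM (var COUNT) (var VTX) ﹔
    put TO (var COUNT) (var TAIL) ﹔
    put EDGE (var COUNT) (var IDX) ﹔
    put NEXT (var COUNT) (get HEAD (var VTX)) ﹔
    put HEAD (var VTX) (var COUNT) )

pushEdge : Cmd
pushEdge = call
  ( pushArc ﹔
    SUM ≔ var VTX ﹔
    VTX ≔ var TAIL ﹔
    TAIL ≔ var SUM ﹔
    pushArc )

-- `TRIALS` becomes a power of `CHOICES`, every multiplication being a loop of additions. This takes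
-- about W times `CHOICES` steps, within the time allowed for the trials.
tablesCmd : Cmd
tablesCmd =
  TRIALS ≔ lit 1 ﹔
  for GOAL
    ( SUM ≔ lit 0 ﹔
      for CHOICES (SUM ≔ var TRIALS ⊕ var SUM) ﹔
      TRIALS ≔ var SUM ) ﹔
  COUNT ≔ lit 0 ﹔
  IDX ≔ lit 0 ﹔
  CUR ≔ lit 5 ﹔
  for SIZE
    ( VTX ≔ cell (var CUR) ﹔
      TAIL ≔ cell (lit 1 ⊕ var CUR) ﹔
      put SRC (var IDX) (var VTX) ﹔
      put TGT (var IDX) (var TAIL) ﹔
      put WEIGHT (var IDX) (cell (lit 2 ⊕ var CUR)) ﹔
      CUR ≔ lit 3 ⊕ var CUR ﹔
      pushEdge ﹔
      incr IDX ) ﹔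
  NUM ≔ par NUM ﹔
  SIZE ≔ par SIZE ﹔
  GOAL ≔ par GOAL ﹔
  STRETCH ≔ par STRETCH ﹔
  CHOICES ≔ par CHOICES ﹔
  ROUNDS ≔ par ROUNDS

module Parameters (π : ℕ → ℕ) (ρ : Array → ℕ → ℕ) (b : ℕ) where
  η : Env
  η = env π ρ (5 + b)
  open Semantics η
  open Frames η

  -- STRETCH becomes the minimum of NUM and the integral part of p / q.
  record Computed (p q : ℕ) (s : Store) : Set where
    field
      num≡     : vars s NUM ≡ π NUM
      size≡    : vars s SIZE ≡ π SIZE
      goal≡    : vars s GOAL ≡ π GOAL
      stretch≤ : vars s STRETCH * q ≤ p
      stretch≥ : vars s STRETCH ≡ π NUM ⊎ p < suc (vars s STRETCH) * q
      choices≡ : vars s CHOICES ≡ suc (π GOAL * suc (vars s STRETCH + vars s STRETCH))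
      rounds≡  : vars s ROUNDS ≡ 2 + (π SIZE + π SIZE + π NUM)

  parameters-correct : ∀ {s} → wp parametersCmd (λ s′ → Computed (cells s 3) (cells s 4) s′) s
  parameters-correct {s} =
    wp-for NUM _ Divided
      (+-identityʳ p , inj₁ refl , refl)
      divide
      λ s₁ (sum≡ , ≥n , _) →
    wp-for GOAL _ (λ i s′ → vars s′ STRETCH ≡ vars s₁ STRETCH × vars s′ CHOICES ≡ suc (i * suc (vars s₁ STRETCH + vars s₁ STRETCH)))
      (refl , refl)
      (λ i s′ _ (eqA , eq) → eqA , cong suc (trans (cong₂ _+_ (cong₂ _+_ eqA eqA) eq) (+-suc _ _)))
      λ s₂ (eqA , eq) → record
        { num≡ = refl ; size≡ = refl ; goal≡ = refl
        ; stretch≤ = subst (λ a → a * q ≤ p) (sym eqA) (≤-trans (m≤n+m _ (vars s₁ VTX)) (≤-reflexive sum≡))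
        ; stretch≥ = subst (λ a → a ≡ π NUM ⊎ p < suc a * q) (sym eqA)
            (Sum.map₂ (λ lt → <-≤-trans (s≤s (≤-reflexive (sym sum≡))) (+-monoˡ-< (vars s₁ STRETCH * q) lt)) ≥n)
        ; choices≡ = subst (λ a → vars s₂ CHOICES ≡ suc (π GOAL * suc (a + a))) (sym eqA) eq
        ; rounds≡ = refl }
    where
    p q : ℕ
    p = cells s 3
    q = cells s 4
    -- Either all `i` subtractions succeeded, or the remainder is below `q` and all further attempts
    -- fail.
    Divided : ℕ → Store → Set
    Divided i s′ = vars s′ VTX + vars s′ STRETCH * q ≡ p ×
      (vars s′ STRETCH ≡ i ⊎ vars s′ VTX < q) × cells s′ ≡ cells s
    divide : ∀ i s′ → i < π NUM → Divided i s′ → _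
    divide i s′ _ (sum≡ , ≥i , same) =
      (λ q≤x → let q≤x = ≤-trans (≤-reflexive (sym q≡)) (≤-pred q≤x) in
        trans (trans (cong (λ z → X ∸ z + (q + vars s′ STRETCH * q)) q≡)
          (trans (sym (+-assoc (X ∸ q) q _)) (cong (_+ vars s′ STRETCH * q) (m∸n+n≡m q≤x)))) sum≡ ,
        inj₁ (cong suc (Sum.[ id , (λ x<q → contradiction x<q (≤⇒≯ q≤x)) ]′ ≥i)) ,
        same) ,
      (λ q≰x → sum≡ ,
        inj₂ (subst (X <_) q≡ (≰⇒> (λ q≤x → q≰x (s≤s q≤x)))) , same)
      where
      X : ℕ
      X = vars s′ VTX
      q≡ : cells s′ 4 ≡ q
      q≡ = cong (λ g → g 4) same

arc-weaken : ∀ {M a} → Arc M a → Arc (suc M) a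
arc-weaken (a≢0 , a≤M) = a≢0 , m≤n⇒m≤1+n a≤M

arc-split : ∀ {M a} → Arc (suc M) a → Arc M a ⊎ a ≡ suc M
arc-split (a≢0 , a≤) with m≤n⇒m<n∨m≡n a≤
... | inj₁ a<  = inj₁ (a≢0 , ≤-pred a<)
... | inj₂ a≡ = inj₂ a≡

old-arc : ∀ {M a} g {v} → Arc M a → (g [ suc M ↦ v ]) a ≡ g a
old-arc g (_ , a≤M) = update-other g _ (<⇒≢ (s≤s a≤M))

-- The new arc has the largest number; as the new head it keeps its chain decreasing.
chains-push : ∀ {M hd nx fr} x → Chains M hd nx fr →
  Chains (suc M) (hd [ x ↦ suc M ]) (nx [ suc M ↦ hd x ]) (fr [ suc M ↦ x ])
chains-push {M} {hd} {nx} {fr} x C = record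
  { head-arc = head-arc′ ; head-max = head-max′ ; next-arc = next-arc′ ; next< = next<′ ; next-max = next-max′ }
  where
  open Chains C
  hd′ nx′ fr′ : ℕ → ℕ
  hd′ = hd [ x ↦ suc M ]
  nx′ = nx [ suc M ↦ hd x ]
  fr′ = fr [ suc M ↦ x ]
  head-arc′ : ∀ y → hd′ y ≢ 0 → Arc (suc M) (hd′ y) × fr′ (hd′ y) ≡ y
  head-arc′ y hd≢0 with y ≟ x
  ... | yes refl rewrite update-same hd x (suc M) = ((λ ()) , ≤-refl) , update-same fr (suc M) x
  ... | no  y≢x rewrite update-other hd (suc M) y≢x =
    arc-weaken (proj₁ (head-arc y hd≢0)) , trans (old-arc fr (proj₁ (head-arc y hd≢0))) (proj₂ (head-arc y hd≢0))
  head-max′ : ∀ {a} → Arc (suc M) a → a ≤ hd′ (fr′ a)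
  head-max′ {a} ar with arc-split ar
  ... | inj₂ refl = ≤-reflexive (sym (trans (cong hd′ (update-same fr (suc M) x)) (update-same hd x (suc M))))
  ... | inj₁ ar′ with fr a ≟ x
  ...   | yes eq = ≤-trans (proj₂ ar) (≤-reflexive (sym (trans (cong hd′ (trans (old-arc fr ar′) eq)) (update-same hd x (suc M)))))
  ...   | no  ne = ≤-trans (head-max ar′) (≤-reflexive (sym (trans (cong hd′ (old-arc fr ar′)) (update-other hd (suc M) ne))))
  next-arc′ : ∀ {a} → Arc (suc M) a → nx′ a ≢ 0 → Arc (suc M) (nx′ a) × fr′ (nx′ a) ≡ fr′ a
  next-arc′ {a} ar nx≢0 with arc-split ar
  ... | inj₂ refl rewrite update-same nx (suc M) (hd x) | update-same fr (suc M) x =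
    arc-weaken (proj₁ (head-arc x nx≢0)) , trans (old-arc fr (proj₁ (head-arc x nx≢0))) (proj₂ (head-arc x nx≢0))
  ... | inj₁ ar′ rewrite old-arc nx {hd x} ar′ | old-arc fr {x} ar′ =
    arc-weaken (proj₁ (next-arc ar′ nx≢0)) , trans (old-arc fr (proj₁ (next-arc ar′ nx≢0))) (proj₂ (next-arc ar′ nx≢0))
  head≤ : ∀ y → hd y ≤ M
  head≤ y with hd y ≟ 0
  ... | yes eq = ≤-trans (≤-reflexive eq) z≤n
  ... | no  ne = proj₂ (proj₁ (head-arc y ne))
  next<′ : ∀ {a} → Arc (suc M) a → nx′ a < a
  next<′ {a} ar with arc-split ar
  ... | inj₂ refl = ≤-trans (s≤s (≤-reflexive (update-same nx (suc M) (hd x)))) (s≤s (head≤ x))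
  ... | inj₁ ar′  = ≤-trans (s≤s (≤-reflexive (old-arc nx ar′))) (next< ar′)
  next-max′ : ∀ {a b} → Arc (suc M) a → Arc (suc M) b → fr′ b ≡ fr′ a → b < a → b ≤ nx′ a
  next-max′ {a} {b} ara arb eq b<a with arc-split ara
  ... | inj₂ refl = ≤-trans (≤-trans (head-max arb′)
      (≤-reflexive (cong hd (trans (sym (old-arc fr arb′)) (trans eq (update-same fr (suc M) x))))))
      (≤-reflexive (sym (update-same nx (suc M) (hd x))))
    where
    arb′ : Arc M b
    arb′ = proj₁ arb , ≤-pred b<a
  ... | inj₁ ara′ = ≤-trans (next-max ara′ arb′ (trans (sym (old-arc fr arb′)) (trans eq (old-arc fr ara′))) b<a)
      (≤-reflexive (sym (old-arc nx ara′)))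
    where
    arb′ : Arc M b
    arb′ = proj₁ arb , <⇒≤ (<-≤-trans b<a (proj₂ ara′))

adjacency-push : ∀ {i s t hd nx to ed fr M} x y → Adjacency i s t hd nx to ed fr M →
  let hd′ = hd [ x ↦ suc M ] in
  Adjacency (suc i) (s [ i ↦ x ]) (t [ i ↦ y ])
    (hd′ [ y ↦ 2 + M ]) ((nx [ suc M ↦ hd x ]) [ 2 + M ↦ hd′ y ])
    ((to [ suc M ↦ y ]) [ 2 + M ↦ x ]) ((ed [ suc M ↦ i ]) [ 2 + M ↦ i ]) ((fr [ suc M ↦ x ]) [ 2 + M ↦ y ]) (2 + M)
adjacency-push {i} {s} {t} {hd} {nx} {to} {ed} {fr} {M} x y adj = record
  { chains = chains-push y (chains-push x chains) ; sound = sound′ ; complete = complete′ }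
  where
  open Adjacency adj
  s′ t′ to′ ed′ fr′ : ℕ → ℕ
  s′ = s [ i ↦ x ]
  t′ = t [ i ↦ y ]
  to′ = (to [ suc M ↦ y ]) [ 2 + M ↦ x ]
  ed′ = (ed [ suc M ↦ i ]) [ 2 + M ↦ i ]
  fr′ = (fr [ suc M ↦ x ]) [ 2 + M ↦ y ]
  module G  = Graphs i s t
  module G′ = Graphs (suc i) s′ t′
  new : ∀ g {v w} → ((g [ suc M ↦ v ]) [ 2 + M ↦ w ]) (2 + M) ≡ w
  new g {v} {w} = update-same (g [ suc M ↦ v ]) (2 + M) w
  middle : ∀ g {v w} → ((g [ suc M ↦ v ]) [ 2 + M ↦ w ]) (suc M) ≡ v
  middle g {v} {w} = trans (update-other (g [ suc M ↦ v ]) w (<⇒≢ ≤-refl)) (update-same g (suc M) v)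
  old : ∀ g {a v w} → Arc M a → ((g [ suc M ↦ v ]) [ 2 + M ↦ w ]) a ≡ g a
  old g {v = v} ar = trans (old-arc (g [ suc M ↦ v ]) (arc-weaken ar)) (old-arc g ar)
  src≡ : s′ i ≡ x
  src≡ = update-same s i x
  tgt≡ : t′ i ≡ y
  tgt≡ = update-same t i y
  ends-old : ∀ {e a b} → e < i → G.Ends e a b → G′.Ends e a b
  ends-old e<i = Sum.map
    (λ (p , q) → trans (update-other s x (<⇒≢ e<i)) p , trans (update-other t y (<⇒≢ e<i)) q)
    (λ (p , q) → trans (update-other s x (<⇒≢ e<i)) p , trans (update-other t y (<⇒≢ e<i)) q)
  ends-old⁻ : ∀ {e a b} → e < i → G′.Ends e a b → G.Ends e a b
  ends-old⁻ e<i = Sum.map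
    (λ (p , q) → trans (sym (update-other s x (<⇒≢ e<i))) p , trans (sym (update-other t y (<⇒≢ e<i))) q)
    (λ (p , q) → trans (sym (update-other s x (<⇒≢ e<i))) p , trans (sym (update-other t y (<⇒≢ e<i))) q)
  sound′ : ∀ {a} → Arc (2 + M) a → ed′ a < suc i × G′.Ends (ed′ a) (fr′ a) (to′ a)
  sound′ {a} ar with arc-split ar
  ... | inj₂ refl rewrite new ed {i} {i} | new fr {x} {y} | new to {y} {x} = ≤-refl , inj₂ (src≡ , tgt≡)
  ... | inj₁ ar₁ with arc-split ar₁
  ...   | inj₂ refl rewrite middle ed {i} {i} | middle fr {x} {y} | middle to {y} {x} = ≤-refl , inj₁ (src≡ , tgt≡)
  ...   | inj₁ ar₀ rewrite old ed {a} {i} {i} ar₀ | old fr {a} {x} {y} ar₀ | old to {a} {y} {x} ar₀ =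
    m≤n⇒m≤1+n (proj₁ (sound ar₀)) , ends-old (proj₁ (sound ar₀)) (proj₂ (sound ar₀))
  complete′ : ∀ {e a b} → e < suc i → G′.Ends e a b → ∃[ c ] (Arc (2 + M) c × ed′ c ≡ e × fr′ c ≡ a × to′ c ≡ b)
  complete′ e< ends with m≤n⇒m<n∨m≡n (≤-pred e<)
  ... | inj₁ e<i with complete e<i (ends-old⁻ e<i ends)
  ...   | c , ar , p , q , r =
    c , arc-weaken (arc-weaken ar) , trans (old ed ar) p , trans (old fr ar) q , trans (old to ar) r
  complete′ e< (inj₁ (p , q)) | inj₂ refl = suc M , ((λ ()) , n≤1+n _) , middle ed ,
    trans (middle fr) (trans (sym src≡) p) , trans (middle to) (trans (sym tgt≡) q)
  complete′ e< (inj₂ (p , q)) | inj₂ refl = 2 + M , ((λ ()) , ≤-refl) , new ed ,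
    trans (new fr) (trans (sym tgt≡) q) , trans (new to) (trans (sym src≡) p)

record Pushed (s s′ : Store) : Set where
  field
    count≡ : vars s′ COUNT ≡ suc (vars s COUNT)
    head≡  : arrs s′ HEAD ≡ arrs s HEAD [ vars s VTX ↦ suc (vars s COUNT) ]
    next≡  : arrs s′ NEXT ≡ arrs s NEXT [ suc (vars s COUNT) ↦ arrs s HEAD (vars s VTX) ]
    to≡    : arrs s′ TO ≡ arrs s TO [ suc (vars s COUNT) ↦ vars s TAIL ]
    edge≡  : arrs s′ EDGE ≡ arrs s EDGE [ suc (vars s COUNT) ↦ vars s IDX ]
    from≡  : arrs s′ FROM ≡ arrs s FROM [ suc (vars s COUNT) ↦ vars s VTX ]

module Tables (π : ℕ → ℕ) (ρ : Array → ℕ → ℕ) where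
  η : Env
  η = env π ρ (5 + π SIZE * 3)
  open Semantics η
  open Frames η

  push-correct : ∀ {Q s} → (∀ s′ → Unchanged pushArc s s′ → Pushed s s′ → Q s′) → wp pushArc Q s
  push-correct {Q} {s} = wp-frame pushArc {s = s}
    (after (record { count≡ = refl ; head≡ = refl ; next≡ = refl ; to≡ = refl ; edge≡ = refl ; from≡ = refl }))

  push-edge-correct : ∀ {Q s i src tgt} → vars s IDX ≡ i →
    Adjacency i src tgt (arrs s HEAD) (arrs s NEXT) (arrs s TO) (arrs s EDGE) (arrs s FROM) (vars s COUNT) →
    (∀ s′ → Unchanged pushEdge s s′ → vars s′ COUNT ≡ 2 + vars s COUNT →
      Adjacency (suc i) (src [ i ↦ vars s VTX ]) (tgt [ i ↦ vars s TAIL ])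
        (arrs s′ HEAD) (arrs s′ NEXT) (arrs s′ TO) (arrs s′ EDGE) (arrs s′ FROM) (vars s′ COUNT) → Q s′) →
    wp pushEdge Q s
  push-edge-correct {Q} {s} {i} {src} {tgt} idx adj q = wp-frame pushEdge {s = s}
    (wp-call (push-correct {s = s} λ s₁ same₁ p₁ → push-correct λ s₂ same₂ p₂ →
      let open Unchanged same₁
          module P₁ = Pushed p₁
          module P₂ = Pushed p₂ in
      trans P₂.count≡ (cong suc P₁.count≡) ,
      twice idx adj P₁.count≡ P₁.head≡ P₁.next≡ P₁.to≡ P₁.edge≡ P₁.from≡
        (trans (var≡ IDX refl) idx) (var≡ VTX refl) (var≡ TAIL refl)
        P₂.count≡ P₂.head≡ P₂.next≡ P₂.to≡ P₂.edge≡ P₂.from≡))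
    (λ s′ same (eq , adj′) → q s′ same eq adj′)
    where
    -- All arrays are generalised to variables, so that each equation can be matched with `refl`.
    twice : ∀ {i i₁ i₂ x y x₁ y₁ c c₁ c₂ hd hd₁ hd₂ nx nx₁ nx₂ to to₁ to₂ ed ed₁ ed₂ fr fr₁ fr₂} →
      i₁ ≡ i → Adjacency i src tgt hd nx to ed fr c →
      c₁ ≡ suc c → hd₁ ≡ hd [ x ↦ suc c ] → nx₁ ≡ nx [ suc c ↦ hd x ] → to₁ ≡ to [ suc c ↦ y ] →
      ed₁ ≡ ed [ suc c ↦ i₁ ] → fr₁ ≡ fr [ suc c ↦ x ] →
      i₂ ≡ i → x₁ ≡ x → y₁ ≡ y →
      c₂ ≡ suc c₁ → hd₂ ≡ hd₁ [ y₁ ↦ suc c₁ ] → nx₂ ≡ nx₁ [ suc c₁ ↦ hd₁ y₁ ] → to₂ ≡ to₁ [ suc c₁ ↦ x₁ ] →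
      ed₂ ≡ ed₁ [ suc c₁ ↦ i₂ ] → fr₂ ≡ fr₁ [ suc c₁ ↦ y₁ ] →
      Adjacency (suc i) (src [ i ↦ x ]) (tgt [ i ↦ y ]) hd₂ nx₂ to₂ ed₂ fr₂ c₂
    twice refl adj refl refl refl refl refl refl refl refl refl refl refl refl refl refl refl =
      adjacency-push _ _ adj

  record Tabulated (input : ℕ → ℕ) (s : Store) : Set where
    field
      num≡      : vars s NUM ≡ π NUM
      size≡     : vars s SIZE ≡ π SIZE
      goal≡     : vars s GOAL ≡ π GOAL
      stretch≡  : vars s STRETCH ≡ π STRETCH
      choices≡  : vars s CHOICES ≡ π CHOICES
      rounds≡   : vars s ROUNDS ≡ π ROUNDS
      trials≡   : vars s TRIALS ≡ π CHOICES ^ π GOAL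
      src≡      : ∀ e → e < π SIZE → arrs s SRC e ≡ input (5 + e * 3)
      tgt≡      : ∀ e → e < π SIZE → arrs s TGT e ≡ input (6 + e * 3)
      weight≡   : ∀ e → e < π SIZE → arrs s WEIGHT e ≡ input (7 + e * 3)
      -- The index SIZE is the dummy edge.
      src-dummy : arrs s SRC (π SIZE) ≡ 0
      tgt-dummy : arrs s TGT (π SIZE) ≡ 0
      adjacency : Adjacency (π SIZE) (arrs s SRC) (arrs s TGT)
        (arrs s HEAD) (arrs s NEXT) (arrs s TO) (arrs s EDGE) (arrs s FROM) (π SIZE * 2)

  tables-correct : ∀ {s} → (∀ k a → arrs s k a ≡ 0) → wp tablesCmd (Tabulated (cells s)) s
  tables-correct {s} zeros =
    wp-for GOAL _ (λ i s′ → vars s′ TRIALS ≡ π CHOICES ^ i × arrs s′ ≡ arrs s × cells s′ ≡ cells s)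
      (refl , refl , refl)
      (λ i s′ _ (eq , same , same′) →
        wp-for CHOICES _ (λ j s″ → vars s″ SUM ≡ j * π CHOICES ^ i × vars s″ TRIALS ≡ π CHOICES ^ i × arrs s″ ≡ arrs s × cells s″ ≡ cells s)
          (refl , eq , same , same′)
          (λ j s″ _ (eq₁ , eq₂ , r) → cong₂ _+_ eq₂ eq₁ , eq₂ , r)
          (λ s″ (eq₁ , _ , r) → eq₁ , r))
      λ s₁ (trials , same , same′) →
    wp-for SIZE _ Inv
      ( refl , refl , refl , trials , (λ _ ()) , (λ _ ()) , (λ _ ())
      , (λ j _ → trans (cong (λ g → g SRC j) same) (zeros SRC j)) , (λ j _ → trans (cong (λ g → g TGT j) same) (zeros TGT j))
      , record { chains = record
          { head-arc = λ x ≢0 → contradiction (trans (cong (λ g → g HEAD x) same) (zeros HEAD x)) ≢0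
          ; head-max = λ (≢0 , ≤0) → contradiction (n≤0⇒n≡0 ≤0) ≢0
          ; next-arc = λ (≢0 , ≤0) → contradiction (n≤0⇒n≡0 ≤0) ≢0
          ; next<    = λ (≢0 , ≤0) → contradiction (n≤0⇒n≡0 ≤0) ≢0
          ; next-max = λ (≢0 , ≤0) → contradiction (n≤0⇒n≡0 ≤0) ≢0 }
        ; sound = λ (≢0 , ≤0) → contradiction (n≤0⇒n≡0 ≤0) ≢0
        ; complete = λ () }
      , same′ )
      iteration
      λ s₂ (_ , count , _ , trials , src , tgt , wgt , src₀ , tgt₀ , adj , _) → record
        { num≡ = refl ; size≡ = refl ; goal≡ = refl ; stretch≡ = refl ; choices≡ = refl ; rounds≡ = refl
        ; trials≡ = trials ; src≡ = src ; tgt≡ = tgt ; weight≡ = wgt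
        ; src-dummy = src₀ _ ≤-refl ; tgt-dummy = tgt₀ _ ≤-refl
        ; adjacency = subst (Adjacency _ _ _ _ _ _ _ _) count adj }
    where
    Inv : ℕ → Store → Set
    Inv i s′ =
      vars s′ IDX ≡ i × vars s′ COUNT ≡ i * 2 × vars s′ CUR ≡ 5 + i * 3 × vars s′ TRIALS ≡ π CHOICES ^ π GOAL ×
      (∀ e → e < i → arrs s′ SRC e ≡ cells s (5 + e * 3)) ×
      (∀ e → e < i → arrs s′ TGT e ≡ cells s (6 + e * 3)) ×
      (∀ e → e < i → arrs s′ WEIGHT e ≡ cells s (7 + e * 3)) ×
      (∀ e → i ≤ e → arrs s′ SRC e ≡ 0) × (∀ e → i ≤ e → arrs s′ TGT e ≡ 0) ×
      Adjacency i (arrs s′ SRC) (arrs s′ TGT)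
        (arrs s′ HEAD) (arrs s′ NEXT) (arrs s′ TO) (arrs s′ EDGE) (arrs s′ FROM) (vars s′ COUNT) ×
      cells s′ ≡ cells s
    iteration : ∀ i s′ → i < π SIZE → Inv i s′ → _
    iteration i s′ i<m (refl , count , cur , trials , src , tgt , wgt , src₀ , tgt₀ , adj , same) =
      push-edge-correct refl adj λ s″ u count″ adj″ →
      let open Unchanged u
          X = ⟦ cell (lit 0 ⊕ var CUR) ⟧ s′
          Y = ⟦ cell (lit 1 ⊕ var CUR) ⟧ s′
          srcs = arr≡ SRC refl
          tgts = arr≡ TGT refl in
      cong suc (var≡ IDX refl) , trans count″ (cong (2 +_) count) , trans (var≡ CUR refl) (cong (3 +_) cur) ,
      trans (var≡ TRIALS refl) trials ,
      subst (λ g → ∀ e → e < suc i → g e ≡ cells s (5 + e * 3)) (sym srcs) (extend (arrs s′ SRC) (λ e → cells s (5 + e * 3)) src (read 0 z≤n)) ,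
      subst (λ g → ∀ e → e < suc i → g e ≡ cells s (6 + e * 3)) (sym tgts) (extend (arrs s′ TGT) (λ e → cells s (6 + e * 3)) tgt (read 1 (s≤s z≤n))) ,
      subst (λ g → ∀ e → e < suc i → g e ≡ cells s (7 + e * 3)) (sym (arr≡ WEIGHT refl)) (extend (arrs s′ WEIGHT) (λ e → cells s (7 + e * 3)) wgt (read 2 ≤-refl)) ,
      subst (λ g → ∀ e → suc i ≤ e → g e ≡ 0) (sym srcs) (λ e i<e → trans (update-other (arrs s′ SRC) X (>⇒≢ i<e)) (src₀ e (<⇒≤ i<e))) ,
      subst (λ g → ∀ e → suc i ≤ e → g e ≡ 0) (sym tgts) (λ e i<e → trans (update-other (arrs s′ TGT) Y (>⇒≢ i<e)) (tgt₀ e (<⇒≤ i<e))) ,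
      subst₂ (λ g h → Adjacency (suc i) g h (arrs s″ HEAD) (arrs s″ NEXT) (arrs s″ TO) (arrs s″ EDGE) (arrs s″ FROM) (vars s″ COUNT))
        (sym srcs) (sym tgts) adj″ ,
      trans (cells≡ refl) same
      where
      extend : ∀ (g h : ℕ → ℕ) {v} → (∀ e → e < i → g e ≡ h e) → v ≡ h i → ∀ e → e < suc i → (g [ i ↦ v ]) e ≡ h e
      extend g h {v} old eq e e< with m≤n⇒m<n∨m≡n (≤-pred e<)
      ... | inj₁ e<i  = trans (update-other g v (<⇒≢ e<i)) (old e e<i)
      ... | inj₂ refl = trans (update-same g i v) eq
      inside-bound : ∀ j → j ≤ 2 → j + (5 + i * 3) < 5 + π SIZE * 3
      inside-bound j j≤2 = begin
        suc (j + (5 + i * 3)) ≤⟨ +-monoˡ-≤ (5 + i * 3) (s≤s j≤2) ⟩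
        5 + suc i * 3         ≤⟨ +-monoʳ-≤ 5 (*-monoˡ-≤ 3 i<m) ⟩
        5 + π SIZE * 3        ∎
        where open ≤-Reasoning
      read : ∀ j → j ≤ 2 → ⟦ cell (lit j ⊕ var CUR) ⟧ s′ ≡ cells s (j + (5 + i * 3))
      read j j≤2 rewrite cur | same | dec-true (j + (5 + i * 3) <? 5 + π SIZE * 3) (inside-bound j j≤2) = refl

-- The search stage: candidates

-- A crossing edge closes a cycle through the root and two of its children; it provides a detour for
-- the edges from the root to both of them, hence two marks.
markCrossing : Cmd
markCrossing = call
  ( IDX ≔ lit 0 ﹔
    for SIZE
      ( VTX ≔ fix SRC (var IDX) ﹔
        TAIL ≔ fix TGT (var IDX) ﹔
        (when (lit 1 ≺ get DIST (var VTX)) ∧ (lit 1 ≺ get DIST (var TAIL)) ∧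
              ∼ (get BRANCH (var VTX) ≃ get BRANCH (var TAIL)) ∧
              (get DIST (var VTX) ⊕ get DIST (var TAIL) ≺ lit 1 ⊕ (par STRETCH ⊕ lit 2))
         then ( put MARK (get BRANCH (var VTX)) (lit 1) ﹔
                put MARK (get BRANCH (var TAIL)) (lit 1) )
         else pass) ﹔
        incr IDX ) )

-- An edge is tested only in the search from its source. Collecting ceases when all `CHOICES` places
-- are taken.
collect : Cmd
collect = call
  ( IDX ≔ lit 0 ﹔
    for SIZE
      ( (when (fix SRC (var IDX) ≃ var ROOT) ∧ (lit 0 ≺ get MARK (fix TGT (var IDX))) ∧
              (lit 0 ≺ fix WEIGHT (var IDX)) ∧ (var COUNT ≺ par CHOICES)
         then ( put CAND (var COUNT) (var IDX) ﹔ incr COUNT )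
         else pass) ﹔
        incr IDX ) )

-- `CAND` is filled with the dummy edge beforehand, and place 0 is reserved for it; therefore
-- `COUNT` starts at 1.
candidatesCmd : Cmd
candidatesCmd = call
  ( fill REMOVED SIZE (lit 0) ﹔
    fill CAND CHOICES (par SIZE) ﹔
    COUNT ≔ lit 1 ﹔
    ROOT ≔ lit 0 ﹔
    for NUM
      ( bfs ﹔
        fill MARK NUM (lit 0) ﹔
        markCrossing ﹔
        collect ﹔
        incr ROOT ) )

-- All that the search stage assumes about the tables and loop counts. `0 ≡ 0` is the predicate that
-- holds of every edge.
record Setup (η : Env) : Set where
  open Env η renaming (params to π; tables to ρ) using ()
  open Graphs (π SIZE) (ρ SRC) (ρ TGT)
  field
    src<n     : ∀ e → e < π SIZE → ρ SRC e < π NUM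
    tgt<n     : ∀ e → e < π SIZE → ρ TGT e < π NUM
    loopless  : ∀ e → e < π SIZE → ρ SRC e ≢ ρ TGT e
    parallel  : ∀ {e f x y} → e < π SIZE → f < π SIZE → Ends e x y → Ends f x y → e ≡ f
    connected : ∀ x y → x < π NUM → y < π NUM → ∃[ k ] Trail (λ _ → 0 ≡ 0) k x y
    adjacency : Adjacency (π SIZE) (ρ SRC) (ρ TGT) (ρ HEAD) (ρ NEXT) (ρ TO) (ρ EDGE) (ρ FROM) (π SIZE * 2)
    rounds    : suc (π SIZE * 2) + π NUM < π ROUNDS
    src-dummy : ρ SRC (π SIZE) ≡ 0
    tgt-dummy : ρ TGT (π SIZE) ≡ 0
    nonempty  : 0 < π NUM
    choices   : π CHOICES ≡ suc (π GOAL * suc (π STRETCH + π STRETCH))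
    trials    : π TRIALS ≡ π CHOICES ^ π GOAL

module CandidateSearch (η : Env) (setup : Setup η) where
  open Env η renaming (params to π; tables to ρ) using ()
  open Semantics η
  open Frames η
  open Fill η
  open Setup setup
  open BFSCorrect η (π SIZE * 2) src<n tgt<n adjacency rounds
  open Graphs (π SIZE) (ρ SRC) (ρ TGT)

  -- The two cases of `complete` are those of the completeness proof: a full list contains W
  -- independent candidates, and a list with free places is exhaustive.
  record Candidates (Seen : ℕ → Set) (c : ℕ → ℕ) (k : ℕ) : Set where
    field
      positive : 0 < k
      bounded  : k ≤ π CHOICES
      dummy    : ∀ j → j < π CHOICES → j ≡ 0 ⊎ k ≤ j → c j ≡ π SIZE
      valid    : ∀ j → 0 < j → j < k → c j < π SIZE × 0 < ρ WEIGHT (c j) × Detour (π STRETCH) (c j) × Seen (c j)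
      distinct : ∀ {i j} → 0 < i → i < j → j < k → c i ≢ c j
      complete : k ≡ π CHOICES ⊎ (∀ e → e < π SIZE → Seen e → 0 < ρ WEIGHT e → Detour (π STRETCH) e →
        ∃[ j ] (0 < j × j < k × c j ≡ e))

  Seen : ℕ → ℕ → ℕ → Set
  Seen u i e = ρ SRC e < u ⊎ (ρ SRC e ≡ u × e < i)

  seen-suc : ∀ {u i e} → Seen u i e → Seen u (suc i) e
  seen-suc = Sum.map₂ (λ (eq , e<i) → eq , m≤n⇒m≤1+n e<i)

  seen-split : ∀ {u i e} → Seen u (suc i) e → Seen u i e ⊎ (ρ SRC e ≡ u × e ≡ i)
  seen-split (inj₁ lt) = inj₁ (inj₁ lt)
  seen-split (inj₂ (eq , e<)) with m≤n⇒m<n∨m≡n (≤-pred e<)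
  ... | inj₁ e<i = inj₁ (inj₂ (eq , e<i))
  ... | inj₂ e≡i = inj₂ (eq , e≡i)

  candidates-map : ∀ {S S′ c k} → (∀ e → e < π SIZE → S e → S′ e) → (∀ e → e < π SIZE → S′ e → S e) →
    Candidates S c k → Candidates S′ c k
  candidates-map f g C = record
    { positive = positive ; bounded = bounded ; dummy = dummy ; distinct = distinct
    ; valid = λ j 0<j j<k → let (c< , w , d , sn) = valid j 0<j j<k in c< , w , d , f _ c< sn
    ; complete = Sum.map₂ (λ h e e< sn → h e e< (g e e< sn)) complete }
    where open Candidates C

  candidates-add : ∀ {u i c k} → Candidates (Seen u i) c k → i < π SIZE →
    ρ SRC i ≡ u → 0 < ρ WEIGHT i → Detour (π STRETCH) i → k < π CHOICES →
    Candidates (Seen u (suc i)) (c [ k ↦ i ]) (suc k)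
  candidates-add {u} {i} {c} {k} C i<m src≡ w>0 det k<K = record
    { positive = z<s
    ; bounded  = k<K
    ; dummy    = λ { j j< (inj₁ refl) → trans (update-other c i (<⇒≢ positive)) (dummy 0 j< (inj₁ refl))
                   ; j j< (inj₂ k<j) → trans (update-other c i (>⇒≢ k<j)) (dummy j j< (inj₂ (<⇒≤ k<j))) }
    ; valid    = valid′
    ; distinct = distinct′
    ; complete = inj₂-complete complete
    }
    where
    open Candidates C
    old : ∀ {j} → j < k → (c [ k ↦ i ]) j ≡ c j
    old j<k = update-other c i (<⇒≢ j<k)
    new : (c [ k ↦ i ]) k ≡ i
    new = update-same c k i
    valid′ : ∀ j → 0 < j → j < suc k → (c [ k ↦ i ]) j < π SIZE × 0 < ρ WEIGHT ((c [ k ↦ i ]) j) ×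
      Detour (π STRETCH) ((c [ k ↦ i ]) j) × Seen u (suc i) ((c [ k ↦ i ]) j)
    valid′ j 0<j j< with m≤n⇒m<n∨m≡n (≤-pred j<)
    ... | inj₁ j<k rewrite old j<k = let (c< , w , d , sn) = valid j 0<j j<k in c< , w , d , seen-suc sn
    ... | inj₂ refl rewrite new = i<m , w>0 , det , inj₂ (src≡ , ≤-refl)
    distinct′ : ∀ {a b} → 0 < a → a < b → b < suc k → (c [ k ↦ i ]) a ≢ (c [ k ↦ i ]) b
    distinct′ {a} {b} 0<a a<b b< eq with m≤n⇒m<n∨m≡n (≤-pred b<)
    ... | inj₁ b<k  = distinct 0<a a<b b<k (trans (sym (old (<-trans a<b b<k))) (trans eq (old b<k)))
    ... | inj₂ refl = not-seen (proj₂ (proj₂ (proj₂ (valid a 0<a a<b)))) (trans (sym (old a<b)) (trans eq new))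
      where
      not-seen : ∀ {e} → Seen u i e → e ≢ i
      not-seen (inj₁ lt)        refl = <⇒≢ lt src≡
      not-seen (inj₂ (_ , e<i)) refl = <-irrefl refl e<i
    inj₂-complete : k ≡ π CHOICES ⊎ (∀ e → e < π SIZE → Seen u i e → 0 < ρ WEIGHT e → Detour (π STRETCH) e → ∃[ j ] (0 < j × j < k × c j ≡ e)) → _
    inj₂-complete (inj₁ k≡K) = contradiction k≡K (<⇒≢ k<K)
    inj₂-complete (inj₂ h) = inj₂ λ e e< sn w d → case seen-split sn of λ where
      (inj₁ sn′) → let (j , 0<j , j<k , eq) = h e e< sn′ w d in j , 0<j , m≤n⇒m≤1+n j<k , trans (old j<k) eq
      (inj₂ (_ , refl)) → k , positive , ≤-refl , new

  candidates-skip : ∀ {u i c k} → Candidates (Seen u i) c k →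
    ¬ (ρ SRC i ≡ u × Detour (π STRETCH) i × 0 < ρ WEIGHT i × k < π CHOICES) → Candidates (Seen u (suc i)) c k
  candidates-skip {u} {i} {c} {k} C no-add = record
    { positive = positive ; bounded = bounded ; dummy = dummy ; distinct = distinct
    ; valid = λ j 0<j j<k → let (c< , w , d , sn) = valid j 0<j j<k in c< , w , d , seen-suc sn
    ; complete = complete′ complete (k ≟ π CHOICES) }
    where
    open Candidates C
    complete′ : k ≡ π CHOICES ⊎ _ → Dec (k ≡ π CHOICES) → _
    complete′ _ (yes k≡K) = inj₁ k≡K
    complete′ (inj₁ k≡K) _ = inj₁ k≡K
    complete′ (inj₂ h) (no k≢K) = inj₂ λ e e< sn w d → case seen-split sn of λ where
      (inj₁ sn′) → h e e< sn′ w d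
      (inj₂ (src≡ , refl)) → contradiction (src≡ , d , w , ≤∧≢⇒< bounded k≢K) no-add

  module _ {P : ℕ → Set} (full : ∀ e → e < π SIZE → P e) {u D B} (u<n : u < π NUM) (L : Layered (π NUM) P u D B) where

    all-reached : ∀ x → x < π NUM → D x ≢ 0
    all-reached x x<n with connected u x u<n x<n
    ... | _ , p = proj₁ (Layered.reached L (trail-map (λ e< _ → full _ e<) p)
      (λ eq → 1+n≢0 (trans (sym (Layered.root L)) eq)))

    open Branches src<n tgt<n parallel full L all-reached public

    Marked : ℕ → Set
    Marked v = ∃[ e ] ∃[ x ] ∃[ y ] (e < π SIZE × Ends e x y × Crosses (π STRETCH) x y × B x ≡ v)

    marked⇒detour : ∀ {e} → e < π SIZE → ρ SRC e ≡ u → Marked (ρ TGT e) → Detour (π STRETCH) e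
    marked⇒detour e< refl (f , x , y , f< , ends , cr , Bx≡) =
      crossing-detour e< (inj₁ (refl , refl)) (loopless _ e<) f< ends cr Bx≡

    detour⇒marked : ∀ {e} → e < π SIZE → ρ SRC e ≡ u → Detour (π STRETCH) e → Marked (ρ TGT e)
    detour⇒marked e< refl det = detour-marked e< (inj₁ (refl , refl)) (loopless _ e<) det

    -- Marks are sound for `v` below n, where `MARK` was cleared before; this range contains the
    -- targets of all edges.
    mark-correct : ∀ {Q s} → arrs s DIST ≡ D → arrs s BRANCH ≡ B → (∀ v → v < π NUM → arrs s MARK v ≡ 0) →
      (∀ s′ → Unchanged markCrossing s s′ → (∀ v → v < π NUM → arrs s′ MARK v ≢ 0 → Marked v) →
        (∀ v → Marked v → arrs s′ MARK v ≢ 0) → Q s′) →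
      wp markCrossing Q s
    mark-correct {Q} {s} refl refl zeros q = wp-frame markCrossing {s = s}
      (wp-call (wp-for SIZE _ Inv
        (refl , refl , refl , (λ v v<n ≢0 → contradiction (zeros v v<n) ≢0) , λ _ _ _ ())
        iteration
        λ s′ (_ , _ , _ , sound , comp) →
          sound , (λ v (e , x , y , e< , ends , cr , eq) → subst (λ z → arrs s′ MARK z ≢ 0) eq (comp e x y e< ends cr))))
      (λ s′ same (sound , comp) → q s′ same sound comp)
      where
      Inv : ℕ → Store → Set
      Inv i s′ = vars s′ IDX ≡ i × arrs s′ DIST ≡ D × arrs s′ BRANCH ≡ B ×
        (∀ v → v < π NUM → arrs s′ MARK v ≢ 0 → Marked v) ×
        (∀ e x y → e < i → Ends e x y → Crosses (π STRETCH) x y → arrs s′ MARK (B x) ≢ 0)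
      iteration : ∀ i s′ → i < π SIZE → Inv i s′ → _
      iteration i s′ i<m (refl , dist , branch , sound , comp) = marking , passing
        where
        X Y : ℕ
        X = ρ SRC i
        Y = ρ TGT i
        bx by : ℕ
        bx = arrs s′ BRANCH X
        by = arrs s′ BRANCH Y
        Hit : Set
        Hit = 1 < arrs s′ DIST X × 1 < arrs s′ DIST Y × bx ≢ by × arrs s′ DIST X + arrs s′ DIST Y < suc (π STRETCH + 2)
        crosses : Hit → Crosses (π STRETCH) X Y
        crosses (h₁ , h₂ , h₃ , h₄) =
          subst (λ g → 1 < g X) dist h₁ , subst (λ g → 1 < g Y) dist h₂ , subst (λ g → g X ≢ g Y) branch h₃ ,
          subst (λ g → g X + g Y ≤ π STRETCH + 2) dist (≤-pred h₄)
        holds : Crosses (π STRETCH) X Y → Hit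
        holds (h₁ , h₂ , h₃ , h₄) =
          subst (λ g → 1 < g X) (sym dist) h₁ , subst (λ g → 1 < g Y) (sym dist) h₂ , subst (λ g → g X ≢ g Y) (sym branch) h₃ ,
          s≤s (subst (λ g → g X + g Y ≤ π STRETCH + 2) (sym dist) h₄)
        crosses-sym : ∀ {x y} → Crosses (π STRETCH) x y → Crosses (π STRETCH) y x
        crosses-sym {x} {y} (h₁ , h₂ , h₃ , h₄) = h₂ , h₁ , h₃ ∘ sym , ≤-trans (≤-reflexive (+-comm (D y) (D x))) h₄
        marking : Hit → _
        marking h = refl , dist , branch , sound′ , comp′
          where
          mark′ : ℕ → ℕ
          mark′ = (arrs s′ MARK [ bx ↦ 1 ]) [ by ↦ 1 ]
          kept : ∀ v → v ≢ bx → v ≢ by → mark′ v ≡ arrs s′ MARK v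
          kept v v≢x v≢y = trans (update-other (arrs s′ MARK [ bx ↦ 1 ]) 1 v≢y) (update-other (arrs s′ MARK) 1 v≢x)
          set : ∀ v → v ≡ bx ⊎ v ≡ by → mark′ v ≢ 0
          set v v≡ eq with v ≟ by
          ... | yes refl = 1+n≢0 (trans (sym (update-same (arrs s′ MARK [ bx ↦ 1 ]) by 1)) eq)
          ... | no v≢y with v≡
          ...   | inj₂ v≡y = v≢y v≡y
          ...   | inj₁ refl = 1+n≢0 (trans (sym (trans (update-other (arrs s′ MARK [ bx ↦ 1 ]) 1 v≢y) (update-same (arrs s′ MARK) bx 1))) eq)
          b≡ : ∀ z → arrs s′ BRANCH z ≡ B z
          b≡ z = cong (λ g → g z) branch
          sound′ : ∀ v → v < π NUM → mark′ v ≢ 0 → Marked v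
          sound′ v v<n ≢0 with v ≟ bx | v ≟ by
          ... | yes v≡x | _ = i , X , Y , i<m , inj₁ (refl , refl) , crosses h , trans (sym (b≡ X)) (sym v≡x)
          ... | no _ | yes v≡y = i , Y , X , i<m , inj₂ (refl , refl) , crosses-sym (crosses h) , trans (sym (b≡ Y)) (sym v≡y)
          ... | no v≢x | no v≢y = sound v v<n (λ eq → ≢0 (trans (kept v v≢x v≢y) eq))
          comp′ : ∀ e x y → e < suc i → Ends e x y → Crosses (π STRETCH) x y → mark′ (B x) ≢ 0
          comp′ e x y e< ends cr with m≤n⇒m<n∨m≡n (≤-pred e<)
          comp′ e x y e< (inj₁ (refl , _)) cr | inj₂ refl = set _ (inj₁ (sym (b≡ X)))
          comp′ e x y e< (inj₂ (_ , refl)) cr | inj₂ refl = set _ (inj₂ (sym (b≡ Y)))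
          comp′ e x y e< ends cr | inj₁ e<i with B x ≟ bx | B x ≟ by
          ... | yes eq | _      = set _ (inj₁ eq)
          ... | no _   | yes eq = set _ (inj₂ eq)
          ... | no v≢x | no v≢y = λ eq → comp e x y e<i ends cr (trans (sym (kept _ v≢x v≢y)) eq)
        passing : ¬ Hit → _
        passing ¬h = refl , dist , branch , sound , comp′
          where
          comp′ : ∀ e x y → e < suc i → Ends e x y → Crosses (π STRETCH) x y → arrs s′ MARK (B x) ≢ 0
          comp′ e x y e< ends cr with m≤n⇒m<n∨m≡n (≤-pred e<)
          ... | inj₁ e<i = comp e x y e<i ends cr
          comp′ e x y e< (inj₁ (refl , refl)) cr | inj₂ refl = contradiction (holds cr) ¬h
          comp′ e x y e< (inj₂ (refl , refl)) cr | inj₂ refl = contradiction (holds (crosses-sym cr)) ¬h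

    collect-correct : ∀ {Q s} → vars s ROOT ≡ u → (∀ v → v < π NUM → arrs s MARK v ≢ 0 → Marked v) →
      (∀ v → Marked v → arrs s MARK v ≢ 0) → Candidates (Seen u 0) (arrs s CAND) (vars s COUNT) →
      (∀ s′ → Unchanged collect s s′ → Candidates (Seen u (π SIZE)) (arrs s′ CAND) (vars s′ COUNT) → Q s′) →
      wp collect Q s
    collect-correct {Q} {s} root sound comp C₀ q = wp-frame collect {s = s}
      (wp-call (wp-for SIZE _
        (λ i s′ → vars s′ IDX ≡ i × vars s′ ROOT ≡ u × arrs s′ MARK ≡ arrs s MARK × Candidates (Seen u i) (arrs s′ CAND) (vars s′ COUNT))
        (refl , root , refl , C₀)
        (λ { i s′ i<m (refl , root , mark , C) →
          (λ (src , marked , w , k<K) → refl , root , mark ,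
            candidates-add C i<m (trans src root) w
              (marked⇒detour i<m (trans src root) (sound _ (tgt<n i i<m) (λ eq → <⇒≢ marked (sym (trans (cong (λ g → g (ρ TGT i)) mark) eq))))) k<K) ,
          (λ ¬h → refl , root , mark , candidates-skip C (λ (src , det , w , k<K) → ¬h
            (trans src (sym root) , n≢0⇒n>0 (λ eq → comp _ (detour⇒marked i<m src det) (trans (sym (cong (λ g → g (ρ TGT i)) mark)) eq)) , w , k<K))) })
        λ s′ (_ , _ , _ , C) → C))
      q

  candidates-correct : ∀ {Q s} →
    (∀ s′ → Candidates (λ _ → 0 ≡ 0) (arrs s′ CAND) (vars s′ COUNT) → Q s′) → wp candidatesCmd Q s
  candidates-correct {Q} {s} q = wp-mono candidatesCmd
    (wp-call (fill-correct REMOVED SIZE (lit 0) 0 {s = s} (λ _ → refl) λ s₁ same₁ zeros₁ →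
      fill-correct CAND CHOICES (par SIZE) (π SIZE) (λ _ → refl) λ s₂ same₂ dummies →
      wp-for NUM _ Inv
        ( refl
        , (λ e e< → trans (cong (λ g → g e) (Unchanged.arr≡ same₂ REMOVED refl)) (zeros₁ e e<))
        , record { positive = z<s ; bounded = ≤-trans (s≤s z≤n) (≤-reflexive (sym choices)) ; dummy = λ j j< _ → dummies j j<
                 ; valid = λ { j 0<j (s≤s j≤0) → contradiction j≤0 (<⇒≱ 0<j) }
                 ; distinct = λ { 0<i i<j (s≤s z≤n) → contradiction i<j (λ ()) }
                 ; complete = inj₂ (λ e e< → λ { (inj₁ ()) ; (inj₂ (_ , ())) }) } )
        iteration
        (λ s′ (_ , _ , C) → C)))
    (λ s′ C → q s′ (candidates-map (λ _ _ _ → refl) (λ e e< _ → inj₁ (src<n e e<)) C))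
    where
    Inv : ℕ → Store → Set
    Inv u s′ = vars s′ ROOT ≡ u × (∀ e → e < π SIZE → arrs s′ REMOVED e ≡ 0) ×
      Candidates (Seen u 0) (arrs s′ CAND) (vars s′ COUNT)
    iteration : ∀ u s′ → u < π NUM → Inv u s′ → _
    iteration u s′ u<n (refl , full , C) =
      bfs-correct u<n λ s₁ same₁ L →
      fill-correct MARK NUM (lit 0) 0 (λ _ → refl) λ s₂ same₂ zeros →
      mark-correct full u<n L (Unchanged.arr≡ same₂ DIST refl) (Unchanged.arr≡ same₂ BRANCH refl) zeros λ s₃ same₃ sound comp →
      let root≡ : vars s₃ ROOT ≡ u
          root≡ = trans (Unchanged.var≡ same₃ ROOT refl) (trans (Unchanged.var≡ same₂ ROOT refl) (Unchanged.var≡ same₁ ROOT refl))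
          cand≡ = trans (Unchanged.arr≡ same₃ CAND refl) (trans (Unchanged.arr≡ same₂ CAND refl) (Unchanged.arr≡ same₁ CAND refl))
          count≡ = trans (Unchanged.var≡ same₃ COUNT refl) (trans (Unchanged.var≡ same₂ COUNT refl) (Unchanged.var≡ same₁ COUNT refl))
      in
      collect-correct full u<n L root≡ sound comp
        (subst₂ (Candidates (Seen u 0)) (sym cand≡) (sym count≡) C) λ s₄ same₄ C′ →
      let removed≡ = trans (Unchanged.arr≡ same₄ REMOVED refl) (trans (Unchanged.arr≡ same₃ REMOVED refl)
                       (trans (Unchanged.arr≡ same₂ REMOVED refl) (Unchanged.arr≡ same₁ REMOVED refl))) in
      cong suc (trans (Unchanged.var≡ same₄ ROOT refl) root≡) ,
      (λ e e< → trans (cong (λ g → g e) removed≡) (full e e<)) ,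
      candidates-map
        (λ { e e< (inj₁ lt) → inj₁ (m≤n⇒m≤1+n lt) ; e e< (inj₂ (eq , _)) → inj₁ (s≤s (≤-reflexive eq)) })
        (λ { e e< (inj₁ lt) → Sum.map₂ (λ eq → eq , e<) (m≤n⇒m<n∨m≡n (≤-pred lt)) ; e e< (inj₂ (_ , ())) })
        C′

-- The search stage: trials and output

-- The dummy edge sets a flag at index `SIZE`, beyond the entries that are read later.
loadTrial : Cmd
loadTrial = call
  ( fill REMOVED SIZE (lit 0) ﹔
    STEP ≔ lit 0 ﹔
    for GOAL ( put REMOVED (get CAND (get DIGIT (var STEP))) (lit 1) ﹔ incr STEP ) )

weigh : Cmd
weigh = call
  ( SUM ≔ lit 0 ﹔
    IDX ≔ lit 0 ﹔
    for SIZE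
      ( (when lit 0 ≺ get REMOVED (var IDX)
         then SUM ≔ fix WEIGHT (var IDX) ⊕ var SUM
         else pass) ﹔
        incr IDX ) )

verify : Cmd
verify = call
  ( VALID ≔ lit 1 ﹔
    STEP ≔ lit 0 ﹔
    for GOAL
      ( CHOSEN ≔ get CAND (get DIGIT (var STEP)) ﹔
        ROOT ≔ fix SRC (var CHOSEN) ﹔
        bfs ﹔
        -- Labels are distances plus one, so this compares the distance with the stretch.
        (when (lit 0 ≺ get DIST (fix TGT (var CHOSEN))) ∧ (get DIST (fix TGT (var CHOSEN)) ≺ lit 2 ⊕ par STRETCH)
         then pass
         else (VALID ≔ lit 0)) ﹔
        incr STEP ) )

keep : Cmd
keep = call
  ( IDX ≔ lit 0 ﹔
    for SIZE ( put WITNESS (var IDX) (lit 1 ⊖ get REMOVED (var IDX)) ﹔ incr IDX ) )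

-- `DIGIT` is a counter in base `CHOICES` whose value is the number of the trial.
advance : Cmd
advance = call
  ( CARRY ≔ lit 1 ﹔
    STEP ≔ lit 0 ﹔
    for GOAL
      ( (when var CARRY ≃ lit 1
         then (when lit 1 ⊕ get DIGIT (var STEP) ≃ par CHOICES
               then put DIGIT (var STEP) (lit 0)
               else ( put DIGIT (var STEP) (lit 1 ⊕ get DIGIT (var STEP)) ﹔ CARRY ≔ lit 0 ))
         else pass) ﹔
        incr STEP ) )

trial : Cmd
trial = call
  ( loadTrial ﹔
    weigh ﹔
    verify ﹔
    (when (var VALID ≃ lit 1) ∧ (par GOAL ≺ lit 1 ⊕ var SUM)
     then ( FOUND ≔ lit 1 ﹔ keep )
     else pass) ﹔
    advance )

enumerateCmd : Cmd
enumerateCmd = call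
  ( FOUND ≔ lit 0 ﹔
    fill DIGIT GOAL (lit 0) ﹔
    for TRIALS trial )

outputCmd : Cmd
outputCmd =
  when var FOUND ≃ lit 1
  then ( out (lit 0) (lit 1) ﹔
         IDX ≔ lit 0 ﹔
         for SIZE ( out (lit 1 ⊕ var IDX) (get WITNESS (var IDX)) ﹔ incr IDX ) )
  else out (lit 0) (lit 0)

searchCmd : Cmd
searchCmd =
  candidatesCmd ﹔
  enumerateCmd ﹔
  outputCmd

-- Numerals in base b, least significant digit first.

value : ℕ → (ℕ → ℕ) → ℕ → ℕ
value b d zero    = 0
value b d (suc i) = value b d i + d i * b ^ i

value-cong : ∀ b {d d′} i → (∀ j → j < i → d j ≡ d′ j) → value b d i ≡ value b d′ i
value-cong b zero    eq = refl
value-cong b (suc i) eq = cong₂ (λ x y → x + y * b ^ i)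
  (value-cong b i (λ j j<i → eq j (m≤n⇒m≤1+n j<i))) (eq i ≤-refl)

value< : ∀ b {d} i → (∀ j → j < i → d j < b) → value b d i < b ^ i
value< b         zero    d< = z<s
value< b {d} (suc i) d< = begin-strict
  value b d i + d i * b ^ i <⟨ +-monoˡ-< (d i * b ^ i) (value< b i (λ j j<i → d< j (m≤n⇒m≤1+n j<i))) ⟩
  suc (d i) * b ^ i         ≤⟨ *-monoˡ-≤ (b ^ i) (d< i ≤-refl) ⟩
  b * b ^ i                 ∎
  where open ≤-Reasoning

value-inj : ∀ b {d d′} i → (∀ j → j < i → d j < b) → (∀ j → j < i → d′ j < b) →
  value b d i ≡ value b d′ i → ∀ j → j < i → d j ≡ d′ j
value-inj b {d} {d′} (suc i) d< d′< eq j j< with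
  *-inj-remainder (b ^ i) {{m^n≢0 b i {{>-nonZero (≤-<-trans z≤n (d< 0 z<s))}}}} {i = d i} {d′ i}
    (value< b i (λ k k<i → d< k (m≤n⇒m≤1+n k<i))) (value< b i (λ k k<i → d′< k (m≤n⇒m≤1+n k<i))) eq
... | low , high with m≤n⇒m<n∨m≡n (≤-pred j<)
...   | inj₁ j<i  = value-inj b i (λ k k<i → d< k (m≤n⇒m≤1+n k<i)) (λ k k<i → d′< k (m≤n⇒m≤1+n k<i)) low j j<i
...   | inj₂ refl = high

value-zero : ∀ b {d} i → (∀ j → j < i → d j ≡ 0) → value b d i ≡ 0
value-zero b zero    eq = refl
value-zero b (suc i) eq rewrite eq i ≤-refl =
  trans (+-identityʳ _) (value-zero b i (λ j j<i → eq j (m≤n⇒m≤1+n j<i)))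

-- Correctness of the trials

module WeightedSums (m : ℕ) (w : ℕ → ℕ) where

  -- With `downFrom` the list grows at its head, in step with the loop of `weigh`.
  flagged : (ℕ → ℕ) → List ℕ
  flagged r = filter (λ e → 0 <? r e) (downFrom m)

  flaggedWeight : (ℕ → ℕ) → ℕ
  flaggedWeight r = sum (map w (flagged r))

  ∈-flagged⁺ : ∀ {r e} → e < m → 0 < r e → e ∈ flagged r
  ∈-flagged⁺ {r} e< r>0 = ∈ₚ.∈-filter⁺ (λ e → 0 <? r e) (∈ₚ.∈-downFrom⁺ e<) r>0

  ∈-flagged⁻ : ∀ {r e} → e ∈ flagged r → e < m × 0 < r e
  ∈-flagged⁻ {r} e∈ with ∈ₚ.∈-filter⁻ (λ e → 0 <? r e) e∈
  ... | e∈′ , r>0 = ∈ₚ.∈-downFrom⁻ e∈′ , r>0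

  flagged-unique : ∀ r → Unique (flagged r)
  flagged-unique r = Uniqueₚ.filter⁺ (λ e → 0 <? r e) (Uniqueₚ.downFrom⁺ m)

  flaggedWeight-mono : ∀ {r r′} → (∀ e → e < m → 0 < r e → 0 < r′ e) → flaggedWeight r ≤ flaggedWeight r′
  flaggedWeight-mono {r} f = sum-⊆ w (flagged-unique r) λ e∈ →
    let (e< , r>0) = ∈-flagged⁻ {r} e∈ in ∈-flagged⁺ e< (f _ e< r>0)

module Enumeration (η : Env) (setup : Setup η) (c : ℕ → ℕ)
  (c≤m : ∀ j → j < Env.params η CHOICES → c j ≤ Env.params η SIZE) where
  open Env η renaming (params to π; tables to ρ) using ()
  open Semantics η
  open Frames η
  open Fill η
  open Setup setup
  open BFSCorrect η (π SIZE * 2) src<n tgt<n adjacency rounds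
  open Graphs (π SIZE) (ρ SRC) (ρ TGT)
  open WeightedSums (π SIZE) (ρ WEIGHT)

  m W A K : ℕ
  m = π SIZE
  W = π GOAL
  A = π STRETCH
  K = π CHOICES

  Kept : (ℕ → ℕ) → ℕ → Set
  Kept r e = r e ≡ 0

  Good : (ℕ → ℕ) → Set
  Good r = W ≤ flaggedWeight r × (∀ e → e < m → 0 < r e → Bridged (Kept r) A e)

  Chosen : (ℕ → ℕ) → ℕ → Set
  Chosen d e = ∃[ j ] (j < W × c (d j) ≡ e)

  record Flags (r d : ℕ → ℕ) : Set where
    field
      sound    : ∀ e → e < m → 0 < r e → Chosen d e
      complete : ∀ e → e < m → Chosen d e → 0 < r e

  Bridges : (ℕ → ℕ) → (ℕ → ℕ) → Set
  Bridges r d = ∀ j → j < W → Bridged (Kept r) A (c (d j))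

  Accepted : (ℕ → ℕ) → Set
  Accepted d = ∃[ r ] (Flags r d × W ≤ flaggedWeight r × Bridges r d)

  Digits : (ℕ → ℕ) → Set
  Digits d = ∀ j → j < W → d j < K

  -- Acceptance depends on the digits alone: `r₀` and `r` are positive at the same edges, although
  -- they may differ as functions.
  accepted-cong : ∀ {d d′ r} → (∀ j → j < W → d j ≡ d′ j) → Accepted d → Flags r d′ →
    W ≤ flaggedWeight r × Bridges r d′
  accepted-cong {d} {d′} {r} d≡ (r₀ , F₀ , weight≥ , bridges) F =
    ≤-trans weight≥ (flaggedWeight-mono {r₀} {r} r₀⇒r) ,
    λ j j<W → let (k , k≤ , p) = bridges j j<W in
      k , k≤ , subst (λ e → Trail (Kept r) k (ρ SRC e) (ρ TGT e)) (cong c (d≡ j j<W)) (trail-map keep′ p)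
    where
    r₀⇒r : ∀ e → e < m → 0 < r₀ e → 0 < r e
    r₀⇒r e e< r₀>0 with Flags.sound F₀ e e< r₀>0
    ... | j , j<W , eq = Flags.complete F e e< (j , j<W , trans (cong c (sym (d≡ j j<W))) eq)
    keep′ : ∀ {e} → e < m → r₀ e ≡ 0 → r e ≡ 0
    keep′ {e} e< r₀≡0 with r e ≟ 0
    ... | yes eq = eq
    ... | no ne with Flags.sound F e e< (n≢0⇒n>0 ne)
    ...   | j , j<W , eq = contradiction r₀≡0 (>⇒≢ (Flags.complete F₀ e e< (j , j<W , trans (cong c (d≡ j j<W)) eq)))

  accepted⇒good : ∀ {r d} → Flags r d → W ≤ flaggedWeight r → Bridges r d → Good r
  accepted⇒good {r} F weight≥ bridges = weight≥ , λ e e< r>0 →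
    let (j , j<W , eq) = Flags.sound F e e< r>0 in subst (Bridged (Kept r) A) eq (bridges j j<W)

  load-trial-correct : ∀ {Q s} → arrs s CAND ≡ c →
    (∀ s′ → Unchanged loadTrial s s′ → Flags (arrs s′ REMOVED) (arrs s DIGIT) → (∀ e → e < m → arrs s′ REMOVED e ≤ 1) → Q s′) →
    wp loadTrial Q s
  load-trial-correct {Q} {s} cand q = wp-frame loadTrial {s = s}
    (wp-call (fill-correct REMOVED SIZE (lit 0) 0 {s = s} (λ _ → refl) λ s₁ same₁ zeros →
      wp-for GOAL _ Inv
        ( refl , trans (Unchanged.arr≡ same₁ CAND refl) cand , Unchanged.arr≡ same₁ DIGIT refl
        , (λ e e< r>0 → contradiction (zeros e e<) (>⇒≢ r>0)) , (λ _ ())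
        , λ e e< → ≤-trans (≤-reflexive (zeros e e<)) z≤n )
        iteration
        λ s′ (_ , _ , _ , sound , comp , ≤1) →
          record { sound = sound ; complete = λ e e< (j , j<W , eq) → subst (λ z → 0 < arrs s′ REMOVED z) eq (comp j j<W) } , ≤1))
    (λ s′ same (F , ≤1) → q s′ same F ≤1)
    where
    d : ℕ → ℕ
    d = arrs s DIGIT
    Inv : ℕ → Store → Set
    Inv i s′ = vars s′ STEP ≡ i × arrs s′ CAND ≡ c × arrs s′ DIGIT ≡ d ×
      (∀ e → e < m → 0 < arrs s′ REMOVED e → Chosen d e) × (∀ j → j < i → 0 < arrs s′ REMOVED (c (d j))) ×
      (∀ e → e < m → arrs s′ REMOVED e ≤ 1)
    iteration : ∀ i s′ → i < W → Inv i s′ → _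
    iteration i s′ i<W (refl , cand , dig , sound , comp , ≤1) = refl , cand , dig , sound′ , comp′ , ≤1′
      where
      x : ℕ
      x = arrs s′ CAND (arrs s′ DIGIT i)
      x≡ : x ≡ c (d i)
      x≡ = cong₂ (λ g h → g (h i)) cand dig
      r : ℕ → ℕ
      r = arrs s′ REMOVED
      sound′ : ∀ e → e < m → 0 < (r [ x ↦ 1 ]) e → Chosen d e
      sound′ e e< r>0 with e ≟ x
      ... | yes e≡x = i , i<W , trans (sym x≡) (sym e≡x)
      ... | no e≢x = sound e e< (subst (0 <_) (update-other r 1 e≢x) r>0)
      comp′ : ∀ j → j < suc i → 0 < (r [ x ↦ 1 ]) (c (d j))
      comp′ j j< with c (d j) ≟ x
      ... | yes eq = subst (0 <_) (sym (trans (cong (r [ x ↦ 1 ]) eq) (update-same r x 1))) z<s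
      ... | no ne with m≤n⇒m<n∨m≡n (≤-pred j<)
      ...   | inj₁ j<i  = subst (0 <_) (sym (update-other r 1 ne)) (comp j j<i)
      ...   | inj₂ refl = contradiction (sym x≡) ne
      ≤1′ : ∀ e → e < m → (r [ x ↦ 1 ]) e ≤ 1
      ≤1′ e e< with e ≟ x
      ... | yes refl = ≤-reflexive (update-same r x 1)
      ... | no e≢x = ≤-trans (≤-reflexive (update-other r 1 e≢x)) (≤1 e e<)

  weigh-correct : ∀ {Q s} →
    (∀ s′ → Unchanged weigh s s′ → vars s′ SUM ≡ flaggedWeight (arrs s REMOVED) → Q s′) → wp weigh Q s
  weigh-correct {Q} {s} q = wp-frame weigh {s = s}
    (wp-call (wp-for SIZE _
      (λ i s′ → vars s′ IDX ≡ i × arrs s′ REMOVED ≡ r × vars s′ SUM ≡ sum (map (ρ WEIGHT) (filter flag? (downFrom i))))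
      (refl , refl , refl)
      (λ { i s′ _ (refl , same , eq) →
        (λ h → refl , same , trans (cong (ρ WEIGHT (vars s′ IDX) +_) eq)
          (sym (cong (λ l → sum (map (ρ WEIGHT) l)) (Listₚ.filter-accept flag? (subst (λ g → 0 < g (vars s′ IDX)) same h))))) ,
        (λ ¬h → refl , same , trans eq
          (sym (cong (λ l → sum (map (ρ WEIGHT) l)) (Listₚ.filter-reject flag? (λ h → ¬h (subst (λ g → 0 < g (vars s′ IDX)) (sym same) h)))))) })
      λ s′ (_ , _ , eq) → eq))
    q
    where
    r : ℕ → ℕ
    r = arrs s REMOVED
    flag? = λ e → 0 <? r e

  src≤n : ∀ e → e ≤ m → ρ SRC e < π NUM
  src≤n e e≤ with m≤n⇒m<n∨m≡n e≤
  ... | inj₁ e<  = src<n e e<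
  ... | inj₂ refl = subst (_< π NUM) (sym src-dummy) nonempty

  tgt≤n : ∀ e → e ≤ m → ρ TGT e < π NUM
  tgt≤n e e≤ with m≤n⇒m<n∨m≡n e≤
  ... | inj₁ e<  = tgt<n e e<
  ... | inj₂ refl = subst (_< π NUM) (sym tgt-dummy) nonempty

  verify-correct : ∀ {Q s} → arrs s CAND ≡ c → Digits (arrs s DIGIT) →
    (∀ s′ → Unchanged verify s s′ → (vars s′ VALID ≡ 1 → Bridges (arrs s REMOVED) (arrs s DIGIT)) →
      (Bridges (arrs s REMOVED) (arrs s DIGIT) → vars s′ VALID ≡ 1) → Q s′) →
    wp verify Q s
  verify-correct {Q} {s} cand digits q = wp-frame verify {s = s}
    (wp-call (wp-for GOAL _ Inv (refl , cand , refl , refl , (λ _ _ ()) , (λ _ → refl)) iteration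
      λ s′ (_ , _ , _ , _ , sound , comp) → sound , comp))
    (λ s′ same (sound , comp) → q s′ same sound comp)
    where
    r d : ℕ → ℕ
    r = arrs s REMOVED
    d = arrs s DIGIT
    Inv : ℕ → Store → Set
    Inv i s′ = vars s′ STEP ≡ i × arrs s′ CAND ≡ c × arrs s′ DIGIT ≡ d × arrs s′ REMOVED ≡ r ×
      (vars s′ VALID ≡ 1 → ∀ j → j < i → Bridged (Kept r) A (c (d j))) ×
      ((∀ j → j < i → Bridged (Kept r) A (c (d j))) → vars s′ VALID ≡ 1)
    iteration : ∀ i s′ → i < W → Inv i s′ → _
    iteration i s′ i<W (refl , cand , dig , rem , sound , comp) =
      bfs-correct (src≤n e e≤m) λ s₁ same L →
      let open Unchanged same
          chosen≡ : vars s₁ CHOSEN ≡ e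
          chosen≡ = var≡ CHOSEN refl
          step≡ : vars s₁ STEP ≡ i
          step≡ = var≡ STEP refl
          valid≡ : vars s₁ VALID ≡ vars s′ VALID
          valid≡ = var≡ VALID refl
          cand₁ : arrs s₁ CAND ≡ c
          cand₁ = trans (arr≡ CAND refl) cand
          dig₁ : arrs s₁ DIGIT ≡ d
          dig₁ = trans (arr≡ DIGIT refl) dig
          rem₁ : arrs s₁ REMOVED ≡ r
          rem₁ = trans (arr≡ REMOVED refl) rem
          Dt : ℕ
          Dt = arrs s₁ DIST (ρ TGT (vars s₁ CHOSEN))
          L′ = subst (λ g → Layered (π NUM) (λ f → g f ≡ 0) (ρ SRC e) (arrs s₁ DIST) (arrs s₁ BRANCH)) rem L
          bridged : 0 < Dt × Dt < 2 + A → Bridged (Kept r) A (c (d i))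
          bridged (h₁ , h₂) = subst (Bridged (Kept r) A) e≡
            (Layered.bridged-sound L′ refl (tgt≤n e e≤m)
              (>⇒≢ (subst (λ z → 0 < arrs s₁ DIST (ρ TGT z)) chosen≡ h₁))
              (≤-pred (subst (λ z → arrs s₁ DIST (ρ TGT z) < 2 + A) chosen≡ h₂)))
          unbridged : Bridged (Kept r) A (c (d i)) → 0 < Dt × Dt < 2 + A
          unbridged b = let (D≢0 , D≤) = Layered.bridged-complete L′ refl (subst (Bridged (Kept r) A) (sym e≡) b) in
            subst (λ z → 0 < arrs s₁ DIST (ρ TGT z)) (sym chosen≡) (n≢0⇒n>0 D≢0) ,
            subst (λ z → arrs s₁ DIST (ρ TGT z) < 2 + A) (sym chosen≡) (s≤s D≤)
      in
      (λ h → cong suc step≡ , cand₁ , dig₁ , rem₁ ,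
        (λ valid j j< → case m≤n⇒m<n∨m≡n (≤-pred j<) of λ where
          (inj₁ j<i)  → sound (trans (sym valid≡) valid) j j<i
          (inj₂ refl) → bridged h) ,
        (λ all → trans valid≡ (comp (λ j j<i → all j (m≤n⇒m≤1+n j<i))))) ,
      (λ ¬h → cong suc step≡ , cand₁ , dig₁ , rem₁ , (λ ()) , λ all → contradiction (unbridged (all i ≤-refl)) ¬h)
      where
      e : ℕ
      e = arrs s′ CAND (arrs s′ DIGIT i)
      e≡ : e ≡ c (d i)
      e≡ = cong₂ (λ g h → g (h i)) cand dig
      e≤m : e ≤ m
      e≤m = ≤-trans (≤-reflexive e≡) (c≤m (d i) (digits i i<W))

  keep-correct : ∀ {Q s} →
    (∀ s′ → Unchanged keep s s′ → (∀ e → e < m → arrs s′ WITNESS e ≡ 1 ∸ arrs s REMOVED e) → Q s′) → wp keep Q s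
  keep-correct {Q} {s} q = wp-frame keep {s = s}
    (wp-call (wp-for SIZE _
      (λ i s′ → vars s′ IDX ≡ i × arrs s′ REMOVED ≡ arrs s REMOVED × (∀ e → e < i → arrs s′ WITNESS e ≡ 1 ∸ arrs s REMOVED e))
      (refl , refl , λ _ ())
      (λ { i s′ _ (refl , same , old) → refl , same , λ e e< → case m≤n⇒m<n∨m≡n (≤-pred e<) of λ where
        (inj₁ e<i)  → trans (update-other (arrs s′ WITNESS) _ (<⇒≢ e<i)) (old e e<i)
        (inj₂ refl) → trans (update-same (arrs s′ WITNESS) _ _) (cong (λ g → 1 ∸ g e) same) })
      λ s′ (_ , _ , eq) → eq))
    q

  -- The condition on the value excludes the overflow after the last trial, when all digits return
  -- to 0; they are valid digits even then.
  advance-correct : ∀ {Q s} → Digits (arrs s DIGIT) →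
    (∀ s′ → Unchanged advance s s′ → Digits (arrs s′ DIGIT) →
      (suc (value K (arrs s DIGIT) W) < K ^ W → value K (arrs s′ DIGIT) W ≡ suc (value K (arrs s DIGIT) W)) → Q s′) →
    wp advance Q s
  advance-correct {Q} {s} digits q = wp-frame advance {s = s}
    (wp-call (wp-for GOAL _ Inv (refl , ≤-refl , digits , (λ _ _ → refl) , refl) iteration
      λ s′ (_ , carry≤ , digits′ , _ , eq) → digits′ , finish′ s′ carry≤ eq))
    (λ s′ same (digits′ , eq) → q s′ same digits′ eq)
    where
    d : ℕ → ℕ
    d = arrs s DIGIT
    Inv : ℕ → Store → Set
    Inv i s′ = vars s′ STEP ≡ i × vars s′ CARRY ≤ 1 × Digits (arrs s′ DIGIT) ×
      (∀ j → i ≤ j → arrs s′ DIGIT j ≡ d j) ×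
      value K (arrs s′ DIGIT) i + vars s′ CARRY * K ^ i ≡ suc (value K d i)
    finish′ : ∀ s′ → vars s′ CARRY ≤ 1 → value K (arrs s′ DIGIT) W + vars s′ CARRY * K ^ W ≡ suc (value K d W) →
      suc (value K d W) < K ^ W → value K (arrs s′ DIGIT) W ≡ suc (value K d W)
    finish′ s′ carry≤ eq lt with vars s′ CARRY
    ... | zero = trans (sym (+-identityʳ _)) eq
    ... | suc zero = contradiction lt (≤⇒≯ (≤-trans (≤-trans (≤-reflexive (sym (+-identityʳ (K ^ W)))) (m≤n+m _ (value K (arrs s′ DIGIT) W))) (≤-reflexive eq)))
    ... | suc (suc _) = contradiction carry≤ λ { (s≤s ()) }
    K>0 : 0 < K
    K>0 = ≤-trans z<s (≤-reflexive (sym choices))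
    iteration : ∀ i s′ → i < W → Inv i s′ → _
    iteration i s′ i<W (refl , carry≤ , digits′ , later , eq) =
      (λ carry≡1 →
        (λ full → refl , carry≤ , set-digit 0 K>0 , later′ 0 , overflow carry≡1 full) ,
        (λ not-full → refl , z≤n , set-digit (suc (d′ i)) (≤∧≢⇒< (digits′ i i<W) not-full) , later′ (suc (d′ i)) , bump carry≡1)) ,
      (λ carry≢1 → refl , carry≤ , digits′ , (λ j i<j → later j (<⇒≤ i<j)) , settled carry≢1)
      where
      d′ : ℕ → ℕ
      d′ = arrs s′ DIGIT
      V B : ℕ
      V = value K d′ i
      B = K ^ i
      set-digit : ∀ v → v < K → Digits (d′ [ i ↦ v ])
      set-digit v v<K j j<W with j ≟ i
      ... | yes refl = subst (_< K) (sym (update-same d′ i v)) v<K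
      ... | no j≢i = subst (_< K) (sym (update-other d′ v j≢i)) (digits′ j j<W)
      later′ : ∀ v j → i < j → (d′ [ i ↦ v ]) j ≡ d j
      later′ v j i<j = trans (update-other d′ v (>⇒≢ i<j)) (later j (<⇒≤ i<j))
      prefix : ∀ v → value K (d′ [ i ↦ v ]) i ≡ V
      prefix v = value-cong K i (λ j j<i → update-other d′ v (<⇒≢ j<i))
      di≡ : d′ i ≡ d i
      di≡ = later i ≤-refl
      base : vars s′ CARRY ≡ 1 → V + 1 * B ≡ suc (value K d i)
      base carry≡1 = trans (cong (λ z → V + z * B) (sym carry≡1)) eq
      rearrange₁ : ∀ v b k x → v + 1 * b + x * b ≡ v + (suc x) * b
      rearrange₁ v b k x = trans (+-assoc v _ _) (cong (λ z → v + (z + x * b)) (+-identityʳ b))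
      overflow : vars s′ CARRY ≡ 1 → suc (d′ i) ≡ K →
        value K (d′ [ i ↦ 0 ]) i + (d′ [ i ↦ 0 ]) i * B + vars s′ CARRY * (K * B) ≡ suc (value K d i + d i * B)
      overflow carry≡1 full = begin
        value K (d′ [ i ↦ 0 ]) i + (d′ [ i ↦ 0 ]) i * B + vars s′ CARRY * (K * B)
          ≡⟨ cong₂ _+_ (cong₂ (λ x y → x + y * B) (prefix 0) (update-same d′ i 0)) (cong (_* (K * B)) carry≡1) ⟩
        V + 0 + 1 * (K * B)     ≡⟨ cong₂ _+_ (+-identityʳ V) (+-identityʳ (K * B)) ⟩
        V + K * B               ≡⟨ cong (λ k → V + k * B) full ⟨
        V + suc (d′ i) * B      ≡⟨ rearrange₁ V B K (d′ i) ⟨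
        V + 1 * B + d′ i * B    ≡⟨ cong₂ (λ x y → x + y * B) (base carry≡1) di≡ ⟩
        suc (value K d i + d i * B) ∎
        where open ≡-Reasoning
      bump : vars s′ CARRY ≡ 1 →
        value K (d′ [ i ↦ suc (d′ i) ]) i + (d′ [ i ↦ suc (d′ i) ]) i * B + 0 ≡ suc (value K d i + d i * B)
      bump carry≡1 = begin
        value K (d′ [ i ↦ suc (d′ i) ]) i + (d′ [ i ↦ suc (d′ i) ]) i * B + 0
          ≡⟨ +-identityʳ _ ⟩
        value K (d′ [ i ↦ suc (d′ i) ]) i + (d′ [ i ↦ suc (d′ i) ]) i * B
          ≡⟨ cong₂ (λ x y → x + y * B) (prefix _) (update-same d′ i _) ⟩
        V + suc (d′ i) * B      ≡⟨ rearrange₁ V B K (d′ i) ⟨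
        V + 1 * B + d′ i * B    ≡⟨ cong₂ (λ x y → x + y * B) (base carry≡1) di≡ ⟩
        suc (value K d i + d i * B) ∎
        where open ≡-Reasoning
      settled : vars s′ CARRY ≢ 1 → V + d′ i * B + vars s′ CARRY * (K * B) ≡ suc (value K d i + d i * B)
      settled carry≢1 = begin
        V + d′ i * B + vars s′ CARRY * (K * B) ≡⟨ cong (λ z → V + d′ i * B + z * (K * B)) carry≡0 ⟩
        V + d′ i * B + 0                       ≡⟨ +-identityʳ _ ⟩
        V + d′ i * B                           ≡⟨ cong₂ (λ x y → x + y * B) V≡ di≡ ⟩
        suc (value K d i + d i * B)            ∎
        where
        open ≡-Reasoning
        carry≡0 : vars s′ CARRY ≡ 0
        carry≡0 = n<1⇒n≡0 (≤∧≢⇒< carry≤ carry≢1)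
        V≡ : V ≡ suc (value K d i)
        V≡ = trans (sym (trans (cong (λ z → V + z * B) carry≡0) (+-identityʳ V))) eq

  Outcome : ℕ → Store → Set
  Outcome t s =
    (vars s FOUND ≡ 1 × ∃[ r ] (Good r × (∀ e → e < m → r e ≤ 1) × (∀ e → e < m → arrs s WITNESS e ≡ 1 ∸ r e))) ⊎
    (vars s FOUND ≡ 0 × (∀ d → Digits d → value K d W < t → ¬ Accepted d))

  enumerate-correct : ∀ {Q s} → arrs s CAND ≡ c →
    (∀ s′ → Unchanged enumerateCmd s s′ → Outcome (K ^ W) s′ → Q s′) → wp enumerateCmd Q s
  enumerate-correct {Q} {s} cand q = wp-frame enumerateCmd {s = s}
    (wp-call (fill-correct DIGIT GOAL (lit 0) 0 (λ _ → refl) λ s₁ same₁ zeros →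
      wp-for TRIALS _ Inv
        ( trans (Unchanged.arr≡ same₁ CAND refl) cand
        , (λ j j<W → subst (_< K) (sym (zeros j j<W)) (≤-trans z<s (≤-reflexive (sym choices))))
        , (λ _ → value-zero K W zeros)
        , inj₂ (Unchanged.var≡ same₁ FOUND refl , λ _ _ ()))
        iteration
        λ s′ (_ , _ , _ , outcome) → subst (λ t → Outcome t s′) trials outcome))
    q
    where
    Inv : ℕ → Store → Set
    Inv t s′ = arrs s′ CAND ≡ c × Digits (arrs s′ DIGIT) × (t < K ^ W → value K (arrs s′ DIGIT) W ≡ t) × Outcome t s′
    iteration : ∀ t s′ → t < π TRIALS → Inv t s′ → wp trial (Inv (suc t)) s′
    iteration t s′ t<T (cand , digits , val , outcome) =
      wp-call (load-trial-correct cand λ s₁ u₁ F ≤1 →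
        weigh-correct λ s₂ u₂ sum≡ →
        let rem₂ : arrs s₂ REMOVED ≡ arrs s₁ REMOVED
            rem₂ = Unchanged.arr≡ u₂ REMOVED refl
            dig₂ : arrs s₂ DIGIT ≡ d
            dig₂ = trans (Unchanged.arr≡ u₂ DIGIT refl) (Unchanged.arr≡ u₁ DIGIT refl)
            cand₂ : arrs s₂ CAND ≡ c
            cand₂ = trans (Unchanged.arr≡ u₂ CAND refl) (trans (Unchanged.arr≡ u₁ CAND refl) cand)
        in
        verify-correct cand₂ (subst Digits (sym dig₂) digits) λ s₃ u₃ valid⇒ ⇒valid →
        let r = arrs s₁ REMOVED
            rem₃ : arrs s₃ REMOVED ≡ r
            rem₃ = trans (Unchanged.arr≡ u₃ REMOVED refl) rem₂
            dig₃ : arrs s₃ DIGIT ≡ d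
            dig₃ = trans (Unchanged.arr≡ u₃ DIGIT refl) dig₂
            cand₃ : arrs s₃ CAND ≡ c
            cand₃ = trans (Unchanged.arr≡ u₃ CAND refl) cand₂
            sum₃ : vars s₃ SUM ≡ flaggedWeight r
            sum₃ = trans (Unchanged.var≡ u₃ SUM refl) sum≡
            wit₃ : arrs s₃ WITNESS ≡ arrs s′ WITNESS
            wit₃ = trans (Unchanged.arr≡ u₃ WITNESS refl) (trans (Unchanged.arr≡ u₂ WITNESS refl) (Unchanged.arr≡ u₁ WITNESS refl))
            found₃ : vars s₃ FOUND ≡ vars s′ FOUND
            found₃ = trans (Unchanged.var≡ u₃ FOUND refl) (trans (Unchanged.var≡ u₂ FOUND refl) (Unchanged.var≡ u₁ FOUND refl))
            bridges = subst₂ (λ g h → vars s₃ VALID ≡ 1 → Bridges g h) rem₂ dig₂ valid⇒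
            bridges⁻ = subst₂ (λ g h → Bridges g h → vars s₃ VALID ≡ 1) rem₂ dig₂ ⇒valid
        in
        (λ (valid , enough) → keep-correct λ s₄ u₄ wit →
          continue s₄ (trans (Unchanged.arr≡ u₄ CAND refl) cand₃) (trans (Unchanged.arr≡ u₄ DIGIT refl) dig₃)
            (inj₁ (Unchanged.var≡ u₄ FOUND refl , r ,
              accepted⇒good F (≤-trans (≤-pred enough) (≤-reflexive sum₃)) (bridges valid) , ≤1 ,
              λ e e< → trans (wit e e<) (cong (λ g → 1 ∸ g e) rem₃)))) ,
        (λ rejected → continue s₃ cand₃ dig₃
          (Sum.map
            (λ (found , r₀ , good , ≤1₀ , wit) → trans found₃ found , r₀ , good , ≤1₀ ,
              λ e e< → trans (cong (λ g → g e) wit₃) (wit e e<))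
            (λ (found , none) → trans found₃ found , λ d₀ digits₀ val₀ acc → case m≤n⇒m<n∨m≡n (≤-pred val₀) of λ where
              (inj₁ lt) → none d₀ digits₀ lt acc
              -- Numerals are determined by their values, so a trial with number `t` is the one just
              -- rejected.
              (inj₂ eq) →
                let (weight≥ , br) = accepted-cong (value-inj K W digits₀ digits (trans eq (sym (val t<L)))) acc F in
                rejected (bridges⁻ br , s≤s (≤-trans weight≥ (≤-reflexive (sym sum₃)))))
            outcome)))
      where
      d : ℕ → ℕ
      d = arrs s′ DIGIT
      t<L : t < K ^ W
      t<L = ≤-trans t<T (≤-reflexive trials)
      continue : ∀ s₄ → arrs s₄ CAND ≡ c → arrs s₄ DIGIT ≡ d → Outcome (suc t) s₄ → wp advance (Inv (suc t)) s₄
      continue s₄ cand₄ dig₄ out₄ = advance-correct (subst Digits (sym dig₄) digits) λ s₅ u₅ digits₅ val₅ →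
        trans (Unchanged.arr≡ u₅ CAND refl) cand₄ , digits₅ ,
        (λ st<L → trans (val₅ (subst (_< K ^ W) (sym (cong suc (val₄))) st<L)) (cong suc val₄)) ,
        subst₂ (λ f g → (f ≡ 1 × ∃[ r ] (Good r × (∀ e → e < m → r e ≤ 1) × (∀ e → e < m → g e ≡ 1 ∸ r e))) ⊎
                        (f ≡ 0 × (∀ d → Digits d → value K d W < suc t → ¬ Accepted d)))
          (sym (Unchanged.var≡ u₅ FOUND refl)) (sym (Unchanged.arr≡ u₅ WITNESS refl)) out₄
        where
        val₄ : value K (arrs s₄ DIGIT) W ≡ t
        val₄ = trans (cong (λ g → value K g W) dig₄) (val t<L)

-- Independent sets

module _ {A B : Set} {R : A → B → Set} (R? : ∀ a b → Dec (R a b)) where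

  indicator : A → B → ℕ
  indicator a b = if does (R? a b) then 1 else 0

  private
    out-count : ∀ a bs → List.length (filter (R? a) bs) ≡ sum (map (indicator a) bs)
    out-count a []       = refl
    out-count a (b ∷ bs) with does (R? a b)
    ... | true  = cong suc (out-count a bs)
    ... | false = out-count a bs

    in-count : ∀ a as b → List.length (filter (λ a → R? a b) (a ∷ as)) ≡ indicator a b + List.length (filter (λ a → R? a b) as)
    in-count a as b with does (R? a b)
    ... | true  = refl
    ... | false = refl

    sum-map-+ : ∀ (f g : B → ℕ) bs → sum (map (λ b → f b + g b) bs) ≡ sum (map f bs) + sum (map g bs)
    sum-map-+ f g []       = refl
    sum-map-+ f g (b ∷ bs) = trans (cong (f b + g b +_) (sum-map-+ f g bs)) (interchange (f b) (g b) _ _)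

  -- Both sides count the related pairs; for a digraph these are the sums of out-degrees and of
  -- in-degrees.
  double-count : ∀ as bs → sum (map (λ a → List.length (filter (R? a) bs)) as) ≡
    sum (map (λ b → List.length (filter (λ a → R? a b) as)) bs)
  double-count [] bs = sym (zeros bs)
    where
    zeros : ∀ bs → sum (map (λ b → List.length (filter (λ a → R? a b) [])) bs) ≡ 0
    zeros []       = refl
    zeros (_ ∷ bs) = zeros bs
  double-count (a ∷ as) bs = begin
    List.length (filter (R? a) bs) + sum (map (λ a → List.length (filter (R? a) bs)) as)
      ≡⟨ cong₂ _+_ (out-count a bs) (double-count as bs) ⟩
    sum (map (indicator a) bs) + sum (map (λ b → List.length (filter (λ a → R? a b) as)) bs)
      ≡⟨ sum-map-+ (indicator a) _ bs ⟨
    sum (map (λ b → indicator a b + List.length (filter (λ a → R? a b) as)) bs)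
      ≡⟨ cong sum (Listₚ.map-cong (λ b → in-count a as b) bs) ⟨
    sum (map (λ b → List.length (filter (λ a → R? a b) (a ∷ as))) bs) ∎
    where open ≡-Reasoning

sum-map-≤ : ∀ {A : Set} (f : A → ℕ) k xs → (∀ {x} → x ∈ xs → f x ≤ k) → sum (map f xs) ≤ List.length xs * k
sum-map-≤ f k []       _  = z≤n
sum-map-≤ f k (x ∷ xs) f≤ = +-mono-≤ (f≤ (here refl)) (sum-map-≤ f k xs (f≤ ∘ there))

sum-map-≥ : ∀ {A : Set} (f : A → ℕ) k xs → (∀ {x} → x ∈ xs → k ≤ f x) → List.length xs * k ≤ sum (map f xs)
sum-map-≥ f k []       _  = z≤n
sum-map-≥ f k (x ∷ xs) f≥ = +-mono-≤ (f≥ (here refl)) (sum-map-≥ f k xs (f≥ ∘ there))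

-- In the digraph with an arc from e to each element of out e, some
-- vertex has in-degree at most a, as the out-degrees are; it is chosen
-- and removed together with its at most a + a neighbours.
module IndependentSets (out : ℕ → List ℕ) (a : ℕ) where

  hits : List ℕ → ℕ → List ℕ
  hits xs e = filter (λ f → member? _≟_ e (out f)) xs

  -- If all in-degrees were at least a + 1, there would be more arcs than the out-degrees admit.
  low-degree : ∀ xs → Unique xs → (∀ {e} → e ∈ xs → List.length (out e) ≤ a) → 0 < List.length xs →
    ∃[ e ] (e ∈ xs × List.length (hits xs e) ≤ a)
  low-degree xs u out≤ 0<xs with Any.any? (λ e → List.length (hits xs e) ≤? a) xs
  ... | yes p = Membership.find p
  ... | no ¬p = contradiction (begin
      List.length xs * suc a                                          ≤⟨ sum-map-≥ (List.length ∘ hits xs) (suc a) xs (λ e∈ → ≰⇒> (λ le → ¬p (Membership.lose e∈ le))) ⟩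
      sum (map (List.length ∘ hits xs) xs)                            ≡⟨ double-count (λ e f → member? _≟_ e (out f)) xs xs ⟩
      sum (map (λ f → List.length (filter (λ e → member? _≟_ e (out f)) xs)) xs)
        ≤⟨ sum-map-≤ _ a xs (λ {f} f∈ → ≤-trans (length-⊆ (Uniqueₚ.filter⁺ (λ e → member? _≟_ e (out f)) u)
             (λ e∈ → proj₂ (∈ₚ.∈-filter⁻ (λ e → member? _≟_ e (out f)) {xs = xs} e∈))) (out≤ f∈)) ⟩
      List.length xs * a                                              ∎)
    (<⇒≱ (*-monoʳ-< (List.length xs) {{>-nonZero 0<xs}} ≤-refl))
    where open ≤-Reasoning

  Independent : List ℕ → Set
  Independent ys = ∀ {e f} → e ∈ ys → f ∈ ys → e ≢ f → f ∉ out e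

  independent-set : ∀ w xs → Unique xs → (∀ {e} → e ∈ xs → List.length (out e) ≤ a) → w * suc (a + a) ≤ List.length xs →
    ∃[ ys ] (List.length ys ≡ w × Unique ys × ys ⊆ xs × Independent ys)
  independent-set zero    xs u out≤ large = [] , refl , [] , (λ ()) , λ ()
  independent-set (suc w) xs u out≤ large with low-degree xs u out≤ (≤-trans z<s large)
  ... | e , e∈ , deg≤ = extend (independent-set w rest (Uniqueₚ.filter⁺ keep? u) (out≤ ∘ rest⊆) large′)
    where
    Keep : ℕ → Set
    Keep f = f ≢ e × f ∉ out e × e ∉ out f
    keep? : ∀ f → Dec (Keep f)
    keep? f = ¬? (f ≟ e) ×-dec ¬? (member? _≟_ f (out e)) ×-dec ¬? (member? _≟_ e (out f))
    rest : List ℕ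
    rest = filter keep? xs
    rest⊆ : rest ⊆ xs
    rest⊆ f∈ = proj₁ (∈ₚ.∈-filter⁻ keep? f∈)
    cover : xs ⊆ rest ++ (e ∷ out e ++ hits xs e)
    cover {f} f∈ with f ≟ e | member? _≟_ f (out e) | member? _≟_ e (out f)
    ... | yes refl | _ | _ = ∈ₚ.∈-++⁺ʳ rest (here refl)
    ... | no _ | yes f∈e | _ = ∈ₚ.∈-++⁺ʳ rest (there (∈ₚ.∈-++⁺ˡ f∈e))
    ... | no _ | no _ | yes e∈f = ∈ₚ.∈-++⁺ʳ rest (there (∈ₚ.∈-++⁺ʳ (out e) (∈ₚ.∈-filter⁺ (λ f → member? _≟_ e (out f)) f∈ e∈f)))
    ... | no p | no q | no r = ∈ₚ.∈-++⁺ˡ (∈ₚ.∈-filter⁺ keep? f∈ (p , q , r))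
    large′ : w * suc (a + a) ≤ List.length rest
    large′ = +-cancelʳ-≤ (suc (a + a)) _ _ (begin
      w * suc (a + a) + suc (a + a)                  ≡⟨ +-comm _ (suc (a + a)) ⟩
      suc w * suc (a + a)                            ≤⟨ large ⟩
      List.length xs                                 ≤⟨ length-⊆ u cover ⟩
      List.length (rest ++ (e ∷ out e ++ hits xs e)) ≡⟨ Listₚ.length-++ rest ⟩
      List.length rest + suc (List.length (out e ++ hits xs e)) ≡⟨ cong (λ l → List.length rest + suc l) (Listₚ.length-++ (out e)) ⟩
      List.length rest + suc (List.length (out e) + List.length (hits xs e)) ≤⟨ +-monoʳ-≤ (List.length rest) (s≤s (+-mono-≤ (out≤ e∈) deg≤)) ⟩
      List.length rest + suc (a + a)                 ∎)
      where open ≤-Reasoning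
    extend : ∃[ ys ] (List.length ys ≡ w × Unique ys × ys ⊆ rest × Independent ys) →
      ∃[ ys ] (List.length ys ≡ suc w × Unique ys × ys ⊆ xs × Independent ys)
    extend (ys , len , uys , ys⊆ , ind) = e ∷ ys , cong suc len ,
      All.tabulate (λ y∈ → λ { refl → proj₁ (kept y∈) refl }) ∷ uys ,
      (λ { (here refl) → e∈ ; (there y∈) → rest⊆ (ys⊆ y∈) }) ,
      λ { (here refl) (here refl) e≢f → contradiction refl e≢f
        ; (here refl) (there f∈) _ → proj₁ (proj₂ (kept f∈))
        ; (there f∈) (here refl) _ → proj₂ (proj₂ (kept f∈))
        ; (there e∈) (there f∈) e≢f → ind e∈ f∈ e≢f }
      where
      kept : ∀ {f} → f ∈ ys → Keep f
      kept f∈ = proj₂ (∈ₚ.∈-filter⁻ keep? {xs = xs} (ys⊆ f∈))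

-- Completeness of the search

-- Turns the detours of the single candidates into one function, which is the out-neighbourhood in
-- the digraph.
finite-choice : ∀ {A : Set} (default : A) {Q : ℕ → A → Set} xs →
  (∀ {x} → x ∈ xs → ∃[ y ] Q x y) → ∃[ f ] (∀ {x} → x ∈ xs → Q x (f x))
finite-choice {A} default {Q} xs h = f , correct
  where
  pick : ∀ {x} → Dec (x ∈ xs) → A
  pick (yes x∈) = proj₁ (h x∈)
  pick (no _)   = default
  f : ℕ → A
  f x = pick (member? _≟_ x xs)
  correct : ∀ {x} → x ∈ xs → Q x (f x)
  correct {x} x∈ with member? _≟_ x xs
  ... | yes x∈′ = proj₂ (h x∈′)
  ... | no x∉   = contradiction x∈ x∉

-- Reading beyond the end of a list yields 0, the place of the dummy edge; short sequences of digits
-- are thereby padded.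
contents-cases : ∀ xs i → contents xs i ∈ xs ⊎ contents xs i ≡ 0
contents-cases []       i       = inj₂ refl
contents-cases (x ∷ xs) zero    = inj₁ (here refl)
contents-cases (x ∷ xs) (suc i) = Sum.map₁ there (contents-cases xs i)

∈-contents : ∀ {x xs} → x ∈ xs → ∃[ i ] (i < List.length xs × contents xs i ≡ x)
∈-contents (here refl) = 0 , z<s , refl
∈-contents (there x∈)  = let (i , i< , eq) = ∈-contents x∈ in suc i , s≤s i< , eq

preimages : ∀ {g : ℕ → ℕ} {Q : ℕ → Set} ys → (∀ {y} → y ∈ ys → ∃[ j ] (Q j × g j ≡ y)) →
  ∃[ js ] (List.length js ≡ List.length ys × (∀ {j} → j ∈ js → Q j × g j ∈ ys) × (∀ {y} → y ∈ ys → ∃[ j ] (j ∈ js × g j ≡ y)))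
preimages []       h = [] , refl , (λ ()) , λ ()
preimages (y ∷ ys) h with h (here refl) | preimages ys (h ∘ there)
... | j , Qj , refl | js , len , p , q = j ∷ js , cong suc len ,
  (λ { (here refl) → Qj , here refl ; (there j∈) → let (Qi , i∈) = p j∈ in Qi , there i∈ }) ,
  (λ { (here refl) → j , here refl , refl ; (there y∈) → let (i , i∈ , eq) = q y∈ in i , there i∈ , eq })

-- The elements kept contribute at least 1 each; if there are fewer than `w`, nothing is cut off.
sum-take : ∀ (g : ℕ → ℕ) w xs → (∀ {x} → x ∈ xs → 0 < g x) → w ≤ sum (map g xs) → w ≤ sum (map g (take w xs))
sum-take g w xs pos w≤ = ≤-trans (≤-reflexive (sym (m≤n⇒m⊓n≡m w≤))) (truncated w xs pos)
  where
  truncated : ∀ w xs → (∀ {x} → x ∈ xs → 0 < g x) → w ⊓ sum (map g xs) ≤ sum (map g (take w xs))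
  truncated zero    xs       _   = z≤n
  truncated (suc w) []       _   = z≤n
  truncated (suc w) (x ∷ xs) pos = begin
    suc w ⊓ (g x + sum (map g xs))     ≤⟨ ⊓-monoˡ-≤ _ (+-monoˡ-≤ w (pos (here refl))) ⟩
    (g x + w) ⊓ (g x + sum (map g xs)) ≡⟨ +-distribˡ-⊓ (g x) w _ ⟨
    g x + (w ⊓ sum (map g xs))         ≤⟨ +-monoʳ-≤ (g x) (truncated w xs (pos ∘ there)) ⟩
    g x + sum (map g (take w xs))      ∎
    where open ≤-Reasoning

sum-positive : ∀ (g : ℕ → ℕ) xs → sum (map g (filter (λ x → 0 <? g x) xs)) ≡ sum (map g xs)
sum-positive g []       = refl
sum-positive g (x ∷ xs) with 0 <? g x
... | yes p = trans (cong (λ l → sum (map g l)) (Listₚ.filter-accept (λ x → 0 <? g x) p)) (cong (g x +_) (sum-positive g xs))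
... | no ¬p = trans (cong (λ l → sum (map g l)) (Listₚ.filter-reject (λ x → 0 <? g x) ¬p))
  (trans (sum-positive g xs) (cong (_+ sum (map g xs)) (sym (n≤0⇒n≡0 (≮⇒≥ ¬p)))))

take-⊆ : ∀ {A : Set} w (xs : List A) → take w xs ⊆ xs
take-⊆ (suc w) (x ∷ xs) (here refl) = here refl
take-⊆ (suc w) (x ∷ xs) (there y∈)  = there (take-⊆ w xs y∈)

module Completeness (η : Env) (setup : Setup η) (c : ℕ → ℕ)
  (c≤m : ∀ j → j < Env.params η CHOICES → c j ≤ Env.params η SIZE) {k : ℕ}
  (C : CandidateSearch.Candidates η setup (λ _ → 0 ≡ 0) c k) where
  open Env η renaming (params to π; tables to ρ) using ()
  open Setup setup
  open Graphs (π SIZE) (ρ SRC) (ρ TGT)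
  open WeightedSums (π SIZE) (ρ WEIGHT)
  open Enumeration η setup c c≤m
  open CandidateSearch.Candidates C renaming (complete to exhausted)

  candidateList : List ℕ
  candidateList = applyUpTo (λ i → c (suc i)) (pred k)

  private
    suc-pred-k : suc (pred k) ≡ k
    suc-pred-k = suc-pred k {{>-nonZero positive}}

    suc<k : ∀ {i} → i < pred k → suc i < k
    suc<k i< = ≤-trans (s≤s i<) (≤-reflexive suc-pred-k)

  candidateList-unique : Unique candidateList
  candidateList-unique = Uniqueₚ.applyUpTo⁺₁ _ (pred k) λ i<j j< → distinct z<s (s≤s i<j) (suc<k j<)

  ∈-candidateList⁻ : ∀ {e} → e ∈ candidateList → ∃[ j ] ((0 < j × j < k) × c j ≡ e)
  ∈-candidateList⁻ e∈ with ∈ₚ.∈-applyUpTo⁻ _ e∈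
  ... | i , i< , refl = suc i , (z<s , suc<k i<) , refl

  candidate : ∀ {e} → e ∈ candidateList → e < m × 0 < ρ WEIGHT e × Detour A e
  candidate e∈ with ∈-candidateList⁻ e∈
  ... | j , (0<j , j<k) , refl = let (c< , w , d , _) = valid j 0<j j<k in c< , w , d

  -- A set of at most W candidates is a trial, the dummy candidate 0
  -- filling the remaining positions.
  accepts : ∀ ys → Unique ys → (∀ {e} → e ∈ ys → ∃[ j ] ((0 < j × j < k) × c j ≡ e)) → List.length ys ≤ W →
    W ≤ sum (map (ρ WEIGHT) ys) → (∀ {e} → e ∈ ys → Bridged (_∉ ys) A e) → ∃[ d ] (Digits d × Accepted d)
  accepts ys uys ys⊆ len≤ weight≥ bridged with preimages {g = c} ys ys⊆
  ... | js , len , js⇒ , ys⇒ = contents js , digits , r ,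
    record { sound = sound ; complete = complete } ,
    ≤-trans weight≥ (sum-⊆ (ρ WEIGHT) uys (λ e∈ → ∈-flagged⁺ (ys<m e∈) (member-flag e∈))) , bridges
    where
    r : ℕ → ℕ
    r e = if does (member? _≟_ e ys) then 1 else 0
    member-flag : ∀ {e} → e ∈ ys → 0 < r e
    member-flag {e} e∈ rewrite dec-true (member? _≟_ e ys) e∈ = z<s
    not-member-kept : ∀ {e} → e ∉ ys → Kept r e
    not-member-kept {e} e∉ rewrite dec-false (member? _≟_ e ys) e∉ = refl
    flag-member : ∀ {e} → 0 < r e → e ∈ ys
    flag-member {e} r>0 = case member? _≟_ e ys of λ where
      (yes e∈) → e∈
      (no e∉)  → contradiction (not-member-kept e∉) (>⇒≢ r>0)
    ys<m : ∀ {e} → e ∈ ys → e < m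
    ys<m e∈ with ys⊆ e∈
    ... | j , (0<j , j<k) , refl = proj₁ (valid j 0<j j<k)
    K>0 : 0 < K
    K>0 = ≤-trans positive bounded
    zero-dummy : c 0 ≡ m
    zero-dummy = dummy 0 K>0 (inj₁ refl)
    digits : Digits (contents js)
    digits j _ with contents-cases js j
    ... | inj₁ j∈ = <-≤-trans (proj₂ (proj₁ (js⇒ j∈))) bounded
    ... | inj₂ eq = subst (_< K) (sym eq) K>0
    sound : ∀ e → e < m → 0 < r e → Chosen (contents js) e
    sound e e< r>0 with ys⇒ (flag-member r>0)
    ... | j , j∈ , eq with ∈-contents j∈
    ...   | i , i< , refl = i , <-≤-trans i< (≤-trans (≤-reflexive len) len≤) , eq
    complete : ∀ e → e < m → Chosen (contents js) e → 0 < r e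
    complete e e< (j , j<W , eq) with contents-cases js j
    ... | inj₁ j∈ = member-flag (subst (_∈ ys) eq (proj₂ (js⇒ j∈)))
    ... | inj₂ j≡0 = contradiction (trans (sym eq) (trans (cong c j≡0) zero-dummy)) (<⇒≢ e<)
    bridges : Bridges r (contents js)
    bridges j j<W with contents-cases js j
    ... | inj₁ j∈ = let (k , k≤ , p) = bridged (proj₂ (js⇒ j∈)) in k , k≤ , trail-map (λ _ → not-member-kept) p
    -- Both ends of the dummy edge are vertex 0, so that the empty trail bridges it.
    ... | inj₂ j≡0 = 0 , z≤n , subst₂ (Trail (Kept r) 0) refl
      (trans (trans (cong (ρ SRC) c≡m) src-dummy) (sym (trans (cong (ρ TGT) c≡m) tgt-dummy))) stop
      where
      c≡m : c (contents js j) ≡ m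
      c≡m = trans (cong c j≡0) zero-dummy

  -- A full list means yes without assuming a solution: W of its W (2A + 1) candidates are
  -- independent, each retains its detour when all are removed, and positive integer weights add up
  -- to at least W.
  many-candidates : k ≡ K → ∃[ d ] (Digits d × Accepted d)
  many-candidates refl with finite-choice [] {Q = λ e es → List.length es ≤ A × e ∉ es ×
      (∃[ j ] (j ≤ A × Σ[ p ∈ Trail (_≢ e) j (ρ SRC e) (ρ TGT e) ] trail-edges p ⊆ es))} candidateList
      (λ e∈ → let (_ , _ , j , j≤A , p) = candidate e∈ in
        trail-edges p , ≤-trans (≤-reflexive (trail-edges-length p)) j≤A , (λ e∈p → trail-edges-all p e∈p refl) ,
        j , j≤A , p , id)
  ... | det , correct with IndependentSets.independent-set det A W candidateList candidateList-unique
      (λ e∈ → proj₁ (correct e∈)) (≤-reflexive (trans (cong pred (sym choices)) (sym (Listₚ.length-applyUpTo _ (pred k)))))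
  ...   | ys , len , uys , ys⊆ , ind = accepts ys uys (∈-candidateList⁻ ∘ ys⊆) (≤-reflexive len)
    (≤-trans (≤-reflexive (trans (sym len) (sym (*-identityʳ _))))
      (sum-map-≥ (ρ WEIGHT) 1 ys (λ e∈ → proj₁ (proj₂ (candidate (ys⊆ e∈))))))
    λ {e} e∈ → let (j , j≤A , p , p⊆) = proj₂ (proj₂ (correct (ys⊆ e∈))) in
      j , j≤A , trail-restrict p λ f∈p _ f≢e f∈ → ind e∈ f∈ (f≢e ∘ sym) (p⊆ f∈p)

  -- Every removed edge of positive weight has a detour and is therefore listed. Restricting a
  -- solution to W such edges puts the others back, which leaves the detours intact.
  few-candidates : (∀ e → e < m → 0 ≡ 0 → 0 < ρ WEIGHT e → Detour A e → ∃[ j ] (0 < j × j < k × c j ≡ e)) →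
    ∀ {r} → Good r → ∃[ d ] (Digits d × Accepted d)
  few-candidates all {r} (weight≥ , bridged) = accepts ys
    (Uniqueₚ.take⁺ W (Uniqueₚ.filter⁺ positive? (flagged-unique r)))
    (λ e∈ → let (e< , r>0 , w>0) = heavy e∈
                (i , i≤ , p) = bridged _ e< r>0
                (j , 0<j , j<k , eq) = all _ e< refl w>0 (i , i≤ , trail-map (λ _ kept → λ { refl → >⇒≢ r>0 kept }) p)
            in j , (0<j , j<k) , eq)
    (≤-trans (≤-reflexive (Listₚ.length-take W _)) (m⊓n≤m W _))
    (sum-take (ρ WEIGHT) W _ (λ e∈ → proj₂ (∈ₚ.∈-filter⁻ positive? {xs = flagged r} e∈))
      (≤-trans weight≥ (≤-reflexive (sym (sum-positive (ρ WEIGHT) (flagged r))))))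
    (λ e∈ → let (e< , r>0 , w>0) = heavy e∈
                (i , i≤ , p) = bridged _ e< r>0
            in i , i≤ , trail-map (λ _ kept f∈ → >⇒≢ (proj₁ (proj₂ (heavy f∈))) kept) p)
    where
    positive? = λ e → 0 <? ρ WEIGHT e
    ys : List ℕ
    ys = take W (filter positive? (flagged r))
    heavy : ∀ {e} → e ∈ ys → e < m × 0 < r e × 0 < ρ WEIGHT e
    heavy e∈ with ∈ₚ.∈-filter⁻ positive? {xs = flagged r} (take-⊆ W _ e∈)
    ... | e∈′ , w>0 with ∈-flagged⁻ {r} e∈′
    ...   | e< , r>0 = e< , r>0 , w>0

  good⇒accepted : ∀ {r} → Good r → ∃[ d ] (Digits d × Accepted d)
  good⇒accepted good = Sum.[ many-candidates , (λ all → few-candidates all good) ]′ exhausted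

module Searching (η : Env) (setup : Setup η) where
  open Env η renaming (params to π; tables to ρ) using ()
  open Semantics η
  open Frames η
  open Setup setup
  open Graphs (π SIZE) (ρ SRC) (ρ TGT)
  open WeightedSums (π SIZE) (ρ WEIGHT)

  -- The condition `Good`, restated outside the module over a fixed list of candidates.
  GoodFlags : (ℕ → ℕ) → Set
  GoodFlags r = π GOAL ≤ flaggedWeight r × (∀ e → e < π SIZE → 0 < r e → Bridged (λ f → r f ≡ 0) (π STRETCH) e)

  Answer : Store → Set
  Answer s =
    (cells s 0 ≡ 1 × ∃[ r ] (GoodFlags r × (∀ e → e < π SIZE → r e ≤ 1) × (∀ e → e < π SIZE → cells s (suc e) ≡ 1 ∸ r e))) ⊎
    (cells s 0 ≡ 0 × ¬ (∃[ r ] GoodFlags r))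

  write-same : ∀ s a v → a < bound η → cells (setCell a v s) a ≡ v
  write-same s a v a< rewrite dec-true (a <? bound η) a< = update-same (cells s) a v

  write-other : ∀ s a v b → b ≢ a → cells (setCell a v s) b ≡ cells s b
  write-other s a v b b≢a with does (a <? bound η)
  ... | true  = update-other (cells s) v b≢a
  ... | false = refl

  search-correct : π SIZE < bound η → ∀ {s} → wp searchCmd Answer s
  search-correct room {s} = CandidateSearch.candidates-correct η setup λ s₁ C →
    let open CandidateSearch.Candidates C
        c = arrs s₁ CAND
        c≤m : ∀ j → j < π CHOICES → c j ≤ π SIZE
        c≤m j j<K = case <-cmp j 0 of λ where
          (tri≈ _ j≡0 _) → ≤-reflexive (dummy j j<K (inj₁ j≡0))
          (tri> _ _ 0<j) → case vars s₁ COUNT ≤? j of λ where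
            (yes k≤j) → ≤-reflexive (dummy j j<K (inj₂ k≤j))
            (no k≰j)  → <⇒≤ (proj₁ (valid j 0<j (≰⇒> k≰j)))
    in
    Enumeration.enumerate-correct η setup c c≤m refl λ s₂ _ outcome →
    output s₂ c c≤m (Completeness.good⇒accepted η setup c c≤m C) outcome
    where
    output : ∀ s₂ c c≤m → let open Enumeration η setup c c≤m in
      (∀ {r} → Good r → ∃[ d ] (Digits d × Accepted d)) → Outcome (K ^ W) s₂ → wp outputCmd Answer s₂
    output s₂ c c≤m complete (inj₂ (found≡0 , none)) =
      (λ found → contradiction (trans (sym found) found≡0) 1+n≢0) ,
      (λ _ → inj₂ (write-same s₂ 0 0 (≤-trans z<s room) ,
        λ (r , good) → let (d , digits , acc) = complete good in none d digits (value< K W digits) acc))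
      where open Enumeration η setup c c≤m
    output s₂ c c≤m complete (inj₁ (found≡1 , r , good , ≤1 , wit)) =
      (λ _ → wp-for SIZE _
        (λ i s′ → vars s′ IDX ≡ i × arrs s′ WITNESS ≡ arrs s₂ WITNESS × cells s′ 0 ≡ 1 × (∀ e → e < i → cells s′ (suc e) ≡ 1 ∸ r e))
        (refl , refl , write-same s₂ 0 1 (≤-trans z<s room) , λ _ ())
        (λ { i s′ i<m (refl , same , zero≡ , old) → refl , same ,
          trans (write-other s′ (suc i) (arrs s′ WITNESS i) 0 (λ ())) zero≡ ,
          λ e e< → case m≤n⇒m<n∨m≡n (≤-pred e<) of λ where
            (inj₁ e<i)  → trans (write-other s′ (suc i) (arrs s′ WITNESS i) (suc e) (λ eq → <⇒≢ e<i (suc-injective eq))) (old e e<i)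
            (inj₂ refl) → trans (write-same s′ (suc i) (arrs s′ WITNESS i) (≤-<-trans i<m room))
              (trans (cong (λ g → g e) same) (wit e i<m)) })
        λ s′ (_ , _ , zero≡ , eq) → inj₁ (zero≡ , r , good , ≤1 , eq)) ,
      (λ not-found → contradiction found≡1 not-found)

-- Rational bounds

-- The division in `fromℕ` takes a gcd, which is stuck on a variable; this exposes the normal form.
fromℕ-mkℚ : ∀ k → fromℕ k ≡ ℚ.mkℚ (ℤ.+ k) 0 (Coprimality.sym (Coprimality.1-coprimeTo k))
fromℕ-mkℚ k = ℚₚ.normalize-coprime (Coprimality.sym (Coprimality.1-coprimeTo k))

toℚᵘ-fromℕ : ∀ k → ℚ.toℚᵘ (fromℕ k) ≡ ℚᵘ.mkℚᵘ (ℤ.+ k) 0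
toℚᵘ-fromℕ k = cong ℚ.toℚᵘ (fromℕ-mkℚ k)

fromℕ-* : ∀ a b → fromℕ (a * b) ≡ fromℕ a ℚ.* fromℕ b
fromℕ-* a b = ℚₚ.toℚᵘ-injective (begin
  ℚ.toℚᵘ (fromℕ (a * b))                       ≡⟨ toℚᵘ-fromℕ (a * b) ⟩
  ℚᵘ.mkℚᵘ (ℤ.+ (a * b)) 0                      ≡⟨ cong (λ i → ℚᵘ.mkℚᵘ i 0) (ℤₚ.pos-* a b) ⟩
  ℚᵘ.mkℚᵘ (ℤ.+ a) 0 ℚᵘ.* ℚᵘ.mkℚᵘ (ℤ.+ b) 0     ≡⟨ cong₂ ℚᵘ._*_ (toℚᵘ-fromℕ a) (toℚᵘ-fromℕ b) ⟨
  ℚ.toℚᵘ (fromℕ a) ℚᵘ.* ℚ.toℚᵘ (fromℕ b)       ≈⟨ ℚₚ.toℚᵘ-homo-* (fromℕ a) (fromℕ b) ⟨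
  ℚ.toℚᵘ (fromℕ a ℚ.* fromℕ b)                 ∎)
  where open ℚᵘₚ.≃-Reasoning

fromℕ-+ : ∀ a b → fromℕ (a + b) ≡ fromℕ a ℚ.+ fromℕ b
fromℕ-+ a b = ℚₚ.toℚᵘ-injective (begin
  ℚ.toℚᵘ (fromℕ (a + b))                       ≡⟨ toℚᵘ-fromℕ (a + b) ⟩
  ℚᵘ.mkℚᵘ (ℤ.+ (a + b)) 0                      ≡⟨ cong (λ i → ℚᵘ.mkℚᵘ i 0) (cong₂ ℤ._+_ (ℤₚ.*-identityʳ (ℤ.+ a)) (ℤₚ.*-identityʳ (ℤ.+ b))) ⟨
  ℚᵘ.mkℚᵘ (ℤ.+ a) 0 ℚᵘ.+ ℚᵘ.mkℚᵘ (ℤ.+ b) 0     ≡⟨ cong₂ ℚᵘ._+_ (toℚᵘ-fromℕ a) (toℚᵘ-fromℕ b) ⟨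
  ℚ.toℚᵘ (fromℕ a) ℚᵘ.+ ℚ.toℚᵘ (fromℕ b)       ≈⟨ ℚₚ.toℚᵘ-homo-+ (fromℕ a) (fromℕ b) ⟨
  ℚ.toℚᵘ (fromℕ a ℚ.+ fromℕ b)                 ∎)
  where open ℚᵘₚ.≃-Reasoning

numerator-nonneg : ∀ {α} → 0ℚ ℚ.≤ α → ℤ.+ ℤ.∣ ℚ.↥ α ∣ ≡ ℚ.↥ α
numerator-nonneg {α@record{}} (ℚ.*≤* le) = ℤₚ.0≤i⇒+∣i∣≡i
  (ℤₚ.≤-trans le (ℤₚ.≤-reflexive (ℤₚ.*-identityʳ (ℚ.↥ α))))

fromℕ-mono-≤ : ∀ {a b} → a ≤ b → fromℕ a ℚ.≤ fromℕ b
fromℕ-mono-≤ {a} {b} a≤b = subst₂ ℚ._≤_ (sym (fromℕ-mkℚ a)) (sym (fromℕ-mkℚ b))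
  (ℚ.*≤* (ℤₚ.*-monoʳ-≤-nonNeg (ℤ.+ 1) (ℤ.+≤+ a≤b)))

fromℕ≥0 : ∀ k → 0ℚ ℚ.≤ fromℕ k
fromℕ≥0 k = fromℕ-mono-≤ {0} {k} z≤n

-- Cross-multiplication: comparisons with α become comparisons of the numbers that the machine
-- divides.
fromℕ≤⁻ : ∀ {d α} → fromℕ d ℚ.≤ α → d * ℚ.↧ₙ α ≤ ℤ.∣ ℚ.↥ α ∣
fromℕ≤⁻ {d} {α@record{}} d≤α with subst (ℚ._≤ α) (fromℕ-mkℚ d) d≤α
... | ℚ.*≤* le = ℤₚ.drop‿+≤+ (ℤₚ.≤-trans (ℤₚ.≤-reflexive (ℤₚ.pos-* d (ℚ.↧ₙ α)))
  (ℤₚ.≤-trans le (ℤₚ.≤-trans (ℤₚ.≤-reflexive (ℤₚ.*-identityʳ (ℚ.↥ α))) (ℤₚ.≤-reflexive (sym (numerator-nonneg {α} (ℚₚ.≤-trans (fromℕ≥0 d) d≤α)))))))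

fromℕ≤⁺ : ∀ {d α} → 0ℚ ℚ.≤ α → d * ℚ.↧ₙ α ≤ ℤ.∣ ℚ.↥ α ∣ → fromℕ d ℚ.≤ α
fromℕ≤⁺ {d} {α@record{}} 0≤α le = subst (ℚ._≤ α) (sym (fromℕ-mkℚ d)) (ℚ.*≤* (begin
  ℤ.+ d ℤ.* ℚ.↧ α       ≡⟨ ℤₚ.pos-* d (ℚ.↧ₙ α) ⟨
  ℤ.+ (d * ℚ.↧ₙ α)      ≤⟨ ℤ.+≤+ le ⟩
  ℤ.+ ℤ.∣ ℚ.↥ α ∣       ≡⟨ numerator-nonneg 0≤α ⟩
  ℚ.↥ α                 ≡⟨ ℤₚ.*-identityʳ (ℚ.↥ α) ⟨
  ℚ.↥ α ℤ.* ℤ.+ 1       ∎))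
  where open ℤₚ.≤-Reasoning

*-mono-≤ℚ : ∀ {a b c d} → 0ℚ ℚ.≤ a → 0ℚ ℚ.≤ d → a ℚ.≤ b → c ℚ.≤ d → a ℚ.* c ℚ.≤ b ℚ.* d
*-mono-≤ℚ {a} {b} {c} {d} 0≤a 0≤d a≤b c≤d = ℚₚ.≤-trans
  (ℚₚ.*-monoˡ-≤-nonNeg a {{ℚ.nonNegative 0≤a}} c≤d) (ℚₚ.*-monoʳ-≤-nonNeg d {{ℚ.nonNegative 0≤d}} a≤b)

-- Walks, paths and distances

least : ∀ {P : ℕ → Set} → (∀ i → Dec (P i)) → ∀ {k} → P k → ∃[ d ] (d ≤ k × P d × (∀ j → P j → d ≤ j))
least {P} P? {k} Pk = search k 0 (+-identityʳ k) (λ _ ())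
  where
  search : ∀ fuel i → fuel + i ≡ k → (∀ j → j < i → ¬ P j) → ∃[ d ] (d ≤ k × P d × (∀ j → P j → d ≤ j))
  search fuel i eq below with P? i
  ... | yes Pi = i , ≤-trans (m≤n+m i fuel) (≤-reflexive eq) , Pi , λ j Pj → ≮⇒≥ λ j<i → below j j<i Pj
  search zero       i refl below | no ¬Pi = contradiction Pk ¬Pi
  search (suc fuel) i eq   below | no ¬Pi = search fuel (suc i) (trans (+-suc fuel i) eq)
    λ j j< → case m≤n⇒m<n∨m≡n (≤-pred j<) of λ where
      (inj₁ j<i)  → below j j<i
      (inj₂ refl) → ¬Pi

module Walks {n m : ℕ} (G : Graph n m) where
  open Graph G

  module _ {F : Subset m} where

    steps : ∀ {u v} → Walk G F u v → ℕ
    steps = length G unitLength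

    vertices-length : ∀ {u v} (p : Walk G F u v) → List.length (vertices G p) ≡ suc (steps p)
    vertices-length nil            = refl
    vertices-length (cons _ _ _ p) = cong suc (vertices-length p)

    path-short : ∀ {u v} (p : Walk G F u v) → IsPath G p → steps p < n
    path-short p path = ≤-trans (≤-reflexive (sym (vertices-length p)))
      (≤-trans (length-⊆ path (λ {x} _ → ∈ₚ.∈-allFin x)) (≤-reflexive (Listₚ.length-tabulate id)))

    Shortcut : ∀ u v → ℕ → Set
    Shortcut u v k = Σ[ p ∈ Walk G F u v ] (IsPath G p × steps p ≤ k)

    suffix : ∀ {u x v} (p : Walk G F x v) → IsPath G p → u ∈ vertices G p → Shortcut u v (steps p)
    suffix nil              path       (here refl) = nil , path , ≤-refl
    suffix q@(cons _ _ _ p) path       (here refl) = q , path , ≤-refl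
    suffix (cons _ _ _ p)   (_ ∷ path) (there u∈)  =
      let (q , path′ , le) = suffix p path u∈ in q , path′ , m≤n⇒m≤1+n le

    -- If the first vertex recurs, the path starts at the later occurrence, cutting out a closed
    -- walk.
    shortcut : ∀ {u v} (p : Walk G F u v) → Shortcut u v (steps p)
    shortcut nil = nil , [] ∷ [] , z≤n
    shortcut {u} (cons e e∈ joins p) with shortcut p
    ... | q , path , le with member? Finₚ._≟_ u (vertices G q)
    ...   | yes u∈ = let (q′ , path′ , le′) = suffix q path u∈ in q′ , path′ , ≤-trans le′ (m≤n⇒m≤1+n le)
    ...   | no u∉  = cons e e∈ joins q , All.tabulate (λ x∈ → λ { refl → u∉ x∈ }) ∷ path , s≤s le

    Steps : ℕ → Fin n → Fin n → Set
    Steps k u v = Σ[ p ∈ Walk G F u v ] steps p ≡ k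

    steps? : ∀ k u v → Dec (Steps k u v)
    steps? zero u v = map′ (λ { refl → nil , refl }) (λ { (nil , _) → refl }) (u Finₚ.≟ v)
    steps? (suc k) u v = map′ to from
      (Finₚ.any? λ e → (e Subsetₚ.∈? F) ×-dec (Finₚ.any? λ x → joins? e u x ×-dec steps? k x v))
      where
      open import Relation.Nullary.Decidable using (_⊎-dec_)
      joins? : ∀ e u x → Dec (Joins e u x)
      joins? e u x = ((src e Finₚ.≟ u) ×-dec (tgt e Finₚ.≟ x)) ⊎-dec ((src e Finₚ.≟ x) ×-dec (tgt e Finₚ.≟ u))
      to : ∃[ e ] (e Subset.∈ F × ∃[ x ] (Joins e u x × Steps k x v)) → Steps (suc k) u v
      to (e , e∈ , x , joins , p , eq) = cons e e∈ joins p , cong suc eq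
      from : Steps (suc k) u v → ∃[ e ] (e Subset.∈ F × ∃[ x ] (Joins e u x × Steps k x v))
      from (cons e e∈ joins p , eq) = e , e∈ , _ , joins , p , suc-injective eq

    -- Having a walk of given length is decidable, so there is a least length; cutting out closed
    -- walks cannot undercut it, so a path attains it.
    distance : ∀ {u v} (p : Walk G F u v) → ∃[ d ] (IsDistance G unitLength F u v d × d ≤ steps p)
    distance {u} {v} p with least (λ k → steps? k u v) {steps p} (p , refl)
    ... | d , d≤ , (q , refl) , minimal with shortcut q
    ...   | q′ , path , le = d , ((q′ , path , ≤-antisym le (minimal _ (q′ , refl))) , (λ r _ → minimal _ (r , refl))) , d≤

  edge-distance : ∀ e → IsDistance G unitLength ⊤ (src e) (tgt e) 1
  edge-distance e = (cons e Subsetₚ.∈⊤ (inj₁ (refl , refl)) nil , (loopless e ∷ []) ∷ [] ∷ [] , refl) , at-least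
    where
    at-least : ∀ (p : Walk G ⊤ (src e) (tgt e)) → IsPath G p → 1 ≤ length G unitLength p
    at-least p _ = positive p refl
      where
      positive : ∀ {v} (p : Walk G ⊤ (src e) v) → v ≡ tgt e → 1 ≤ length G unitLength p
      positive nil            eq = contradiction eq (loopless e)
      positive (cons _ _ _ _) _  = s≤s z≤n

  module Translation (s t : ℕ → ℕ) (s≡ : ∀ e → s (toℕ e) ≡ toℕ (src e)) (t≡ : ∀ e → t (toℕ e) ≡ toℕ (tgt e)) where
    open Graphs m s t

    joins⇒ends : ∀ {e u v} → Joins e u v → Ends (toℕ e) (toℕ u) (toℕ v)
    joins⇒ends {e} = Sum.map (λ (p , q) → trans (s≡ e) (cong toℕ p) , trans (t≡ e) (cong toℕ q))
                             (λ (p , q) → trans (s≡ e) (cong toℕ p) , trans (t≡ e) (cong toℕ q))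

    ends⇒joins : ∀ {e u v} → Ends (toℕ e) (toℕ u) (toℕ v) → Joins e u v
    ends⇒joins {e} = Sum.map
      (λ (p , q) → Finₚ.toℕ-injective (trans (sym (s≡ e)) p) , Finₚ.toℕ-injective (trans (sym (t≡ e)) q))
      (λ (p , q) → Finₚ.toℕ-injective (trans (sym (s≡ e)) p) , Finₚ.toℕ-injective (trans (sym (t≡ e)) q))

    walk⇒trail : ∀ {F P u v} → (∀ {e} → e Subset.∈ F → P (toℕ e)) → (p : Walk G F u v) → Trail P (steps p) (toℕ u) (toℕ v)
    walk⇒trail f nil = stop
    walk⇒trail f (cons e e∈ joins p) = move (toℕ e) (Finₚ.toℕ<n e) (f e∈) (joins⇒ends joins) (walk⇒trail f p)

    edge-index : ∀ {e} → e < m → ∃[ f ] toℕ f ≡ e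
    edge-index e< = fromℕ< e< , Finₚ.toℕ-fromℕ< e<

    ends-target : ∀ {e x y} → e < m → Ends e x y → ∃[ v ] toℕ {n} v ≡ y
    ends-target e< ends with edge-index e<
    ends-target e< (inj₁ (_ , refl)) | f , refl = tgt f , sym (t≡ f)
    ends-target e< (inj₂ (refl , _)) | f , refl = src f , sym (s≡ f)

    trail⇒walk : ∀ {F P k x y} → (∀ {e} → P (toℕ e) → e Subset.∈ F) → Trail P k x y → ∀ {u v} → toℕ u ≡ x → toℕ v ≡ y →
      Σ[ p ∈ Walk G F u v ] steps p ≡ k
    trail⇒walk f stop u≡ v≡ with Finₚ.toℕ-injective (trans u≡ (sym v≡))
    ... | refl = nil , refl
    trail⇒walk f (move e e< Pe ends p) refl v≡ with ends-target e< ends | edge-index e<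
    ... | z , refl | e′ , refl = let (q , eq) = trail⇒walk f p refl v≡ in
      cons e′ (f Pe) (ends⇒joins ends) q , cong suc eq

    src<n′ : ∀ e → e < m → s e < n
    src<n′ e e< with edge-index e<
    ... | f , refl = subst (_< n) (sym (s≡ f)) (Finₚ.toℕ<n (src f))

    tgt<n′ : ∀ e → e < m → t e < n
    tgt<n′ e e< with edge-index e<
    ... | f , refl = subst (_< n) (sym (t≡ f)) (Finₚ.toℕ<n (tgt f))

    loopless′ : ∀ e → e < m → s e ≢ t e
    loopless′ e e< eq with edge-index e<
    ... | f , refl = loopless f (Finₚ.toℕ-injective (trans (sym (s≡ f)) (trans eq (t≡ f))))

    parallel′ : ∀ {e f x y} → e < m → f < m → Ends e x y → Ends f x y → e ≡ f
    parallel′ e< f< p q with edge-index e< | edge-index f<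
    ... | e , refl | f , refl = cong toℕ (noParallel (ends⇒joins (same p q)))
      where
      same : ∀ {x y} → Ends (toℕ e) x y → Ends (toℕ f) x y → Ends (toℕ e) (toℕ (src f)) (toℕ (tgt f))
      same (inj₁ (a , b)) (inj₁ (c , d)) = inj₁ (trans a (trans (sym c) (s≡ f)) , trans b (trans (sym d) (t≡ f)))
      same (inj₁ (a , b)) (inj₂ (c , d)) = inj₂ (trans a (trans (sym d) (t≡ f)) , trans b (trans (sym c) (s≡ f)))
      same (inj₂ (a , b)) (inj₁ (c , d)) = inj₂ (trans a (trans (sym d) (t≡ f)) , trans b (trans (sym c) (s≡ f)))
      same (inj₂ (a , b)) (inj₂ (c , d)) = inj₁ (trans a (trans (sym c) (s≡ f)) , trans b (trans (sym d) (t≡ f)))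

    connected′ : Connected G → ∀ x y → x < n → y < n → ∃[ k ] Trail (λ _ → 0 ≡ 0) k x y
    connected′ conn x y x<n y<n = _ , subst₂ (Trail _ _) (Finₚ.toℕ-fromℕ< x<n) (Finₚ.toℕ-fromℕ< y<n)
      (walk⇒trail (λ _ → refl) (proj₁ (conn (fromℕ< x<n) (fromℕ< y<n))))

    -- Each edge is replaced by its bridge, which is why bounding the stretch of single edges
    -- suffices.
    bridge-trail : ∀ {P Q a k x y} → (∀ {e} → e < m → Bridged P a e) → Trail Q k x y → ∃[ j ] (j ≤ k * a × Trail P j x y)
    bridge-trail br stop = 0 , z≤n , stop
    bridge-trail br (move e e< _ ends p) with bridge-trail br p | br e<
    bridge-trail br (move e e< _ (inj₁ (refl , refl)) p) | j , j≤ , q | i , i≤ , b = i + j , +-mono-≤ i≤ j≤ , trail-++ b q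
    bridge-trail br (move e e< _ (inj₂ (refl , refl)) p) | j , j≤ , q | i , i≤ , b = i + j , +-mono-≤ i≤ j≤ , trail-++ (trail-reverse b) q

  -- Every vertex is an end of some edge.
  vertices≤ends : Connected G → 0 < m → n ≤ m + m
  vertices≤ends conn 0<m = begin
    n                             ≡⟨ Listₚ.length-tabulate id ⟨
    List.length (List.allFin n)   ≤⟨ length-⊆ (Uniqueₚ.allFin⁺ n) (λ {x} _ → is-end x) ⟩
    List.length (map src (List.allFin m) ++ map tgt (List.allFin m)) ≡⟨ Listₚ.length-++ (map src (List.allFin m)) ⟩
    List.length (map src (List.allFin m)) + List.length (map tgt (List.allFin m))
      ≡⟨ cong₂ _+_ (length-ends src) (length-ends tgt) ⟩
    m + m                         ∎
    where
    open ≤-Reasoning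
    length-ends : ∀ (f : Fin m → Fin n) → List.length (map f (List.allFin m)) ≡ m
    length-ends f = trans (Listₚ.length-map f (List.allFin m)) (Listₚ.length-tabulate id)
    e₀ : Fin m
    e₀ = fromℕ< 0<m
    first-edge : ∀ {u v} → u ≢ v → Walk G ⊤ u v → u ∈ map src (List.allFin m) ++ map tgt (List.allFin m)
    first-edge u≢v nil = contradiction refl u≢v
    first-edge u≢v (cons e _ (inj₁ (refl , _)) _) = ∈ₚ.∈-++⁺ˡ (∈ₚ.∈-map⁺ src (∈ₚ.∈-allFin e))
    first-edge u≢v (cons e _ (inj₂ (_ , refl)) _) = ∈ₚ.∈-++⁺ʳ (map src (List.allFin m)) (∈ₚ.∈-map⁺ tgt (∈ₚ.∈-allFin e))
    is-end : ∀ u → u ∈ map src (List.allFin m) ++ map tgt (List.allFin m)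
    is-end u with u Finₚ.≟ src e₀
    ... | yes refl = first-edge (loopless e₀) (proj₁ (conn (src e₀) (tgt e₀)))
    ... | no u≢s   = first-edge u≢s (proj₁ (conn u (src e₀)))

-- Spanners as functions flagging the removed edges

module Solutions (I : Instance) (s t wt : ℕ → ℕ) (A : ℕ)
  (s≡ : ∀ e → s (toℕ e) ≡ toℕ (Graph.src (Instance.G I) e))
  (t≡ : ∀ e → t (toℕ e) ≡ toℕ (Graph.tgt (Instance.G I) e))
  (wt≡ : ∀ e → wt (toℕ e) ≡ Instance.w I e)
  (stretch≤ : A * ℚ.↧ₙ (Instance.α I) ≤ ℤ.∣ ℚ.↥ (Instance.α I) ∣)
  (stretch≥ : A ≡ Instance.n I ⊎ ℤ.∣ ℚ.↥ (Instance.α I) ∣ < suc A * ℚ.↧ₙ (Instance.α I)) where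
  open Instance I
  open Graph G
  open Walks G
  open Translation s t s≡ t≡
  open Graphs m s t
  open WeightedSums m wt

  Valid : (ℕ → ℕ) → Set
  Valid r = W̄ ≤ flaggedWeight r × (∀ e → e < m → 0 < r e → Bridged (λ f → r f ≡ 0) A e)

  0≤α : 0ℚ ℚ.≤ α
  0≤α = ℚₚ.≤-trans (fromℕ-mono-≤ {0} {1} z≤n) 1≤α

  -- Distances are integers below n, so neither rounding α down nor capping it at n loses a
  -- solution.
  fits : ∀ {d} → d < n → fromℕ d ℚ.≤ α → d ≤ A
  fits {d} d<n d≤α = Sum.[ (λ A≡n → ≤-trans (<⇒≤ d<n) (≤-reflexive (sym A≡n)))
    , (λ lt → ≤-pred (*-cancelʳ-< (ℚ.↧ₙ α) d (suc A) (≤-<-trans (fromℕ≤⁻ {d} d≤α) lt))) ]′ stretch≥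

  1≤A : 0 < n → 1 ≤ A
  1≤A 0<n = Sum.[ (λ A≡n → ≤-trans 0<n (≤-reflexive (sym A≡n)))
    , (λ lt → ≤-pred (*-cancelʳ-< (ℚ.↧ₙ α) 1 (suc A) (≤-<-trans (fromℕ≤⁻ {1} 1≤α) lt))) ]′ stretch≥

  removed : Subset m → ℕ → ℕ
  removed F e with e <? m
  ... | no _   = 0
  ... | yes e< = if does (fromℕ< e< Subsetₚ.∈? F) then 0 else 1

  removed-in : ∀ {F e} → e Subset.∈ F → removed F (toℕ e) ≡ 0
  removed-in {F} {e} e∈ with toℕ e <? m
  ... | no _   = refl
  ... | yes e< rewrite Finₚ.fromℕ<-toℕ e e< | dec-true (e Subsetₚ.∈? F) e∈ = refl

  removed-out : ∀ {F e} → e Subset.∉ F → 0 < removed F (toℕ e)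
  removed-out {F} {e} e∉ with toℕ e <? m
  ... | no e≮  = contradiction (Finₚ.toℕ<n e) e≮
  ... | yes e< rewrite Finₚ.fromℕ<-toℕ e e< | dec-false (e Subsetₚ.∈? F) e∉ = z<s

  sum-edges : ∀ es → sum (map w es) ≡ sum (map wt (map toℕ es))
  sum-edges []       = refl
  sum-edges (e ∷ es) = cong₂ _+_ (sym (wt≡ e)) (sum-edges es)

  selected : Subset m → List (Fin m)
  selected X = filter (Subsetₚ._∈? X) (List.allFin m)

  selected-unique : ∀ X → Unique (map toℕ (selected X))
  selected-unique X = Uniqueₚ.map⁺ Finₚ.toℕ-injective (Uniqueₚ.filter⁺ (Subsetₚ._∈? X) (Uniqueₚ.allFin⁺ m))

  solution⇒valid : ∀ {F} → IsSolution I F → Valid (removed F)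
  solution⇒valid {F} (spanner , weight≥) =
    ≤-trans weight≥ (≤-trans (≤-reflexive (sum-edges (selected (∁ F)))) (sum-⊆ wt (selected-unique (∁ F)) selected⊆)) ,
    bridged
    where
    selected⊆ : map toℕ (selected (∁ F)) ⊆ flagged (removed F)
    selected⊆ e∈ with ∈ₚ.∈-map⁻ toℕ e∈
    ... | e , e∈′ , refl = ∈-flagged⁺ (Finₚ.toℕ<n e)
      (removed-out (Subsetₚ.x∈∁p⇒x∉p (proj₂ (∈ₚ.∈-filter⁻ (Subsetₚ._∈? ∁ F) {xs = List.allFin m} e∈′))))
    bridged : ∀ e → e < m → 0 < removed F e → Bridged (λ f → removed F f ≡ 0) A e
    bridged e e< _ with edge-index e<
    ... | f , refl with spanner (src f) (tgt f) 1 (edge-distance f)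
    ...   | d , ((p , path , refl) , _) , d≤α =
      steps p , fits (path-short p path) (subst (fromℕ (steps p) ℚ.≤_) (ℚₚ.*-identityʳ α) d≤α) ,
      subst₂ (Trail _ (steps p)) (sym (s≡ f)) (sym (t≡ f)) (walk⇒trail removed-in p)

  retained : (ℕ → ℕ) → Subset m
  retained r = Vec.tabulate (λ e → r (toℕ e) ≡ᵇ 0)

  retained-in : ∀ {r e} → r (toℕ e) ≡ 0 → e Subset.∈ retained r
  retained-in {r} {e} eq = Vecₚ.lookup⇒[]= e (retained r) (trans (Vecₚ.lookup∘tabulate _ e) (cong (_≡ᵇ 0) eq))

  retained-out : ∀ {r e} → 0 < r (toℕ e) → e Subset.∉ retained r
  retained-out {r} {e} r>0 e∈ with r (toℕ e) | r>0 | trans (sym (Vecₚ.lookup∘tabulate (λ e → r (toℕ e) ≡ᵇ 0) e)) (Vecₚ.[]=⇒lookup e∈)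
  ... | suc _ | _ | ()

  valid⇒solution : ∀ {r} → Valid r → IsSolution I (retained r)
  valid⇒solution {r} (weight≥ , bridged) = spanner ,
    ≤-trans weight≥ (≤-trans (sum-⊆ wt (flagged-unique r) flagged⊆) (≤-reflexive (sym (sum-edges (selected (∁ (retained r)))))))
    where
    flagged⊆ : flagged r ⊆ map toℕ (selected (∁ (retained r)))
    flagged⊆ e∈ with ∈-flagged⁻ {r} e∈
    ... | e< , r>0 with edge-index e<
    ...   | f , refl = ∈ₚ.∈-map⁺ toℕ (∈ₚ.∈-filter⁺ (Subsetₚ._∈? ∁ (retained r)) (∈ₚ.∈-allFin f)
      (Subsetₚ.x∉p⇒x∈∁p (retained-out {r} r>0)))
    -- A retained edge is its own bridge; its length 1 is within the stretch because 1 ≤ α and 0 <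
    -- n.
    all-bridged : 0 < n → ∀ {e} → e < m → Bridged (λ f → r f ≡ 0) A e
    all-bridged 0<n {e} e< with r e ≟ 0
    ... | yes r≡0 = 1 , 1≤A 0<n , move e e< r≡0 (inj₁ (refl , refl)) stop
    ... | no r≢0  = bridged e e< (n≢0⇒n>0 r≢0)
    spanner : IsSpanner G unitLength α (retained r)
    spanner u v d ((p , path , refl) , _) with bridge-trail (all-bridged (≤-<-trans z≤n (Finₚ.toℕ<n u))) (walk⇒trail {P = λ _ → 0 ≡ 0} (λ _ → refl) p)
    ... | j , j≤ , q with trail⇒walk {F = retained r} (retained-in {r}) q refl refl
    ...   | q′ , refl with distance q′
    ...     | d′ , dist , d′≤ = d′ , dist , (begin
      fromℕ d′                  ≤⟨ fromℕ-mono-≤ {d′} {A * steps p} (≤-trans d′≤ (≤-trans j≤ (≤-reflexive (*-comm (steps p) A)))) ⟩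
      fromℕ (A * steps p)       ≡⟨ fromℕ-* A (steps p) ⟩
      fromℕ A ℚ.* fromℕ (steps p) ≤⟨ ℚₚ.*-monoʳ-≤-nonNeg (fromℕ (steps p)) {{ℚ.nonNegative (fromℕ≥0 (steps p))}} (fromℕ≤⁺ {A} 0≤α stretch≤) ⟩
      α ℚ.* fromℕ (steps p)     ∎)
      where open ℚₚ.≤-Reasoning

  retained-output : ∀ {r} e → r (toℕ e) ≤ 1 → 1 ∸ r (toℕ e) ≡ (if lookup (retained r) e then 1 else 0)
  retained-output {r} e ≤1 rewrite Vecₚ.lookup∘tabulate (λ e → r (toℕ e) ≡ᵇ 0) e with r (toℕ e) | ≤1
  ... | zero  | _       = refl
  ... | suc _ | s≤s z≤n = refl

-- Time bounds

loopFree : Cmd → Bool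
loopFree (c ﹔ d)                = if loopFree c then loopFree d else false
loopFree (when _ then c else d) = if loopFree c then loopFree d else false
loopFree (for _ _)              = false
loopFree (call c)               = loopFree c
loopFree _                      = true

-- No command within c is executed more than b times, not counting the
-- final tests of the loops.
data Within (π : ℕ → ℕ) : Cmd → ℕ → Set where
  simple : ∀ {c b} → loopFree c ≡ true → 0 < b → Within π c b
  _then_ : ∀ {c d b} → Within π c b → Within π d b → Within π (c ﹔ d) b
  branch : ∀ {t c d b} → Within π c b → Within π d b → Within π (when t then c else d) b
  loop   : ∀ {x c b b′} → Within π c b → suc (π x) * b ≤ b′ → Within π (for x c) b′
  called : ∀ {c b} → Within π c b → Within π (call c) b

infixr 1 _then_

within>0 : ∀ {π c b} → Within π c b → 0 < b
within>0 (simple _ 0<b) = 0<b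
within>0 (p then _)     = within>0 p
within>0 (branch p _)   = within>0 p
within>0 (loop p le)    = ≤-trans (≤-trans (within>0 p) (m≤m+n _ _)) le
within>0 (called p)     = within>0 p

-- Opaque, lest products with these numerals be unfolded.
opaque
  size : Cmd → ℕ
  size pass                   = 1
  size (x ≔ e)                = expTime e + 2
  size (put k i e)            = expTime i + (7 + (expTime e + 1))
  size (out i e)              = expTime i + (expTime e + 3)
  size (c ﹔ d)                = size c + size d
  size (when b then c else d) = testTime b + (size c + size d)
  size (for x c)              = 6 + size c
  size (call c)               = size c

  loopFree-time : ∀ π c → loopFree c ≡ true → time π c ≤ size c
  loopFree-time π pass        _  = ≤-refl
  loopFree-time π (x ≔ e)     _  = ≤-refl
  loopFree-time π (put k i e) _  = ≤-refl
  loopFree-time π (out i e)   _  = ≤-refl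
  loopFree-time π (c ﹔ d)     eq with loopFree c in p
  ... | true  = +-mono-≤ (loopFree-time π c p) (loopFree-time π d eq)
  loopFree-time π (when b then c else d) eq with loopFree c in p
  ... | true  = +-monoʳ-≤ (testTime b) (⊔-lub
    (≤-trans (loopFree-time π c p) (m≤m+n (size c) (size d)))
    (≤-trans (loopFree-time π d eq) (m≤n+m (size d) (size c))))
  loopFree-time π (call c)    eq = loopFree-time π c eq

  -- Each command costs a constant per execution, collected in `size`, and is executed at most `b`
  -- times; the summand 6 for a loop covers its entry, tests and counter.
  time≤ : ∀ {π c b} → Within π c b → time π c ≤ size c * b
  time≤ {π} {c} {b} (simple free 0<b) = ≤-trans (loopFree-time π c free) (m≤m*n (size c) b {{>-nonZero 0<b}})
  time≤ {π} {c ﹔ d} {b} (p then q) =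
    ≤-trans (+-mono-≤ (time≤ p) (time≤ q)) (≤-reflexive (sym (*-distribʳ-+ b (size c) (size d))))
  time≤ {π} {when t then c else d} {b} (branch p q) = begin
    testTime t + (time π c ⊔ time π d)          ≤⟨ +-monoʳ-≤ (testTime t) (m⊔n≤m+n (time π c) (time π d)) ⟩
    testTime t + (time π c + time π d)          ≤⟨ +-mono-≤ (m≤m*n (testTime t) b {{>-nonZero (within>0 p)}}) (+-mono-≤ (time≤ p) (time≤ q)) ⟩
    testTime t * b + (size c * b + size d * b)  ≡⟨ cong (testTime t * b +_) (*-distribʳ-+ b (size c) (size d)) ⟨
    testTime t * b + (size c + size d) * b      ≡⟨ *-distribʳ-+ b (testTime t) _ ⟨
    (testTime t + (size c + size d)) * b        ∎
    where open ≤-Reasoning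
  time≤ {π} {for x c} {b′} (loop {b = b} p le) = begin
    3 + π x * (3 + time π c)                        ≤⟨ +-monoʳ-≤ 3 (*-monoʳ-≤ (π x) (+-mono-≤ (m≤m*n 3 b {{b≢0}}) (time≤ p))) ⟩
    3 + π x * (3 * b + size c * b)                  ≤⟨ +-monoˡ-≤ _ (m≤m*n 3 b {{b≢0}}) ⟩
    3 * b + π x * (3 * b + size c * b)              ≤⟨ +-monoˡ-≤ _ (m≤m+n (3 * b) _) ⟩
    (3 * b + (3 * b + size c * b + π x * (3 * b))) + π x * (3 * b + size c * b) ≡⟨ rearrange b (π x) (size c) ⟩
    (6 + size c) * (suc (π x) * b)                  ≤⟨ *-monoʳ-≤ (6 + size c) le ⟩
    (6 + size c) * b′                               ∎
    where
    open ≤-Reasoning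
    b≢0 : NonZero b
    b≢0 = >-nonZero (within>0 p)
    rearrange : ∀ r p s → (3 * r + (3 * r + s * r + p * (3 * r))) + p * (3 * r + s * r) ≡ (6 + s) * (suc p * r)
    rearrange = solve-∀
  time≤ (called p) = time≤ p

-- Either 4 ≤ w, or the left side is at most 4 ^ 4 = 256, the origin of the constant.
4^w≤ : ∀ w → 4 ^ w ≤ 256 * w ^ w
4^w≤ zero      = s≤s z≤n
4^w≤ w@(suc _) with 4 ≤? w
... | yes 4≤w = ≤-trans (^-monoˡ-≤ w 4≤w) (m≤n*m (w ^ w) 256)
... | no  4≰w = ≤-trans (^-monoʳ-≤ 4 (<⇒≤ (≰⇒> 4≰w))) (m≤m*n 256 (w ^ w) {{m^n≢0 w w}})

-- There are at most 4 a w choices, and 4 ^ w is absorbed by w ^ w.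
trials-bound : ∀ w a → 0 < a → suc (w * suc (a + a)) ^ w ≤ 256 * (w ^ (2 * w) * a ^ (2 * w))
trials-bound zero          a 0<a = s≤s z≤n
trials-bound w@(suc w-1) a 0<a = begin
  suc (w * suc (a + a)) ^ w           ≤⟨ ^-monoˡ-≤ w base ⟩
  (4 * (w * a)) ^ w                   ≡⟨ ^-distrib 4 (w * a) w ⟩
  4 ^ w * (w * a) ^ w                 ≤⟨ *-monoˡ-≤ ((w * a) ^ w) (4^w≤ w) ⟩
  256 * w ^ w * (w * a) ^ w           ≡⟨ cong (256 * w ^ w *_) (^-distrib w a w) ⟩
  256 * w ^ w * (w ^ w * a ^ w)       ≡⟨ rearrange (w ^ w) (a ^ w) ⟩
  256 * (w ^ w * w ^ w * a ^ w)       ≡⟨ cong (λ z → 256 * (z * a ^ w)) (sym (trans (cong (w ^_) two-w) (^-distribˡ-+-* w w w))) ⟩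
  256 * (w ^ (2 * w) * a ^ w)         ≤⟨ *-monoʳ-≤ 256 (*-monoʳ-≤ (w ^ (2 * w)) (^-monoʳ-≤ a {{>-nonZero 0<a}} (m≤m+n w _))) ⟩
  256 * (w ^ (2 * w) * a ^ (2 * w))   ∎
  where
  open ≤-Reasoning
  ^-distrib : ∀ x y k → (x * y) ^ k ≡ x ^ k * y ^ k
  ^-distrib x y zero    = refl
  ^-distrib x y (suc k) = trans (cong (x * y *_) (^-distrib x y k)) ([m*n]*[o*p]≡[m*o]*[n*p] x y (x ^ k) (y ^ k))
  two-w : 2 * w ≡ w + w
  two-w = cong (w +_) (+-identityʳ w)
  rearrange : ∀ x y → 256 * x * (x * y) ≡ 256 * (x * x * y)
  rearrange = solve-∀
  base : suc (w * suc (a + a)) ≤ 4 * (w * a)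
  base = begin
    suc (w * suc (a + a))             ≤⟨ +-mono-≤ (*-mono-≤ (s≤s (z≤n {w-1})) 0<a) (*-monoʳ-≤ w (+-monoˡ-≤ (a + a) 0<a)) ⟩
    w * a + w * (a + (a + a))         ≡⟨ four w a ⟩
    4 * (w * a)                       ∎
    where
    four : ∀ w a → w * a + w * (a + (a + a)) ≡ 4 * (w * a)
    four = solve-∀

-- The bound of the theorem with an integer stretch `a` in place of α.
work : ℕ → ℕ → ℕ → ℕ → ℕ
work n m w a = w ^ (2 * w + 1) * a ^ (2 * w) * m + n * m

module WorkBound {n m w a : ℕ} (0<m : 0 < m) (0<n : 0 < n) (n≤2m : n ≤ m + m) (0<a : 0 < a) where

  trials : ℕ
  trials = suc (w * suc (a + a)) ^ w

  -- The time up to a constant: one linear search per vertex for the candidates, and W + 1 times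
  -- linear work per trial.
  raw : ℕ
  raw = n * m + suc w * trials * m

  -- For w > 0, w + 1 ≤ 2w and 512 = 2 * 256. For w = 0 the first summand of `work` vanishes, and nm
  -- must also pay for the single trial.
  raw≤work : raw ≤ 512 * work n m w a
  raw≤work = absorb w
    where
    open ≤-Reasoning
    absorb : ∀ w → n * m + suc w * suc (w * suc (a + a)) ^ w * m ≤ 512 * work n m w a
    absorb zero = begin
      n * m + 1 * m             ≤⟨ +-monoʳ-≤ (n * m) (*-monoˡ-≤ m 0<n) ⟩
      n * m + n * m             ≤⟨ +-mono-≤ (m≤m+n (n * m) 0) ≤-refl ⟩
      n * m + 0 + n * m         ≡⟨ twice (n * m) ⟩
      2 * (n * m)               ≤⟨ *-monoˡ-≤ (n * m) (m≤m+n 2 510) ⟩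
      512 * (n * m)             ∎
      where
      twice : ∀ x → x + 0 + x ≡ 2 * x
      twice = solve-∀
    absorb w@(suc _) = begin
      n * m + suc w * suc (w * suc (a + a)) ^ w * m
        ≤⟨ +-monoʳ-≤ (n * m) (*-monoˡ-≤ m (*-mono-≤ (+-monoˡ-≤ w (s≤s (z≤n {pred w}))) (trials-bound w a 0<a))) ⟩
      n * m + (w + w) * (256 * (w ^ (2 * w) * a ^ (2 * w))) * m ≡⟨ rearrange (n * m) w (w ^ (2 * w)) (a ^ (2 * w)) m ⟩
      n * m + 512 * (w ^ (2 * w) * w * a ^ (2 * w) * m) ≡⟨ cong (λ z → n * m + 512 * (z * a ^ (2 * w) * m)) (sym power) ⟩
      n * m + 512 * (w ^ (2 * w + 1) * a ^ (2 * w) * m) ≤⟨ +-monoˡ-≤ _ (m≤n*m (n * m) 512) ⟩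
      512 * (n * m) + 512 * (w ^ (2 * w + 1) * a ^ (2 * w) * m) ≡⟨ collect-terms (n * m) (w ^ (2 * w + 1) * a ^ (2 * w) * m) ⟩
      512 * work n m w a ∎
      where
      rearrange : ∀ x w p q m → x + (w + w) * (256 * (p * q)) * m ≡ x + 512 * (p * w * q * m)
      rearrange = solve-∀
      collect-terms : ∀ x y → 512 * x + 512 * y ≡ 512 * (y + x)
      collect-terms = solve-∀
      power : w ^ (2 * w + 1) ≡ w ^ (2 * w) * w
      power = trans (^-distribˡ-+-* w (2 * w) 1) (cong (w ^ (2 * w) *_) (*-identityʳ w))

  trials>0 : 0 < trials
  trials>0 = n≢0⇒n>0 (≢-nonZero⁻¹ _ {{m^n≢0 (suc (w * suc (a + a))) w}})

  choices≤trials : suc (w * suc (a + a)) ≤ trials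
  choices≤trials = power w
    where
    power : ∀ w → suc (w * suc (a + a)) ≤ suc (w * suc (a + a)) ^ w
    power zero    = ≤-refl
    power (suc w) = m≤m*n _ _ {{m^n≢0 (suc (suc w * suc (a + a))) w}}

  right : ∀ {x y} → x ≤ y * suc w * trials * m → x ≤ y * raw
  right {x} {y} x≤ = ≤-trans x≤ (≤-trans (≤-reflexive (assoc₄ y (suc w) trials m)) (*-monoʳ-≤ y (m≤n+m _ (n * m))))
    where
    assoc₄ : ∀ y w t m → y * w * t * m ≡ y * (w * t * m)
    assoc₄ = solve-∀

  left : ∀ {x y} → x ≤ y * n * m → x ≤ y * raw
  left {x} {y} x≤ = ≤-trans x≤ (≤-trans (≤-reflexive (*-assoc y n m)) (*-monoʳ-≤ y (m≤m+n (n * m) _)))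

  private
    instance
      m≢0 : NonZero m
      m≢0 = >-nonZero 0<m
      n≢0 : NonZero n
      n≢0 = >-nonZero 0<n
      t≢0 : NonZero trials
      t≢0 = >-nonZero trials>0

  double : ∀ {x} → 0 < x → suc x ≤ 2 * x
  double {x} 0<x = ≤-trans (+-monoˡ-≤ x 0<x) (≤-reflexive (cong (x +_) (sym (+-identityʳ x))))

  1≤raw : 1 ≤ raw
  1≤raw = ≤-trans (*-mono-≤ 0<n 0<m) (m≤m+n (n * m) _)

  -- The constant 14 in this module is 2 * 7: linear passes cost up to 7m, and doubling the count of
  -- the loop around them covers its successor.
  one≤ : 1 ≤ 14 * raw
  one≤ = ≤-trans 1≤raw (m≤n*m raw 14)

  n≤ : suc n * 1 ≤ 14 * raw
  n≤ = left {y = 14} (begin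
    suc n * 1   ≡⟨ *-identityʳ (suc n) ⟩
    suc n       ≤⟨ double 0<n ⟩
    2 * n       ≤⟨ *-monoˡ-≤ n (m≤m+n 2 12) ⟩
    14 * n      ≤⟨ m≤m*n (14 * n) m ⟩
    14 * n * m  ∎)
    where open ≤-Reasoning

  m≤ : suc m * 1 ≤ 14 * raw
  m≤ = left {y = 14} (begin
    suc m * 1   ≡⟨ *-identityʳ (suc m) ⟩
    suc m       ≤⟨ double 0<m ⟩
    2 * m       ≤⟨ *-monoˡ-≤ m (m≤m+n 2 12) ⟩
    14 * m      ≤⟨ *-monoˡ-≤ m (m≤m*n 14 n) ⟩
    14 * n * m  ∎)
    where open ≤-Reasoning

  w≤ : suc w * 1 ≤ 14 * raw
  w≤ = right {y = 14} (begin
    suc w * 1                ≡⟨ *-identityʳ (suc w) ⟩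
    suc w                    ≤⟨ m≤n*m (suc w) 14 ⟩
    14 * suc w               ≤⟨ m≤m*n (14 * suc w) trials ⟩
    14 * suc w * trials      ≤⟨ m≤m*n (14 * suc w * trials) m ⟩
    14 * suc w * trials * m  ∎)
    where open ≤-Reasoning

  k≤ : ∀ x → 0 < x → x ≤ suc w → x * (suc (suc (w * suc (a + a))) * 1) ≤ 14 * raw
  k≤ x 0<x x≤ = right {y = 14} (begin
    x * (suc (suc (w * suc (a + a))) * 1) ≡⟨ cong (x *_) (*-identityʳ _) ⟩
    x * suc (suc (w * suc (a + a)))       ≤⟨ *-mono-≤ x≤ (double z<s) ⟩
    suc w * (2 * suc (w * suc (a + a)))   ≤⟨ *-monoʳ-≤ (suc w) (*-mono-≤ (m≤m+n 2 12) choices≤trials) ⟩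
    suc w * (14 * trials)                 ≡⟨ rearrange (suc w) trials ⟩
    14 * suc w * trials                   ≤⟨ m≤m*n (14 * suc w * trials) m ⟩
    14 * suc w * trials * m               ∎)
    where
    open ≤-Reasoning
    rearrange : ∀ w t → w * (14 * t) ≡ 14 * w * t
    rearrange = solve-∀

  -- 7 * m bounds a breadth-first search and a scan of the vertices or edges.
  linear-1 : 1 ≤ 7 * m
  linear-1 = ≤-trans 0<m (m≤n*m m 7)

  linear-n : suc n * 1 ≤ 7 * m
  linear-n = begin
    suc n * 1   ≡⟨ *-identityʳ (suc n) ⟩
    suc n       ≤⟨ +-mono-≤ 0<m n≤2m ⟩
    m + (m + m) ≡⟨ three m ⟩
    3 * m       ≤⟨ *-monoˡ-≤ m (m≤m+n 3 4) ⟩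
    7 * m       ∎
    where
    open ≤-Reasoning
    three : ∀ m → m + (m + m) ≡ 3 * m
    three = solve-∀

  linear-m : suc m * 1 ≤ 7 * m
  linear-m = ≤-trans (≤-reflexive (*-identityʳ (suc m))) (≤-trans (double 0<m) (*-monoˡ-≤ m (m≤m+n 2 5)))

  -- The longest of the linear loops and the origin of 7: its 3 + 2m + n is at most 3m + 2m + 2m.
  linear-rounds : suc (2 + (m + m + n)) * 1 ≤ 7 * m
  linear-rounds = begin
    suc (2 + (m + m + n)) * 1         ≡⟨ *-identityʳ _ ⟩
    3 + (m + m + n)                   ≤⟨ +-mono-≤ (*-monoʳ-≤ 3 0<m) (+-monoʳ-≤ (m + m) n≤2m) ⟩
    3 * m + (m + m + (m + m))         ≡⟨ seven m ⟩
    7 * m                             ∎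
    where
    open ≤-Reasoning
    seven : ∀ m → 3 * m + (m + m + (m + m)) ≡ 7 * m
    seven = solve-∀

  per-vertex : suc n * (7 * m) ≤ 14 * raw
  per-vertex = left {y = 14} (begin
    suc n * (7 * m)   ≤⟨ *-monoˡ-≤ (7 * m) (double 0<n) ⟩
    2 * n * (7 * m)   ≡⟨ rearrange n m ⟩
    14 * n * m        ∎)
    where
    open ≤-Reasoning
    rearrange : ∀ n m → 2 * n * (7 * m) ≡ 14 * n * m
    rearrange = solve-∀

  per-trial : suc trials * (suc w * (7 * m)) ≤ 14 * raw
  per-trial = right {y = 14} (begin
    suc trials * (suc w * (7 * m))    ≤⟨ *-monoˡ-≤ (suc w * (7 * m)) (double trials>0) ⟩
    2 * trials * (suc w * (7 * m))    ≡⟨ rearrange trials (suc w) m ⟩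
    14 * suc w * trials * m           ∎)
    where
    open ≤-Reasoning
    rearrange : ∀ t w m → 2 * t * (w * (7 * m)) ≡ 14 * w * t * m
    rearrange = solve-∀

  scan : 7 * m ≤ suc w * (7 * m)
  scan = m≤n*m (7 * m) (suc w)

  scan-1 : 0 < suc w * (7 * m)
  scan-1 = ≤-trans linear-1 scan

  scan-m : suc m * 1 ≤ suc w * (7 * m)
  scan-m = ≤-trans linear-m scan

  scan-w : suc w * 1 ≤ suc w * (7 * m)
  scan-w = *-monoʳ-≤ (suc w) linear-1

  parameters-within : ∀ {π} → π NUM ≡ n → π GOAL ≡ w → Within π parametersCmd (14 * raw)
  parameters-within refl refl =
    simple refl one≤ then simple refl one≤ then loop (simple refl z<s) n≤ then
    simple refl one≤ then loop (simple refl z<s) w≤ then simple refl one≤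

  tables-within : ∀ {π} → π SIZE ≡ m → π GOAL ≡ w → π CHOICES ≡ suc (w * suc (a + a)) → Within π tablesCmd (14 * raw)
  tables-within {π} π-m π-w π-k =
    simple refl one≤ then
    loop (simple refl z<s then loop (simple refl z<s) ≤-refl then simple refl z<s)
      (subst₂ (λ x y → suc x * (suc y * 1) ≤ 14 * raw) (sym π-w) (sym π-k) (k≤ (suc w) z<s ≤-refl)) then
    simple refl one≤ then simple refl one≤ then simple refl one≤ then
    loop (simple refl z<s) (subst (λ x → suc x * 1 ≤ 14 * raw) (sym π-m) m≤) then
    simple refl one≤

  module _ {π : ℕ → ℕ} (π-n : π NUM ≡ n) (π-m : π SIZE ≡ m) (π-w : π GOAL ≡ w) (π-k : π CHOICES ≡ suc (w * suc (a + a)))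
    (π-r : π ROUNDS ≡ 2 + (m + m + n)) (π-t : π TRIALS ≡ trials) where

    fill-within : ∀ {k x e b} → suc (π x) * 1 ≤ b → Within π (fill k x e) b
    fill-within le = called (simple refl (≤-trans (s≤s z≤n) le) then loop (simple refl z<s) le)

    loop-n : ∀ {b b′ c} → Within π c b → suc n * b ≤ b′ → Within π (for NUM c) b′
    loop-n {b} {b′} p le = loop p (subst (λ x → suc x * b ≤ b′) (sym π-n) le)

    loop-m : ∀ {b b′ c} → Within π c b → suc m * b ≤ b′ → Within π (for SIZE c) b′
    loop-m {b} {b′} p le = loop p (subst (λ x → suc x * b ≤ b′) (sym π-m) le)

    loop-w : ∀ {b b′ c} → Within π c b → suc w * b ≤ b′ → Within π (for GOAL c) b′
    loop-w {b} {b′} p le = loop p (subst (λ x → suc x * b ≤ b′) (sym π-w) le)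

    bfs-within : Within π bfs (7 * m)
    bfs-within = called
      ( fill-within (subst (λ x → suc x * 1 ≤ 7 * m) (sym π-n) linear-n) then simple refl linear-1 then
        simple refl linear-1 then simple refl linear-1 then simple refl linear-1 then simple refl linear-1 then
        loop (simple refl z<s) (subst (λ x → suc x * 1 ≤ 7 * m) (sym π-r) linear-rounds) )

    candidates-within : Within π candidatesCmd (14 * raw)
    candidates-within = called
      ( fill-within (subst (λ x → suc x * 1 ≤ 14 * raw) (sym π-m) m≤) then
        fill-within (subst (λ x → suc x * 1 ≤ 14 * raw) (sym π-k) (≤-trans (≤-reflexive (sym (*-identityˡ _))) (k≤ 1 z<s (s≤s z≤n)))) then
        simple refl one≤ then simple refl one≤ then
        loop-n
          ( bfs-within then
            fill-within (subst (λ x → suc x * 1 ≤ 7 * m) (sym π-n) linear-n) then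
            called (simple refl linear-1 then loop-m (simple refl z<s) linear-m) then
            called (simple refl linear-1 then loop-m (simple refl z<s) linear-m) then
            simple refl linear-1 )
          per-vertex )

    trial-within : Within π trial (suc w * (7 * m))
    trial-within = called
      ( called ( fill-within (subst (λ x → suc x * 1 ≤ suc w * (7 * m)) (sym π-m) scan-m) then simple refl scan-1 then
                 loop-w (simple refl z<s) scan-w ) then
        called ( simple refl scan-1 then simple refl scan-1 then loop-m (simple refl z<s) scan-m ) then
        called ( simple refl scan-1 then simple refl scan-1 then
                 loop-w (simple refl linear-1 then simple refl linear-1 then bfs-within then simple refl linear-1) ≤-refl ) then
        branch (simple refl scan-1 then called (simple refl scan-1 then loop-m (simple refl z<s) scan-m)) (simple refl scan-1) then
        called (simple refl scan-1 then simple refl scan-1 then loop-w (simple refl z<s) scan-w) )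

    search-within : Within π searchCmd (14 * raw)
    search-within =
      candidates-within then
      called ( simple refl one≤ then fill-within (subst (λ x → suc x * 1 ≤ 14 * raw) (sym π-w) w≤) then
               loop trial-within (subst (λ x → suc x * (suc w * (7 * m)) ≤ 14 * raw) (sym π-t) per-trial) ) then
      branch (simple refl one≤ then simple refl one≤ then loop-m (simple refl z<s) m≤) (simple refl one≤)

-- The layout of the input and the complete program

length-triples : ∀ {X : Set} (f g h : X → ℕ) {k} (x : Fin k → X) →
  List.length (List.concatMap (λ y → f y ∷ g y ∷ h y ∷ []) (List.tabulate x)) ≡ k * 3
length-triples f g h {zero}  x = refl
length-triples f g h {suc k} x = cong (3 +_) (length-triples f g h (x ∘ Fin.suc))

contents-triples : ∀ {X : Set} (f g h : X → ℕ) {k} (x : Fin k → X) e →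
  let xs = List.concatMap (λ y → f y ∷ g y ∷ h y ∷ []) (List.tabulate x) in
  contents xs (toℕ e * 3) ≡ f (x e) × contents xs (1 + toℕ e * 3) ≡ g (x e) × contents xs (2 + toℕ e * 3) ≡ h (x e)
contents-triples f g h x Fin.zero    = refl , refl , refl
contents-triples f g h x (Fin.suc e) = contents-triples f g h (x ∘ Fin.suc) e

contents-beyond : ∀ xs {a} → List.length xs ≤ a → contents xs a ≡ 0
contents-beyond []       _        = refl
contents-beyond (_ ∷ xs) (s≤s le) = contents-beyond xs le

-- Register class 2 holds the parameters of the first stage. The bound is set to 5 + 3m, the length
-- of the input.
boot : Program
boot =
  exec (const (R 0 0) 0) ⨾ exec (load (R 2 NUM) (R 0 0)) ⨾
  exec (const (R 0 0) 1) ⨾ exec (load (R 2 SIZE) (R 0 0)) ⨾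
  exec (const (R 0 0) 2) ⨾ exec (load (R 2 GOAL) (R 0 0)) ⨾
  exec (const (R 3 0) 5) ⨾ exec (add (R 3 0) (R 3 0) (R 2 SIZE)) ⨾
  exec (add (R 3 0) (R 3 0) (R 2 SIZE)) ⨾ exec (add (R 3 0) (R 3 0) (R 2 SIZE))

-- For an instance without edges.
trivialProgram : Program
trivialProgram =
  exec (const (R 0 0) 0) ⨾
  if≢0 (R 2 GOAL) (exec (store (R 0 0) (R 0 0))) (exec (const (R 0 1) 1) ⨾ exec (store (R 0 0) (R 0 1)))

-- The flags alternate, so that each stage reads what the preceding one has written.
solver : Program
solver = boot ⨾ if≢0 (R 2 SIZE)
  (cmdCode true 0 parametersCmd ⨾ cmdCode false 0 tablesCmd ⨾ cmdCode true 0 searchCmd)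
  trivialProgram

record Booted (xs : List ℕ) (σ : State) : Set where
  field
    num≡   : reg σ (R 2 NUM) ≡ contents xs 0
    size≡  : reg σ (R 2 SIZE) ≡ contents xs 1
    goal≡  : reg σ (R 2 GOAL) ≡ contents xs 2
    bound≡ : reg σ (R 3 0) ≡ 5 + contents xs 1 * 3
    mem≡   : ∀ a → mem σ a ≡ contents xs a

opaque
  unfolding R

  -- With `R` unfolded all registers are numerals, and the final state is found by computation.
  boot-correct : ∀ xs → Runs boot (initial xs) 10 (Booted xs)
  boot-correct xs = 10 , _ ,
    ⇓seq ⇓exec (⇓seq ⇓exec (⇓seq ⇓exec (⇓seq ⇓exec (⇓seq ⇓exec (⇓seq ⇓exec
      (⇓seq ⇓exec (⇓seq ⇓exec (⇓seq ⇓exec ⇓exec)))))))) , ≤-refl ,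
    record { num≡ = refl ; size≡ = refl ; goal≡ = refl ; bound≡ = triple (contents xs 1) ; mem≡ = λ _ → refl }
    where
    triple : ∀ x → 5 + x + x + x ≡ 5 + x * 3
    triple = solve-∀

  trivial-correct : ∀ σ → Runs trivialProgram σ 4
    (λ σ′ → (reg σ (R 2 GOAL) ≡ 0 → mem σ′ 0 ≡ 1) × (reg σ (R 2 GOAL) ≢ 0 → mem σ′ 0 ≡ 0))
  trivial-correct σ with reg σ (R 2 GOAL) ≟ 0
  ... | yes eq = 4 , _ , ⇓seq ⇓exec (⇓else eq (⇓seq ⇓exec ⇓exec)) , ≤-refl , (λ _ → refl) , λ ne → contradiction eq ne
  ... | no ne  = 3 , _ , ⇓seq ⇓exec (⇓then ne ⇓exec) , n≤1+n 3 , (λ eq → contradiction eq ne) , λ _ → refl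

-- Nothing has to be initialised: the store and the tables are read off from the machine state.
booted-simulates : ∀ {xs σ} → Booted xs σ → let β = 5 + contents xs 1 * 3 in
  Simulates true (env (λ x → reg σ (R 2 x)) (λ k a → contents xs (address β false k a)) β) σ
    ⟪ (λ x → reg σ (R 1 x)) , (λ k a → contents xs (address β true k a)) , contents xs ⟫
booted-simulates b = record
  { vars≈ = λ _ → refl ; params≈ = λ _ → refl ; bound≈ = Booted.bound≡ b
  ; arrs≈ = λ _ _ → Booted.mem≡ b _ ; tables≈ = λ _ _ → Booted.mem≡ b _ ; cells≈ = λ _ _ → Booted.mem≡ b _ }

run-cmd : ∀ {f η σ s} c {Q : Store → Set} → Simulates f η σ s → Semantics.wp η c Q s →
  Runs (cmdCode f 0 c) σ (time (params η) c)
    (λ σ′ → ∃[ s′ ] (Simulates f η σ′ s′ × (writesCells c ≡ false → cells s′ ≡ cells s) × Q s′))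
run-cmd {f} {η} {s = s} c S p = runs-mono (cmd-correct f η c 0 S) ≤-refl λ σ′ (S′ , _) →
  Semantics.run η c s , S′ , (λ eq → Frames.cells-frame η c eq s) , Semantics.wp-sound η c p

-- 7168 = 14 * 512 combines the bound of each stage by `raw` with `raw≤work`; 18 covers booting and
-- the program for graphs without edges.
constant : ℕ
constant = 18 + (size parametersCmd + (size tablesCmd + size searchCmd)) * 7168

18≤constant : 18 ≤ constant
18≤constant = m≤m+n 18 _

module Main (I : Instance) where
  open Instance I
  open Graph G

  xs : List ℕ
  xs = encode I

  edge-cells : ∀ e → contents xs (5 + toℕ e * 3) ≡ toℕ (src e) × contents xs (6 + toℕ e * 3) ≡ toℕ (tgt e) ×
    contents xs (7 + toℕ e * 3) ≡ w e
  edge-cells e = contents-triples (toℕ ∘ src) (toℕ ∘ tgt) w id e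

  xs-length : List.length xs ≡ 5 + m * 3
  xs-length = cong (5 +_) (length-triples (toℕ ∘ src) (toℕ ∘ tgt) w id)

  p q : ℕ
  p = ℤ.∣ ℚ.↥ α ∣
  q = ℚ.↧ₙ α

  Stretch : ℕ → Set
  Stretch a = a * q ≤ p × (a ≡ n ⊎ p < suc a * q)

  choicesFor : ℕ → ℕ
  choicesFor a = suc (W̄ * suc (a + a))

  record Stage₁ (σ : State) : Set where
    field
      {π}       : ℕ → ℕ
      {ρ}       : Array → ℕ → ℕ
      {entry}   : Store
      simulates : Simulates true (env π ρ (5 + m * 3)) σ entry
      num≡      : π NUM ≡ n
      size≡     : π SIZE ≡ m
      goal≡     : π GOAL ≡ W̄
      zeros     : ∀ k a → ρ k a ≡ 0
      cells≡    : cells entry ≡ contents xs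

  record Stage₂ (a : ℕ) (σ : State) : Set where
    field
      {π}       : ℕ → ℕ
      {ρ}       : Array → ℕ → ℕ
      {entry}   : Store
      simulates : Simulates false (env π ρ (5 + m * 3)) σ entry
      num≡      : π NUM ≡ n
      size≡     : π SIZE ≡ m
      goal≡     : π GOAL ≡ W̄
      stretch≡  : π STRETCH ≡ a
      choices≡  : π CHOICES ≡ choicesFor a
      rounds≡   : π ROUNDS ≡ 2 + (m + m + n)
      zeros     : ∀ k a → arrs entry k a ≡ 0
      cells≡    : cells entry ≡ contents xs

  record Stage₃ (a : ℕ) (σ : State) : Set where
    field
      {π}       : ℕ → ℕ
      {ρ}       : Array → ℕ → ℕ
      {entry}   : Store
      simulates : Simulates true (env π ρ (5 + m * 3)) σ entry
      num≡      : π NUM ≡ n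
      size≡     : π SIZE ≡ m
      goal≡     : π GOAL ≡ W̄
      stretch≡  : π STRETCH ≡ a
      choices≡  : π CHOICES ≡ choicesFor a
      rounds≡   : π ROUNDS ≡ 2 + (m + m + n)
      trials≡   : π TRIALS ≡ choicesFor a ^ W̄
      src≡      : ∀ e → ρ SRC (toℕ e) ≡ toℕ (src e)
      tgt≡      : ∀ e → ρ TGT (toℕ e) ≡ toℕ (tgt e)
      weight≡   : ∀ e → ρ WEIGHT (toℕ e) ≡ w e
      src-dummy : ρ SRC m ≡ 0
      tgt-dummy : ρ TGT m ≡ 0
      adjacency : Adjacency m (ρ SRC) (ρ TGT) (ρ HEAD) (ρ NEXT) (ρ TO) (ρ EDGE) (ρ FROM) (m * 2)

  stage₁ : ∀ {σ} → Booted xs σ → Stage₁ σ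
  stage₁ b = record
    { simulates = booted-simulates b ; num≡ = num≡ ; size≡ = size≡ ; goal≡ = goal≡
    -- Memory beyond the input is 0; the second stage relies on this, as these tables become its
    -- arrays.
    ; zeros = λ k a → contents-beyond xs (≤-trans (≤-reflexive xs-length) (address≥bound (5 + m * 3) false k a))
    ; cells≡ = refl }
    where open Booted b

  stage₂ : ∀ {σ} (g : Stage₁ σ) →
    Runs (cmdCode true 0 parametersCmd) σ (time (Stage₁.π g) parametersCmd) (λ σ′ → ∃[ a ] (Stretch a × Stage₂ a σ′))
  stage₂ g = runs-mono (run-cmd parametersCmd {Parameters.Computed π ρ (m * 3) (cells entry 3) (cells entry 4)} simulates (Parameters.parameters-correct π ρ (m * 3))) ≤-refl
    λ σ′ (s′ , S′ , same , computed) →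
    let module C = Parameters.Computed computed in
    vars s′ STRETCH ,
    ( subst (λ c → vars s′ STRETCH * c 4 ≤ c 3) cells≡ C.stretch≤
    , subst₂ (λ c k → vars s′ STRETCH ≡ k ⊎ c 3 < suc (vars s′ STRETCH) * c 4) cells≡ num≡ C.stretch≥ ) ,
    record
      { simulates = swap-stage S′
      ; num≡ = trans C.num≡ num≡ ; size≡ = trans C.size≡ size≡ ; goal≡ = trans C.goal≡ goal≡
      ; stretch≡ = refl
      ; choices≡ = trans C.choices≡ (cong (λ k → suc (k * suc (vars s′ STRETCH + vars s′ STRETCH))) goal≡)
      ; rounds≡ = trans C.rounds≡ (cong₂ (λ M N → 2 + (M + M + N)) size≡ num≡)
      ; zeros = zeros
      ; cells≡ = trans (same refl) cells≡ }
    where open Stage₁ g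

  stage₃ : ∀ {a σ} (g : Stage₂ a σ) → Runs (cmdCode false 0 tablesCmd) σ (time (Stage₂.π g) tablesCmd) (Stage₃ a)
  stage₃ {a} {σ} g = runs-mono (run-cmd tablesCmd {Tables.Tabulated π ρ (cells entry)} simulates′ (Tables.tables-correct π ρ zeros)) ≤-refl
    λ σ′ (s′ , S′ , same , tabulated) →
    let module T = Tables.Tabulated tabulated
        input : ∀ (k : Array) d → (∀ e → e < π SIZE → arrs s′ k e ≡ cells entry (d + e * 3)) →
          ∀ e → arrs s′ k (toℕ e) ≡ contents xs (d + toℕ e * 3)
        input k d eq e = trans (eq (toℕ e) (≤-trans (Finₚ.toℕ<n e) (≤-reflexive (sym size≡)))) (cong (λ c → c (d + toℕ e * 3)) cells≡)
    in record
      { simulates = subst (λ M → Simulates true (env (vars s′) (arrs s′) (5 + M * 3)) σ′ ⟪ π , ρ , cells s′ ⟫) size≡ (swap-stage S′)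
      ; num≡ = trans T.num≡ num≡ ; size≡ = trans T.size≡ size≡ ; goal≡ = trans T.goal≡ goal≡
      ; stretch≡ = trans T.stretch≡ stretch≡ ; choices≡ = trans T.choices≡ choices≡ ; rounds≡ = trans T.rounds≡ rounds≡
      ; trials≡ = trans T.trials≡ (cong₂ _^_ choices≡ goal≡)
      ; src≡ = λ e → trans (input SRC 5 T.src≡ e) (proj₁ (edge-cells e))
      ; tgt≡ = λ e → trans (input TGT 6 T.tgt≡ e) (proj₁ (proj₂ (edge-cells e)))
      ; weight≡ = λ e → trans (input WEIGHT 7 T.weight≡ e) (proj₂ (proj₂ (edge-cells e)))
      ; src-dummy = subst (λ M → arrs s′ SRC M ≡ 0) size≡ T.src-dummy
      ; tgt-dummy = subst (λ M → arrs s′ TGT M ≡ 0) size≡ T.tgt-dummy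
      ; adjacency = subst (λ M → Adjacency M (arrs s′ SRC) (arrs s′ TGT) (arrs s′ HEAD) (arrs s′ NEXT) (arrs s′ TO) (arrs s′ EDGE) (arrs s′ FROM) (M * 2))
          size≡ T.adjacency }
    where
    open Stage₂ g
    simulates′ : Simulates false (env π ρ (5 + π SIZE * 3)) σ entry
    simulates′ = subst (λ M → Simulates false (env π ρ (5 + M * 3)) σ entry) (sym size≡) simulates

  module _ {a σ} (stretch : Stretch a) (0<m : 0 < m) (g : Stage₃ a σ) where
    open Stage₃ g
    open Solutions I (ρ SRC) (ρ TGT) (ρ WEIGHT) a src≡ tgt≡ weight≡ (proj₁ stretch) (proj₂ stretch)
    open Walks G
    open Translation (ρ SRC) (ρ TGT) src≡ tgt≡

    0<n : 0 < n
    0<n = ≤-<-trans z≤n (Finₚ.toℕ<n (src (fromℕ< 0<m)))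

    setup : Setup (env π ρ (5 + m * 3))
    setup = record
      { src<n     = subst₂ (λ N M → ∀ e → e < M → ρ SRC e < N) (sym num≡) (sym size≡) src<n′
      ; tgt<n     = subst₂ (λ N M → ∀ e → e < M → ρ TGT e < N) (sym num≡) (sym size≡) tgt<n′
      ; loopless  = subst (λ M → ∀ e → e < M → ρ SRC e ≢ ρ TGT e) (sym size≡) loopless′
      ; parallel  = λ {e} {f} e< f< → parallel′ (<-≤-trans e< (≤-reflexive size≡)) (<-≤-trans f< (≤-reflexive size≡))
      ; connected = subst₂ (λ N M → ∀ x y → x < N → y < N → ∃[ k ] Graphs.Trail M (ρ SRC) (ρ TGT) (λ _ → 0 ≡ 0) k x y)
          (sym num≡) (sym size≡) (connected′ connected)
      ; adjacency = subst (λ M → Adjacency M (ρ SRC) (ρ TGT) (ρ HEAD) (ρ NEXT) (ρ TO) (ρ EDGE) (ρ FROM) (M * 2)) (sym size≡) adjacency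
      ; rounds    = ≤-reflexive (trans (cong₂ (λ M N → suc (suc (M * 2) + N)) size≡ num≡) (trans (shape m n) (sym rounds≡)))
      ; src-dummy = subst (λ M → ρ SRC M ≡ 0) (sym size≡) src-dummy
      ; tgt-dummy = subst (λ M → ρ TGT M ≡ 0) (sym size≡) tgt-dummy
      ; nonempty  = subst (0 <_) (sym num≡) 0<n
      ; choices   = trans choices≡ (cong₂ (λ k b → suc (k * suc (b + b))) (sym goal≡) (sym stretch≡))
      ; trials    = trans trials≡ (cong₂ _^_ (sym choices≡) (sym goal≡))
      }
      where
      shape : ∀ m n → suc (suc (m * 2) + n) ≡ 2 + (m + m + n)
      shape = solve-∀

    η : Env
    η = env π ρ (5 + m * 3)

    valid-cong : ∀ {M K b r} → M ≡ m → K ≡ W̄ → b ≡ a →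
      (K ≤ WeightedSums.flaggedWeight M (ρ WEIGHT) r ×
        (∀ e → e < M → 0 < r e → Graphs.Bridged M (ρ SRC) (ρ TGT) (λ f → r f ≡ 0) b e)) → Valid r
    valid-cong refl refl refl v = v

    valid-cong⁻ : ∀ {M K b r} → M ≡ m → K ≡ W̄ → b ≡ a → Valid r →
      (K ≤ WeightedSums.flaggedWeight M (ρ WEIGHT) r ×
        (∀ e → e < M → 0 < r e → Graphs.Bridged M (ρ SRC) (ρ TGT) (λ f → r f ≡ 0) b e))
    valid-cong⁻ refl refl refl v = v

    answer⇒output : ∀ {σ′ s′} → Simulates true η σ′ s′ → Searching.Answer η setup s′ → CorrectOutput I σ′
    answer⇒output {σ′} {s′} S (inj₁ (yes≡ , r , good , ≤1 , wit)) = inj₁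
      ( trans (Simulates.cells≈ S 0 z<s) yes≡
      , retained r , valid⇒solution (valid-cong size≡ goal≡ stretch≡ good)
      , λ e → trans (Simulates.cells≈ S (suc (toℕ e)) (s≤s (≤-trans (Finₚ.toℕ<n e) (≤-trans (m≤m*n m 3) (m≤n+m (m * 3) 4)))))
                (trans (wit (toℕ e) (e<M e)) (retained-output {r} e (≤1 (toℕ e) (e<M e)))) )
      where
      e<M : ∀ e → toℕ e < π SIZE
      e<M e = ≤-trans (Finₚ.toℕ<n e) (≤-reflexive (sym size≡))
    answer⇒output S (inj₂ (no≡ , none)) = inj₂
      ( trans (Simulates.cells≈ S 0 z<s) no≡
      , λ (F , solution) → none (removed F , valid-cong⁻ size≡ goal≡ stretch≡ (solution⇒valid solution)) )

    final : Runs (cmdCode true 0 searchCmd) σ (time π searchCmd) (CorrectOutput I)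
    final = runs-mono (run-cmd searchCmd {Searching.Answer η setup} simulates (Searching.search-correct η setup room)) ≤-refl
      λ σ′ (s′ , S′ , _ , answer) → answer⇒output S′ answer
      where
      room : π SIZE < 5 + m * 3
      room = ≤-trans (s≤s (≤-reflexive size≡)) (s≤s (≤-trans (m≤m*n m 3) (m≤n+m (m * 3) 4)))

  -- The time is bounded over the natural numbers, for some `a` not exceeding α; both complexity
  -- claims follow by monotonicity.
  Solved : Set
  Solved = ∃[ a ] (a * q ≤ p × Runs solver (initial xs) (constant * suc (work n m W̄ a)) (CorrectOutput I))

  total-time : ∀ {a σ₀ σ₁ σ₂ t₀ t₁ t₂ t₃} → 0 < m → Stretch a → (g₁ : Stage₁ σ₀) (g₂ : Stage₂ a σ₁) (g₃ : Stage₃ a σ₂) →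
    t₀ ≤ 10 → t₁ ≤ time (Stage₁.π g₁) parametersCmd → t₂ ≤ time (Stage₂.π g₂) tablesCmd → t₃ ≤ time (Stage₃.π g₃) searchCmd →
    t₀ + suc (t₁ + (t₂ + t₃)) ≤ constant * suc (work n m W̄ a)
  total-time {a} {t₀ = t₀} {t₁} {t₂} {t₃} 0<m stretch g₁ g₂ g₃ t₀≤ t₁≤ t₂≤ t₃≤ = bounded
    where
    module G₁ = Stage₁ g₁
    module G₂ = Stage₂ g₂
    module G₃ = Stage₃ g₃
    0<a : 0 < a
    0<a = Solutions.1≤A I (Stage₃.ρ g₃ SRC) (Stage₃.ρ g₃ TGT) (Stage₃.ρ g₃ WEIGHT) a G₃.src≡ G₃.tgt≡ G₃.weight≡ (proj₁ stretch) (proj₂ stretch) (0<n stretch 0<m g₃)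
    open WorkBound {n} {m} {W̄} {a} 0<m (0<n stretch 0<m g₃) (Walks.vertices≤ends G connected 0<m) 0<a
    X : ℕ
    X = work n m W̄ a
    scale : ∀ k → k * (14 * raw) ≤ k * 7168 * suc X
    scale k = begin
      k * (14 * raw)        ≤⟨ *-monoʳ-≤ k (*-monoʳ-≤ 14 raw≤work) ⟩
      k * (14 * (512 * X))  ≡⟨ regroup k 14 512 X ⟩
      k * 7168 * X          ≤⟨ *-monoʳ-≤ (k * 7168) (n≤1+n X) ⟩
      k * 7168 * suc X      ∎
      where
      open ≤-Reasoning
      regroup : ∀ k b c x → k * (b * (c * x)) ≡ k * (b * c) * x
      regroup = solve-∀
    time₁ : t₁ ≤ size parametersCmd * 7168 * suc X
    time₁ = ≤-trans t₁≤ (≤-trans (time≤ {G₁.π} {parametersCmd} (parameters-within {π = G₁.π} G₁.num≡ G₁.goal≡)) (scale (size parametersCmd)))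
    time₂ : t₂ ≤ size tablesCmd * 7168 * suc X
    time₂ = ≤-trans t₂≤ (≤-trans (time≤ {G₂.π} {tablesCmd} (tables-within {π = G₂.π} G₂.size≡ G₂.goal≡ G₂.choices≡)) (scale (size tablesCmd)))
    time₃ : t₃ ≤ size searchCmd * 7168 * suc X
    time₃ = ≤-trans t₃≤ (≤-trans (time≤ {G₃.π} {searchCmd} (search-within {π = G₃.π} G₃.num≡ G₃.size≡ G₃.goal≡ G₃.choices≡ G₃.rounds≡ G₃.trials≡)) (scale (size searchCmd)))
    total : ∀ x y z c Y → 18 * Y + (x * c * Y + (y * c * Y + z * c * Y)) ≡ (18 + (x + (y + z)) * c) * Y
    total = solve-∀
    bounded : t₀ + suc (t₁ + (t₂ + t₃)) ≤ constant * suc X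
    bounded = begin
      t₀ + suc (t₁ + (t₂ + t₃))  ≡⟨ +-suc t₀ _ ⟩
      suc t₀ + (t₁ + (t₂ + t₃))  ≤⟨ +-mono-≤ (≤-trans (s≤s t₀≤) (≤-trans (m≤m+n 11 7) (m≤m*n 18 (suc X)))) (+-mono-≤ time₁ (+-mono-≤ time₂ time₃)) ⟩
      18 * suc X + (size parametersCmd * 7168 * suc X + (size tablesCmd * 7168 * suc X + size searchCmd * 7168 * suc X))
        ≡⟨ total (size parametersCmd) (size tablesCmd) (size searchCmd) 7168 (suc X) ⟩
      constant * suc X           ∎
      where open ≤-Reasoning

  solve-nonempty : 0 < m → Solved
  solve-nonempty 0<m = from-boot (boot-correct xs)
    where
    from-search : ∀ {a σ₀ σ₁ σ₂ t₀ t₁ t₂} → Stretch a → (b : Booted xs σ₀) (g₁ : Stage₁ σ₀) (g₂ : Stage₂ a σ₁) (g₃ : Stage₃ a σ₂) →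
      t₀ ≤ 10 → t₁ ≤ time (Stage₁.π g₁) parametersCmd → t₂ ≤ time (Stage₂.π g₂) tablesCmd →
      boot , initial xs ⇓[ t₀ ] σ₀ → cmdCode true 0 parametersCmd , σ₀ ⇓[ t₁ ] σ₁ → cmdCode false 0 tablesCmd , σ₁ ⇓[ t₂ ] σ₂ →
      Runs (cmdCode true 0 searchCmd) σ₂ (time (Stage₃.π g₃) searchCmd) (CorrectOutput I) → Solved
    from-search stretch b g₁ g₂ g₃ t₀≤ t₁≤ t₂≤ r₀ r₁ r₂ (_ , _ , r₃ , t₃≤ , output) =
      _ , proj₁ stretch , _ , _ ,
      ⇓seq r₀ (⇓then (λ eq → <⇒≢ 0<m (sym (trans (sym (Booted.size≡ b)) eq))) (⇓seq r₁ (⇓seq r₂ r₃))) ,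
      total-time 0<m stretch g₁ g₂ g₃ t₀≤ t₁≤ t₂≤ t₃≤ , output
    from-tables : ∀ {a σ₀ σ₁ t₀ t₁} → Stretch a → (b : Booted xs σ₀) (g₁ : Stage₁ σ₀) (g₂ : Stage₂ a σ₁) →
      t₀ ≤ 10 → t₁ ≤ time (Stage₁.π g₁) parametersCmd →
      boot , initial xs ⇓[ t₀ ] σ₀ → cmdCode true 0 parametersCmd , σ₀ ⇓[ t₁ ] σ₁ →
      Runs (cmdCode false 0 tablesCmd) σ₁ (time (Stage₂.π g₂) tablesCmd) (Stage₃ a) → Solved
    from-tables stretch b g₁ g₂ t₀≤ t₁≤ r₀ r₁ (_ , _ , r₂ , t₂≤ , g₃) =
      from-search stretch b g₁ g₂ g₃ t₀≤ t₁≤ t₂≤ r₀ r₁ r₂ (final stretch 0<m g₃)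
    from-parameters : ∀ {σ₀ t₀} (b : Booted xs σ₀) (g₁ : Stage₁ σ₀) → t₀ ≤ 10 → boot , initial xs ⇓[ t₀ ] σ₀ →
      Runs (cmdCode true 0 parametersCmd) σ₀ (time (Stage₁.π g₁) parametersCmd) (λ σ₁ → ∃[ a ] (Stretch a × Stage₂ a σ₁)) → Solved
    from-parameters b g₁ t₀≤ r₀ (_ , _ , r₁ , t₁≤ , a , stretch , g₂) =
      from-tables stretch b g₁ g₂ t₀≤ t₁≤ r₀ r₁ (stage₃ g₂)
    from-boot : Runs boot (initial xs) 10 (Booted xs) → Solved
    from-boot (_ , _ , r₀ , t₀≤ , b) = from-parameters b (stage₁ b) t₀≤ r₀ (stage₂ (stage₁ b))

  no-edges : m ≡ 0 → ∀ X → weight w X ≡ 0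
  no-edges m≡0 = weightless m≡0 w
    where
    weightless : ∀ {k} → k ≡ 0 → ∀ (w : Fin k → ℕ) X → weight w X ≡ 0
    weightless refl w X = refl

  everything-spans : IsSpanner G unitLength α ⊤
  everything-spans u v d dist = d , dist , subst (ℚ._≤ α ℚ.* fromℕ d) (ℚₚ.*-identityˡ (fromℕ d))
    (ℚₚ.*-monoʳ-≤-nonNeg (fromℕ d) {{ℚ.nonNegative (fromℕ≥0 d)}} 1≤α)

  -- No weight can be removed, so the answer depends only on whether `W̄` is 0. The run takes
  -- constant time, for which the stretch 0 will do.
  solve-empty : m ≡ 0 → Solved
  solve-empty m≡0 = from-boot (boot-correct xs)
    where
    from-boot : Runs boot (initial xs) 10 (Booted xs) → Solved
    from-boot (t₀ , σ₀ , r₀ , t₀≤ , b) = from-trivial (trivial-correct σ₀)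
      where
      from-trivial : Runs trivialProgram σ₀ 4
        (λ σ′ → (reg σ₀ (R 2 GOAL) ≡ 0 → mem σ′ 0 ≡ 1) × (reg σ₀ (R 2 GOAL) ≢ 0 → mem σ′ 0 ≡ 0)) → Solved
      from-trivial (t₁ , σ₁ , r₁ , t₁≤ , yes-case , no-case) =
        0 , z≤n , t₀ + suc t₁ , σ₁ ,
        ⇓seq r₀ (⇓else (trans (Booted.size≡ b) m≡0) r₁) ,
        (begin
          t₀ + suc t₁                              ≤⟨ +-mono-≤ t₀≤ (s≤s t₁≤) ⟩
          15                                       ≤⟨ m≤m+n 15 3 ⟩
          18                                       ≤⟨ *-monoʳ-≤ 18 (s≤s (z≤n {X})) ⟩
          18 * suc X                               ≤⟨ *-monoˡ-≤ (suc X) 18≤constant ⟩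
          constant * suc X                         ∎) ,
        output (W̄ ≟ 0)
        where
        open ≤-Reasoning
        X : ℕ
        X = work n m W̄ 0
        output : Dec (W̄ ≡ 0) → CorrectOutput I σ₁
        output (yes W̄≡0) = inj₁ (yes-case (trans (Booted.goal≡ b) W̄≡0) , ⊤ ,
          (everything-spans , ≤-trans (≤-reflexive W̄≡0) z≤n) , λ e → contradiction (subst Fin m≡0 e) λ ())
        output (no W̄≢0) = inj₂ (no-case (λ eq → W̄≢0 (trans (sym (Booted.goal≡ b)) eq)) ,
          λ (F , _ , weight≥) → W̄≢0 (n≤0⇒n≡0 (≤-trans weight≥ (≤-reflexive (no-edges m≡0 (∁ F))))))

  solve : Solved
  solve = by-size (m ≟ 0)
    where
    by-size : Dec (m ≡ 0) → Solved
    by-size (yes m≡0) = solve-empty m≡0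
    by-size (no m≢0)  = solve-nonempty (n≢0⇒n>0 m≢0)

-- Complexity

runs-in-O : ∀ g → (∀ I a → let open Instance I in a * ℚ.↧ₙ α ≤ ℤ.∣ ℚ.↥ α ∣ → fromℕ (work n m W̄ a) ℚ.≤ g I) →
  RunsInO g solver
runs-in-O g work≤ = constant , λ I → bounded I (Main.solve I)
  where
  bounded : ∀ I → Main.Solved I → ∃[ t ] ∃[ σ ] (solver , initial (encode I) ⇓[ t ] σ × fromℕ t ℚ.≤ fromℕ constant ℚ.* (g I ℚ.+ 1ℚ))
  bounded I (a , a≤ , t , σ , r , t≤ , _) = t , σ , r , (begin
    fromℕ t                                   ≤⟨ fromℕ-mono-≤ {t} {constant * suc X} t≤ ⟩
    fromℕ (constant * suc X)                  ≡⟨ fromℕ-* constant (suc X) ⟩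
    fromℕ constant ℚ.* fromℕ (suc X)          ≡⟨ cong (λ x → fromℕ constant ℚ.* fromℕ x) (+-comm 1 X) ⟩
    fromℕ constant ℚ.* fromℕ (X + 1)          ≡⟨ cong (fromℕ constant ℚ.*_) (fromℕ-+ X 1) ⟩
    fromℕ constant ℚ.* (fromℕ X ℚ.+ 1ℚ)       ≤⟨ ℚₚ.*-monoˡ-≤-nonNeg (fromℕ constant) {{ℚ.nonNegative (fromℕ≥0 constant)}}
                                                   (ℚₚ.+-monoˡ-≤ 1ℚ (work≤ I a a≤)) ⟩
    fromℕ constant ℚ.* (g I ℚ.+ 1ℚ)           ∎)
    where
    open Instance I
    open ℚₚ.≤-Reasoning
    X : ℕ
    X = work n m W̄ a

fromℕ-^ : ∀ x k → fromℕ (x ^ k) ≡ fromℕ x ^ℚ k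
fromℕ-^ x zero    = refl
fromℕ-^ x (suc k) = trans (fromℕ-* x (x ^ k)) (cong (fromℕ x ℚ.*_) (fromℕ-^ x k))

^ℚ-nonneg : ∀ {x} k → 0ℚ ℚ.≤ x → 0ℚ ℚ.≤ x ^ℚ k
^ℚ-nonneg zero        0≤x = fromℕ-mono-≤ {0} {1} z≤n
^ℚ-nonneg {x} (suc k) 0≤x = *-mono-≤ℚ {0ℚ} {x} {0ℚ} {x ^ℚ k} ℚₚ.≤-refl (^ℚ-nonneg k 0≤x) 0≤x (^ℚ-nonneg k 0≤x)

^ℚ-mono-≤ : ∀ {x y} k → 0ℚ ℚ.≤ x → x ℚ.≤ y → x ^ℚ k ℚ.≤ y ^ℚ k
^ℚ-mono-≤ zero    0≤x x≤y = ℚₚ.≤-refl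
^ℚ-mono-≤ (suc k) 0≤x x≤y = *-mono-≤ℚ 0≤x (^ℚ-nonneg k (ℚₚ.≤-trans 0≤x x≤y)) x≤y (^ℚ-mono-≤ k 0≤x x≤y)

work≤timeBound : ∀ I a → let open Instance I in a * ℚ.↧ₙ α ≤ ℤ.∣ ℚ.↥ α ∣ → fromℕ (work n m W̄ a) ℚ.≤ timeBound I
work≤timeBound I a a≤ = begin
  fromℕ (w₁ * a₁ * m + n * m)                     ≡⟨ fromℕ-+ (w₁ * a₁ * m) (n * m) ⟩
  fromℕ (w₁ * a₁ * m) ℚ.+ fromℕ (n * m)           ≡⟨ cong (ℚ._+ fromℕ (n * m)) (trans (fromℕ-* (w₁ * a₁) m) (cong (ℚ._* fromℕ m) (fromℕ-* w₁ a₁))) ⟩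
  fromℕ w₁ ℚ.* fromℕ a₁ ℚ.* fromℕ m ℚ.+ fromℕ (n * m)
    ≡⟨ cong₂ (λ x y → x ℚ.* y ℚ.* fromℕ m ℚ.+ fromℕ (n * m)) (fromℕ-^ W̄ (2 * W̄ + 1)) (fromℕ-^ a (2 * W̄)) ⟩
  fromℕ W̄ ^ℚ (2 * W̄ + 1) ℚ.* fromℕ a ^ℚ (2 * W̄) ℚ.* fromℕ m ℚ.+ fromℕ (n * m)
    ≤⟨ ℚₚ.+-monoˡ-≤ (fromℕ (n * m)) (ℚₚ.*-monoʳ-≤-nonNeg (fromℕ m) {{ℚ.nonNegative (fromℕ≥0 m)}}
         (ℚₚ.*-monoˡ-≤-nonNeg (fromℕ W̄ ^ℚ (2 * W̄ + 1)) {{ℚ.nonNegative (^ℚ-nonneg (2 * W̄ + 1) (fromℕ≥0 W̄))}}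
           (^ℚ-mono-≤ (2 * W̄) (fromℕ≥0 a) (fromℕ≤⁺ {a} (ℚₚ.≤-trans (fromℕ-mono-≤ {0} {1} z≤n) 1≤α) a≤)))) ⟩
  timeBound I                                     ∎
  where
  open Instance I
  open ℚₚ.≤-Reasoning
  w₁ a₁ : ℕ
  w₁ = W̄ ^ (2 * W̄ + 1)
  a₁ = a ^ (2 * W̄)

-- Fixed-parameter tractability: a computable bound

double : ℕ → Cmd
double x = x ≔ var x ⊕ var x

-- For the input of `parameterBound`, `boot` leaves W and the numerator of α in `NUM` and `SIZE`.
-- Each round of the outer loop doubles 1 + 2W + 2p times.
powerCmd : Cmd
powerCmd =
  SUM ≔ lit 1 ﹔
  for NUM
    ( double SUM ﹔
      for NUM ( double SUM ﹔ double SUM ) ﹔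
      for SIZE ( double SUM ﹔ double SUM ) ) ﹔
  out (lit 0) (var SUM)

exponent : ℕ → ℕ → ℕ
exponent w p = suc (w * 2 + p * 2)

-- A power of 2, since the machine can compute it by doublings. It arises from W ≤ 2^W and a ≤ p ≤
-- 2^p, where p is the numerator of α: W^(2W+1) a^(2W) is at most 2 to the power W (2W + 1) + 2pW.
parameterBound : Vec ℕ 3 → ℕ
parameterBound (w ∷ p ∷ _ ∷ []) = 2 ^ (w * exponent w p)

double-power : ∀ {x} k → x ≡ 2 ^ k → x + x ≡ 2 ^ suc k
double-power k refl = cong (2 ^ k +_) (sym (+-identityʳ (2 ^ k)))

power-correct : ∀ η {s} → 0 < bound η →
  Semantics.wp η powerCmd (λ s′ → cells s′ 0 ≡ 2 ^ (params η NUM * exponent (params η NUM) (params η SIZE))) s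
power-correct η 0<β =
  wp-for NUM _ (λ i s′ → vars s′ SUM ≡ 2 ^ (i * exponent w p)) refl
    (λ i s′ _ eq →
      wp-for NUM _ (λ j s″ → vars s″ SUM ≡ 2 ^ (j * 2 + suc (i * exponent w p))) (double-power (i * exponent w p) eq)
        (λ j s″ _ eq → double-power (suc (j * 2 + suc (i * exponent w p))) (double-power (j * 2 + suc (i * exponent w p)) eq))
      λ s₁ eq →
      wp-for SIZE _ (λ j s″ → vars s″ SUM ≡ 2 ^ (j * 2 + (w * 2 + suc (i * exponent w p)))) eq
        (λ j s″ _ eq → double-power (suc (j * 2 + (w * 2 + suc (i * exponent w p)))) (double-power (j * 2 + (w * 2 + suc (i * exponent w p))) eq))
      λ s₂ eq → trans eq (cong (2 ^_) (rearrange (w * 2) (p * 2) (i * exponent w p))))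
    λ s′ eq → trans (write-first s′ (vars s′ SUM)) eq
  where
  open Semantics η
  w p : ℕ
  w = params η NUM
  p = params η SIZE
  rearrange : ∀ x y z → y + (x + suc z) ≡ suc (x + y) + z
  rearrange = solve-∀
  write-first : ∀ s v → cells (setCell 0 v s) 0 ≡ v
  write-first s v rewrite dec-true (0 <? bound η) 0<β = refl

parameterBound-computable : Computable parameterBound
parameterBound-computable = boot ⨾ cmdCode true 0 powerCmd , computes
  where
  Computes : List ℕ → ℕ → Set
  Computes xs v = ∃[ t ] ∃[ σ ] (boot ⨾ cmdCode true 0 powerCmd , initial xs ⇓[ t ] σ × mem σ 0 ≡ v)
  from-power : ∀ {xs σ t T η v} → bound η ≡ 5 + contents xs 1 * 3 → boot , initial xs ⇓[ t ] σ →
    Runs (cmdCode true 0 powerCmd) σ T (λ σ′ → ∃[ s′ ] (Simulates true η σ′ s′ × cells s′ 0 ≡ v)) →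
    Computes xs v
  from-power β≡ r (t′ , σ′ , r′ , _ , s′ , S , eq) = _ , σ′ , ⇓seq r r′ ,
    trans (Simulates.cells≈ S 0 (≤-trans z<s (≤-reflexive (sym β≡)))) eq
  from-boot : ∀ xs → Runs boot (initial xs) 10 (Booted xs) →
    Computes xs (2 ^ (contents xs 0 * exponent (contents xs 0) (contents xs 1)))
  from-boot xs (t , σ , r , _ , b) = subst (Computes xs)
    (cong₂ (λ x y → 2 ^ (x * exponent x y)) (Booted.num≡ b) (Booted.size≡ b))
    (from-power {xs} {σ} refl r (runs-mono (run-cmd powerCmd (booted-simulates {xs} {σ} b) (power-correct _ z<s)) ≤-refl
      λ σ′ (s′ , S , _ , eq) → s′ , S , eq))
  computes : ∀ v → Computes (Vec.toList v) (parameterBound v)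
  computes (w ∷ p ∷ q ∷ []) = from-boot (w ∷ p ∷ q ∷ []) (boot-correct (w ∷ p ∷ q ∷ []))

n≤2^n : ∀ n → n ≤ 2 ^ n
n≤2^n zero    = z≤n
n≤2^n (suc n) = ≤-trans (+-mono-≤ (≢0⇒1≤ (m^n≢0 2 n)) (n≤2^n n)) (≤-reflexive (cong (2 ^ n +_) (sym (+-identityʳ (2 ^ n)))))
  where
  ≢0⇒1≤ : ∀ {x} → NonZero x → 1 ≤ x
  ≢0⇒1≤ {suc _} _ = s≤s z≤n

-- The polynomial is x + 2x^2: every number of the encoding has at least one bit, so m ≤ x, and nm ≤
-- 2m^2 as every vertex is an end of an edge unless m = 0.
work≤FPT : ∀ I a → let open Instance I in a * ℚ.↧ₙ α ≤ ℤ.∣ ℚ.↥ α ∣ →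
  work n m W̄ a ≤ parameterBound (parameter I) * evalPoly (0 ∷ 1 ∷ 2 ∷ []) (encodingLength I)
work≤FPT I a a≤ = begin
  W̄ ^ (2 * W̄ + 1) * a ^ (2 * W̄) * m + n * m ≤⟨ +-mono-≤ (*-monoˡ-≤ m powers≤) n*m≤ ⟩
  f * m + 2 * (m * m)                         ≤⟨ +-mono-≤ (*-monoʳ-≤ f m≤x) (≤-trans (*-monoʳ-≤ 2 (*-mono-≤ m≤x m≤x)) (m≤n*m (2 * (x * x)) f {{m^n≢0 2 (W̄ * exponent W̄ p)}})) ⟩
  f * x + f * (2 * (x * x))                   ≡⟨ polynomial f x ⟩
  f * evalPoly (0 ∷ 1 ∷ 2 ∷ []) x             ∎
  where
  open Instance I
  open ≤-Reasoning
  p f x : ℕ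
  p = ℤ.∣ ℚ.↥ α ∣
  f = 2 ^ (W̄ * exponent W̄ p)
  x = encodingLength I
  polynomial : ∀ f x → f * x + f * (2 * (x * x)) ≡ f * (0 + x * (1 + x * (2 + x * 0)))
  polynomial = solve-∀
  m≤x : m ≤ x
  m≤x = begin
    m                          ≤⟨ m≤m*n m 3 ⟩
    m * 3                      ≤⟨ m≤n+m (m * 3) 5 ⟩
    5 + m * 3                  ≡⟨ Main.xs-length I ⟨
    List.length (encode I)     ≡⟨ *-identityʳ _ ⟨
    List.length (encode I) * 1 ≤⟨ sum-map-≥ (λ y → suc ⌊log₂ y ⌋) 1 (encode I) (λ _ → s≤s z≤n) ⟩
    x                          ∎
  n*m≤ : n * m ≤ 2 * (m * m)
  n*m≤ with m ≟ 0
  ... | yes m≡0 = ≤-trans (≤-reflexive (trans (cong (n *_) m≡0) (*-zeroʳ n))) z≤n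
  ... | no m≢0  = ≤-trans (*-monoˡ-≤ m (Walks.vertices≤ends G connected (n≢0⇒n>0 m≢0))) (≤-reflexive (square m))
    where
    square : ∀ m → (m + m) * m ≡ 2 * (m * m)
    square = solve-∀
  powers≤ : W̄ ^ (2 * W̄ + 1) * a ^ (2 * W̄) ≤ f
  powers≤ = begin
    W̄ ^ (2 * W̄ + 1) * a ^ (2 * W̄)
      ≤⟨ *-mono-≤ (^-monoˡ-≤ (2 * W̄ + 1) (n≤2^n W̄)) (^-monoˡ-≤ (2 * W̄) (≤-trans (≤-trans (m≤m*n a (ℚ.↧ₙ α)) a≤) (n≤2^n p))) ⟩
    (2 ^ W̄) ^ (2 * W̄ + 1) * (2 ^ p) ^ (2 * W̄) ≡⟨ cong₂ _*_ (^-*-assoc 2 W̄ (2 * W̄ + 1)) (^-*-assoc 2 p (2 * W̄)) ⟩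
    2 ^ (W̄ * (2 * W̄ + 1)) * 2 ^ (p * (2 * W̄)) ≡⟨ ^-distribˡ-+-* 2 (W̄ * (2 * W̄ + 1)) (p * (2 * W̄)) ⟨
    2 ^ (W̄ * (2 * W̄ + 1) + p * (2 * W̄))       ≡⟨ cong (2 ^_) (exponents W̄ p) ⟩
    f                                           ∎
    where
    exponents : ∀ w p → w * (2 * w + 1) + p * (2 * w) ≡ w * suc (w * 2 + p * 2)
    exponents = solve-∀

solver-correct : SolvesSpanner solver
solver-correct I = correct (Main.solve I)
  where
  correct : Main.Solved I → ∃[ t ] ∃[ σ ] (solver , initial (encode I) ⇓[ t ] σ × CorrectOutput I σ)
  correct (_ , _ , t , σ , r , _ , output) = t , σ , r , output

solver-FPT : IsFPT parameter solver
solver-FPT = parameterBound , 0 ∷ 1 ∷ 2 ∷ [] , parameterBound-computable ,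
  runs-in-O
    (λ I → fromℕ (parameterBound (parameter I) * evalPoly (0 ∷ 1 ∷ 2 ∷ []) (encodingLength I)))
    λ I a a≤ → let open Instance I in
      fromℕ-mono-≤ {work n m W̄ a} {parameterBound (parameter I) * evalPoly (0 ∷ 1 ∷ 2 ∷ []) (encodingLength I)} (work≤FPT I a a≤)

corollary5 : ∃[ P ] (SolvesSpanner P × IsFPT parameter P × RunsInO timeBound P)
corollary5 = solver , solver-correct , solver-FPT , runs-in-O timeBound work≤timeBound
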